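{- Let $M\in\mathbb{R}^{m\times m}$ be a diagonally dominant and approximately lower triangular matrix in the following sense: $$|M_{j,i}|\le\epsilon\cdot|M_{i,i}|\qquad\text{for all }1\le j<i\le m.$$ Then there is a universal constant $C>0$ (independent of $M$, $m$ and $\epsilon$) such that $$\mathrm{rank}(M)\ \ge\ C\cdot\min\left\{\left(\frac{1}{\epsilon\log\frac1\epsilon}\right)^2,\ \frac{m}{\log m}\right\}.$$
   Context: $M_{j,i}$ denotes the entry of $M$ in row $j$ and column $i$. "Diagonally dominant" means here that in each column the diagonal entry is largest in absolute value: $|M_{j,i}|\le|M_{i,i}|$ for all $1\le i,j\le m$. The parameter $\epsilon>0$ measures the size of the entries above the diagonal relative to the diagonal entry of the same column.
   Formalization: Proved for m ≥ 2, 0 < ε ≤ 1/2 and M with nonzero diagonal entries; as written the claim fails for M = 0 and for ε near 1 (the rank-2 matrix cos((j−k)π/m) with ε = cos(π/m)), and m/log m is undefined at m = 1. -}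

module Defs where

open import Algebra.Bundles using (RawRing)
import Data.Fin as Fin
open import Data.Fin using (Fin)
open import Data.Integer using (+_)
open import Data.Nat as ℕ using (ℕ; suc; _⊔_)
import Data.Nat.Properties as ℕ
open import Data.Product using (Σ; ∃; _×_; _,_)
open import Data.Rational as ℚ using (ℚ; 0ℚ; 1ℚ; ½; Positive)
import Data.Rational.Properties as ℚ
open import Data.Rational.Solver using (module +-*-Solver)
open import Data.Sum using (inj₁; inj₂)
open import Data.Vec.Functional using (Vector)
open import Level using (0ℓ)
open import Relation.Binary.PropositionalEquality
open import Relation.Nullary using (¬_)

-- "For all sufficiently large n".
Eventually : (ℕ → Set) → Set
Eventually P = ∃ λ N → ∀ n → N ℕ.≤ n → P n

IsCauchy : (ℕ → ℚ) → Set
IsCauchy s = ∀ δ → 0ℚ ℚ.< δ →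
  ∃ λ N → ∀ m n → N ℕ.≤ m → N ℕ.≤ n → ℚ.∣ s m ℚ.- s n ∣ ℚ.≤ δ

-- Real numbers are Cauchy sequences of rationals, considered up to the
-- equivalence _≈_ below.
record ℝ : Set where
  constructor mkℝ
  field
    seq    : ℕ → ℚ
    cauchy : IsCauchy seq

open ℝ public

private
  ½+½ : ∀ δ → ½ ℚ.* δ ℚ.+ ½ ℚ.* δ ≡ δ
  ½+½ δ = trans (sym (ℚ.*-distribʳ-+ δ ½ ½)) (ℚ.*-identityˡ δ)

  pos* : ∀ {p q} → 0ℚ ℚ.< p → 0ℚ ℚ.< q → 0ℚ ℚ.< p ℚ.* q
  pos* {p} {q} 0<p 0<q =
    ℚ.positive⁻¹ (p ℚ.* q) {{ℚ.pos*pos⇒pos p {{ℚ.positive 0<p}} q {{ℚ.positive 0<q}}}}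

  0<½ : 0ℚ ℚ.< ½
  0<½ = ℚ.positive⁻¹ ½

  0<1 : 0ℚ ℚ.< 1ℚ
  0<1 = ℚ.positive⁻¹ 1ℚ

  p≤∣p∣ : ∀ p → p ℚ.≤ ℚ.∣ p ∣
  p≤∣p∣ p with ℚ.≤-total 0ℚ p
  ... | inj₁ 0≤p = ℚ.≤-reflexive (sym (ℚ.0≤p⇒∣p∣≡p 0≤p))
  ... | inj₂ p≤0 = ℚ.≤-trans p≤0 (ℚ.0≤∣p∣ p)

  ∣-∣-comm : ∀ p q → ℚ.∣ p ℚ.- q ∣ ≡ ℚ.∣ q ℚ.- p ∣
  ∣-∣-comm p q = trans (sym (ℚ.∣-p∣≡∣p∣ (p ℚ.- q))) (cong ℚ.∣_∣
    (solve 2 (λ a b → :- (a :- b) := b :- a) refl p q))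
    where
    open +-*-Solver

  p≤q+∣p-q∣ : ∀ p q → p ℚ.≤ q ℚ.+ ℚ.∣ p ℚ.- q ∣
  p≤q+∣p-q∣ p q = begin
    p                      ≡⟨ solve 2 (λ a b → a := b :+ (a :- b)) refl p q ⟩
    q ℚ.+ (p ℚ.- q)        ≤⟨ ℚ.+-monoʳ-≤ q (p≤∣p∣ (p ℚ.- q)) ⟩
    q ℚ.+ ℚ.∣ p ℚ.- q ∣    ∎
    where
    open ℚ.≤-Reasoning
    open +-*-Solver

  ∣-∣≤ : ∀ p q d → p ℚ.≤ q ℚ.+ d → q ℚ.≤ p ℚ.+ d → ℚ.∣ p ℚ.- q ∣ ℚ.≤ d
  ∣-∣≤ p q d p≤ q≤ with ℚ.∣p∣≡p∨∣p∣≡-p (p ℚ.- q)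
  ... | inj₁ eq = begin
    ℚ.∣ p ℚ.- q ∣      ≡⟨ eq ⟩
    p ℚ.- q            ≤⟨ ℚ.+-monoˡ-≤ (ℚ.- q) p≤ ⟩
    q ℚ.+ d ℚ.- q      ≡⟨ solve 2 (λ b c → b :+ c :- b := c) refl q d ⟩
    d                  ∎
    where
    open ℚ.≤-Reasoning
    open +-*-Solver
  ... | inj₂ eq = begin
    ℚ.∣ p ℚ.- q ∣      ≡⟨ eq ⟩
    ℚ.- (p ℚ.- q)      ≡⟨ solve 2 (λ a b → :- (a :- b) := b :- a) refl p q ⟩
    q ℚ.- p            ≤⟨ ℚ.+-monoˡ-≤ (ℚ.- p) q≤ ⟩
    p ℚ.+ d ℚ.- p      ≡⟨ solve 2 (λ b c → b :+ c :- b := c) refl p d ⟩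
    d                  ∎
    where
    open ℚ.≤-Reasoning
    open +-*-Solver

  ∣-∣-nonExpansive : ∀ p q → ℚ.∣ ℚ.∣ p ∣ ℚ.- ℚ.∣ q ∣ ∣ ℚ.≤ ℚ.∣ p ℚ.- q ∣
  ∣-∣-nonExpansive p q = ∣-∣≤ _ _ _ (half p q)
    (subst (λ d → ℚ.∣ q ∣ ℚ.≤ ℚ.∣ p ∣ ℚ.+ d) (∣-∣-comm q p) (half q p))
    where
    open ℚ.≤-Reasoning
    open +-*-Solver
    half : ∀ a b → ℚ.∣ a ∣ ℚ.≤ ℚ.∣ b ∣ ℚ.+ ℚ.∣ a ℚ.- b ∣
    half a b = begin
      ℚ.∣ a ∣                        ≡⟨ cong ℚ.∣_∣ (solve 2 (λ a b → a := b :+ (a :- b)) refl a b) ⟩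
      ℚ.∣ b ℚ.+ (a ℚ.- b) ∣          ≤⟨ ℚ.∣p+q∣≤∣p∣+∣q∣ b (a ℚ.- b) ⟩
      ℚ.∣ b ∣ ℚ.+ ℚ.∣ a ℚ.- b ∣      ∎

  +-lipschitz : ∀ a b c d →
    ℚ.∣ (a ℚ.+ b) ℚ.- (c ℚ.+ d) ∣ ℚ.≤ ℚ.∣ a ℚ.- c ∣ ℚ.+ ℚ.∣ b ℚ.- d ∣
  +-lipschitz a b c d = begin
    ℚ.∣ (a ℚ.+ b) ℚ.- (c ℚ.+ d) ∣        ≡⟨ cong ℚ.∣_∣ (solve 4 (λ a b c d →
        (a :+ b) :- (c :+ d) := (a :- c) :+ (b :- d)) refl a b c d) ⟩
    ℚ.∣ (a ℚ.- c) ℚ.+ (b ℚ.- d) ∣        ≤⟨ ℚ.∣p+q∣≤∣p∣+∣q∣ (a ℚ.- c) (b ℚ.- d) ⟩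
    ℚ.∣ a ℚ.- c ∣ ℚ.+ ℚ.∣ b ℚ.- d ∣      ∎
    where
    open ℚ.≤-Reasoning
    open +-*-Solver

  ⊓-lipschitz : ∀ a b c d →
    ℚ.∣ (a ℚ.⊓ b) ℚ.- (c ℚ.⊓ d) ∣ ℚ.≤ ℚ.∣ a ℚ.- c ∣ ℚ.+ ℚ.∣ b ℚ.- d ∣
  ⊓-lipschitz a b c d = ∣-∣≤ _ _ _ (half a b c d)
    (subst₂ (λ x y → c ℚ.⊓ d ℚ.≤ a ℚ.⊓ b ℚ.+ (x ℚ.+ y))
      (∣-∣-comm c a) (∣-∣-comm d b) (half c d a b))
    where
    open ℚ.≤-Reasoning
    half : ∀ a b c d → a ℚ.⊓ b ℚ.≤ c ℚ.⊓ d ℚ.+ (ℚ.∣ a ℚ.- c ∣ ℚ.+ ℚ.∣ b ℚ.- d ∣)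
    half a b c d with ℚ.⊓-sel c d
    ... | inj₁ eq rewrite eq = begin
      a ℚ.⊓ b                     ≤⟨ ℚ.p⊓q≤p a b ⟩
      a                           ≤⟨ p≤q+∣p-q∣ a c ⟩
      c ℚ.+ ℚ.∣ a ℚ.- c ∣         ≡⟨ cong (c ℚ.+_) (sym (ℚ.+-identityʳ _)) ⟩
      c ℚ.+ (ℚ.∣ a ℚ.- c ∣ ℚ.+ 0ℚ)
        ≤⟨ ℚ.+-monoʳ-≤ c (ℚ.+-monoʳ-≤ ℚ.∣ a ℚ.- c ∣ (ℚ.0≤∣p∣ (b ℚ.- d))) ⟩
      c ℚ.+ (ℚ.∣ a ℚ.- c ∣ ℚ.+ ℚ.∣ b ℚ.- d ∣) ∎
    ... | inj₂ eq rewrite eq = begin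
      a ℚ.⊓ b                     ≤⟨ ℚ.p⊓q≤q a b ⟩
      b                           ≤⟨ p≤q+∣p-q∣ b d ⟩
      d ℚ.+ ℚ.∣ b ℚ.- d ∣         ≡⟨ cong (d ℚ.+_) (sym (ℚ.+-identityˡ _)) ⟩
      d ℚ.+ (0ℚ ℚ.+ ℚ.∣ b ℚ.- d ∣)
        ≤⟨ ℚ.+-monoʳ-≤ d (ℚ.+-monoˡ-≤ ℚ.∣ b ℚ.- d ∣ (ℚ.0≤∣p∣ (a ℚ.- c))) ⟩
      d ℚ.+ (ℚ.∣ a ℚ.- c ∣ ℚ.+ ℚ.∣ b ℚ.- d ∣) ∎

  *-lipschitz : ∀ a b c d →
    ℚ.∣ (a ℚ.* b) ℚ.- (c ℚ.* d) ∣ ℚ.≤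
    ℚ.∣ b ∣ ℚ.* ℚ.∣ a ℚ.- c ∣ ℚ.+ ℚ.∣ c ∣ ℚ.* ℚ.∣ b ℚ.- d ∣
  *-lipschitz a b c d = begin
    ℚ.∣ (a ℚ.* b) ℚ.- (c ℚ.* d) ∣                    ≡⟨ cong ℚ.∣_∣ (solve 4 (λ a b c d →
        (a :* b) :- (c :* d) := b :* (a :- c) :+ c :* (b :- d)) refl a b c d) ⟩
    ℚ.∣ b ℚ.* (a ℚ.- c) ℚ.+ c ℚ.* (b ℚ.- d) ∣        ≤⟨ ℚ.∣p+q∣≤∣p∣+∣q∣ (b ℚ.* (a ℚ.- c)) (c ℚ.* (b ℚ.- d)) ⟩
    ℚ.∣ b ℚ.* (a ℚ.- c) ∣ ℚ.+ ℚ.∣ c ℚ.* (b ℚ.- d) ∣  ≡⟨ cong₂ ℚ._+_ (ℚ.∣p*q∣≡∣p∣*∣q∣ b (a ℚ.- c)) (ℚ.∣p*q∣≡∣p∣*∣q∣ c (b ℚ.- d)) ⟩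
    ℚ.∣ b ∣ ℚ.* ℚ.∣ a ℚ.- c ∣ ℚ.+ ℚ.∣ c ∣ ℚ.* ℚ.∣ b ℚ.- d ∣ ∎
    where
    open ℚ.≤-Reasoning
    open +-*-Solver

  bound : ∀ s → IsCauchy s →
    ∃ λ B → 0ℚ ℚ.< B × Eventually (λ n → ℚ.∣ s n ∣ ℚ.≤ B)
  bound s cs with cs 1ℚ 0<1
  ... | N , h = ℚ.∣ s N ∣ ℚ.+ 1ℚ
      , ℚ.+-mono-≤-< (ℚ.0≤∣p∣ (s N)) 0<1
      , N , λ n N≤n → begin
        ℚ.∣ s n ∣                          ≡⟨ cong ℚ.∣_∣ (solve 2 (λ a b → a := b :+ (a :- b)) refl (s n) (s N)) ⟩
        ℚ.∣ s N ℚ.+ (s n ℚ.- s N) ∣        ≤⟨ ℚ.∣p+q∣≤∣p∣+∣q∣ (s N) (s n ℚ.- s N) ⟩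
        ℚ.∣ s N ∣ ℚ.+ ℚ.∣ s n ℚ.- s N ∣    ≤⟨ ℚ.+-monoʳ-≤ ℚ.∣ s N ∣ (h n N N≤n ℕ.≤-refl) ⟩
        ℚ.∣ s N ∣ ℚ.+ 1ℚ                   ∎
    where
    open ℚ.≤-Reasoning
    open +-*-Solver

  cauchy₂ : (f : ℚ → ℚ → ℚ) →
    (∀ a b c d → ℚ.∣ f a b ℚ.- f c d ∣ ℚ.≤ ℚ.∣ a ℚ.- c ∣ ℚ.+ ℚ.∣ b ℚ.- d ∣) →
    ∀ s t → IsCauchy s → IsCauchy t → IsCauchy (λ n → f (s n) (t n))
  cauchy₂ f lip s t cs ct δ 0<δ
    with cs (½ ℚ.* δ) (pos* 0<½ 0<δ) | ct (½ ℚ.* δ) (pos* 0<½ 0<δ)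
  ... | N₁ , h₁ | N₂ , h₂ = N₁ ⊔ N₂ , λ m n ≤m ≤n → begin
    ℚ.∣ f (s m) (t m) ℚ.- f (s n) (t n) ∣        ≤⟨ lip (s m) (t m) (s n) (t n) ⟩
    ℚ.∣ s m ℚ.- s n ∣ ℚ.+ ℚ.∣ t m ℚ.- t n ∣      ≤⟨ ℚ.+-mono-≤
      (h₁ m n (ℕ.m⊔n≤o⇒m≤o N₁ N₂ ≤m) (ℕ.m⊔n≤o⇒m≤o N₁ N₂ ≤n))
      (h₂ m n (ℕ.m⊔n≤o⇒n≤o N₁ N₂ ≤m) (ℕ.m⊔n≤o⇒n≤o N₁ N₂ ≤n)) ⟩
    ½ ℚ.* δ ℚ.+ ½ ℚ.* δ                          ≡⟨ ½+½ δ ⟩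
    δ                                            ∎
    where
    open ℚ.≤-Reasoning

  scaled : ∀ B δ → 0ℚ ℚ.< B → 0ℚ ℚ.< δ → ∃ λ η → 0ℚ ℚ.< η × B ℚ.* η ≡ δ
  scaled B δ 0<B 0<δ =
    B⁻¹ ℚ.* δ , pos* (ℚ.positive⁻¹ B⁻¹ {{ℚ.1/pos⇒pos B}}) 0<δ , (begin
      B ℚ.* (B⁻¹ ℚ.* δ)    ≡⟨ sym (ℚ.*-assoc B B⁻¹ δ) ⟩
      (B ℚ.* B⁻¹) ℚ.* δ    ≡⟨ cong (ℚ._* δ) (ℚ.*-inverseʳ B) ⟩
      1ℚ ℚ.* δ             ≡⟨ ℚ.*-identityˡ δ ⟩
      δ                    ∎)
    where
    open ≡-Reasoning
    instance
      B-pos : Positive B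
      B-pos = ℚ.positive 0<B
      B-nonZero : ℚ.NonZero B
      B-nonZero = ℚ.pos⇒nonZero B
    B⁻¹ = ℚ.1/ B

  *-mono : ∀ p B q η → 0ℚ ℚ.≤ q → 0ℚ ℚ.< B → p ℚ.≤ B → q ℚ.≤ η → p ℚ.* q ℚ.≤ B ℚ.* η
  *-mono p B q η 0≤q 0<B p≤B q≤η = ℚ.≤-trans
    (ℚ.*-monoʳ-≤-nonNeg q {{ℚ.nonNegative 0≤q}} p≤B)
    (ℚ.*-monoˡ-≤-nonNeg B {{ℚ.nonNegative (ℚ.<⇒≤ 0<B)}} q≤η)

  *-close : ∀ A B η θ δ → 0ℚ ℚ.< A → 0ℚ ℚ.< B → B ℚ.* η ≡ ½ ℚ.* δ → A ℚ.* θ ≡ ½ ℚ.* δ →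
    ∀ a b c d → ℚ.∣ b ∣ ℚ.≤ B → ℚ.∣ c ∣ ℚ.≤ A →
    ℚ.∣ a ℚ.- c ∣ ℚ.≤ η → ℚ.∣ b ℚ.- d ∣ ℚ.≤ θ →
    ℚ.∣ a ℚ.* b ℚ.- c ℚ.* d ∣ ℚ.≤ δ
  *-close A B η θ δ 0<A 0<B Bη Aθ a b c d b≤B c≤A ac bd =
    ℚ.≤-trans (*-lipschitz a b c d) (ℚ.≤-trans
      (ℚ.+-mono-≤
        (*-mono ℚ.∣ b ∣ B ℚ.∣ a ℚ.- c ∣ η (ℚ.0≤∣p∣ (a ℚ.- c)) 0<B b≤B ac)
        (*-mono ℚ.∣ c ∣ A ℚ.∣ b ℚ.- d ∣ θ (ℚ.0≤∣p∣ (b ℚ.- d)) 0<A c≤A bd))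
      (ℚ.≤-reflexive (trans (cong₂ ℚ._+_ Bη Aθ) (½+½ δ))))

  *-cauchy : ∀ s t → IsCauchy s → IsCauchy t → IsCauchy (λ n → s n ℚ.* t n)
  *-cauchy s t cs ct δ 0<δ =
    let A , 0<A , K₁ , s≤A = bound s cs
        B , 0<B , K₂ , t≤B = bound t ct
        0<½δ = pos* {½} {δ} 0<½ 0<δ
        η , 0<η , Bη = scaled B (½ ℚ.* δ) 0<B 0<½δ
        θ , 0<θ , Aθ = scaled A (½ ℚ.* δ) 0<A 0<½δ
        N₁ , h₁ = cs η 0<η
        N₂ , h₂ = ct θ 0<θ
        K = K₁ ⊔ K₂
        N = N₁ ⊔ N₂
    in K ⊔ N , λ m n ≤m ≤n →
      *-close A B η θ δ 0<A 0<B Bη Aθ (s m) (t m) (s n) (t n)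
        (t≤B m (ℕ.m⊔n≤o⇒n≤o K₁ K₂ (ℕ.m⊔n≤o⇒m≤o K N ≤m)))
        (s≤A n (ℕ.m⊔n≤o⇒m≤o K₁ K₂ (ℕ.m⊔n≤o⇒m≤o K N ≤n)))
        (h₁ m n (ℕ.m⊔n≤o⇒m≤o N₁ N₂ (ℕ.m⊔n≤o⇒n≤o K N ≤m))
                (ℕ.m⊔n≤o⇒m≤o N₁ N₂ (ℕ.m⊔n≤o⇒n≤o K N ≤n)))
        (h₂ m n (ℕ.m⊔n≤o⇒n≤o N₁ N₂ (ℕ.m⊔n≤o⇒n≤o K N ≤m))
                (ℕ.m⊔n≤o⇒n≤o N₁ N₂ (ℕ.m⊔n≤o⇒n≤o K N ≤n)))

infix  4 _≈_ _≤_ _<_ _⟶_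
infixl 6 _+_ _-_
infixl 7 _*_ _⊓_
infix  8 -_

_≈_ : ℝ → ℝ → Set
x ≈ y = ∀ δ → 0ℚ ℚ.< δ → Eventually λ n → ℚ.∣ seq x n ℚ.- seq y n ∣ ℚ.≤ δ

_≤_ : ℝ → ℝ → Set
x ≤ y = ∀ δ → 0ℚ ℚ.< δ → Eventually λ n → seq x n ℚ.≤ seq y n ℚ.+ δ

_<_ : ℝ → ℝ → Set
x < y = ∃ λ δ → 0ℚ ℚ.< δ × Eventually λ n → seq x n ℚ.+ δ ℚ.≤ seq y n

fromℚ : ℚ → ℝ
fromℚ q = mkℝ (λ _ → q) λ δ 0<δ → 0 , λ _ _ _ _ →
  subst (λ d → ℚ.∣ d ∣ ℚ.≤ δ) (sym (ℚ.+-inverseʳ q)) (ℚ.<⇒≤ 0<δ)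

fromℕ : ℕ → ℝ
fromℕ n = fromℚ (+ n ℚ./ 1)

0ℝ 1ℝ : ℝ
0ℝ = fromℚ 0ℚ
1ℝ = fromℚ 1ℚ

_+_ _*_ _⊓_ : ℝ → ℝ → ℝ
x + y = mkℝ (λ n → seq x n ℚ.+ seq y n)
  (cauchy₂ ℚ._+_ +-lipschitz (seq x) (seq y) (cauchy x) (cauchy y))
x * y = mkℝ (λ n → seq x n ℚ.* seq y n)
  (*-cauchy (seq x) (seq y) (cauchy x) (cauchy y))
x ⊓ y = mkℝ (λ n → seq x n ℚ.⊓ seq y n)
  (cauchy₂ ℚ._⊓_ ⊓-lipschitz (seq x) (seq y) (cauchy x) (cauchy y))

-_ ∣_∣ : ℝ → ℝ
- x = mkℝ (λ n → ℚ.- seq x n) λ δ 0<δ → let N , h = cauchy x δ 0<δ in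
  N , λ m n ≤m ≤n → subst (ℚ._≤ δ)
    (trans (sym (ℚ.∣-p∣≡∣p∣ (seq x m ℚ.- seq x n)))
      (cong ℚ.∣_∣ (ℚ.neg-distrib-+ (seq x m) (ℚ.- seq x n))))
    (h m n ≤m ≤n)
∣ x ∣ = mkℝ (λ n → ℚ.∣ seq x n ∣) λ δ 0<δ → let N , h = cauchy x δ 0<δ in
  N , λ m n ≤m ≤n →
    ℚ.≤-trans (∣-∣-nonExpansive (seq x m) (seq x n)) (h m n ≤m ≤n)

_-_ : ℝ → ℝ → ℝ
x - y = x + (- y)

ℝ-rawRing : RawRing 0ℓ 0ℓ
ℝ-rawRing = record
  { Carrier = ℝ ; _≈_ = _≈_ ; _+_ = _+_ ; _*_ = _*_ ; -_ = -_ ; 0# = 0ℝ ; 1# = 1ℝ }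

open import Algebra.Definitions.RawSemiring (RawRing.rawSemiring ℝ-rawRing) public
  using (_^_; sum)

_⟶_ : (ℕ → ℝ) → ℝ → Set
s ⟶ x = ∀ δ → 0ℚ ℚ.< δ → Eventually λ n → ∣ s n - x ∣ ≤ fromℚ δ

-- IsQuotient a b q:  q = a / b.  Division is a partial operation; it is
-- represented by its graph, which is empty when b = 0.
IsQuotient : ℝ → ℝ → ℝ → Set
IsQuotient a b q = ¬ (b ≈ 0ℝ) × q * b ≈ a

-- IsLog x l:  l = log x, the natural logarithm, again as the graph of a
-- partial function.  It says exp l = x, with exp l = lim (1 + l/n)ⁿ, where n
-- is shifted by one to avoid n = 0.
IsLog : ℝ → ℝ → Set
IsLog x l = (λ n → (1ℝ + fromℚ (+ 1 ℚ./ suc n) * l) ^ suc n) ⟶ x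

-- M j i is the entry in row j and column i.
Matrix : ℕ → ℕ → Set
Matrix n m = Vector (Vector ℝ m) n

column : ∀ {n m} → Matrix n m → Fin m → Vector ℝ n
column M i j = M j i

linearCombination : ∀ {n k} → Vector ℝ k → Vector (Vector ℝ n) k → Vector ℝ n
linearCombination c v j = sum λ k → c k * v k j

LinearlyIndependent : ∀ {n k} → Vector (Vector ℝ n) k → Set
LinearlyIndependent v =
  ∀ c → (∀ j → linearCombination c v j ≈ 0ℝ) → ∀ k → c k ≈ 0ℝ

_∈Span_ : ∀ {n k} → Vector ℝ n → Vector (Vector ℝ n) k → Set
w ∈Span v = ∃ λ c → ∀ j → w j ≈ linearCombination c v j

-- The column space of M has a basis of r vectors.
IsRank : ∀ {n m} → Matrix n m → ℕ → Set
IsRank {n} M r = Σ (Vector (Vector ℝ n) r) λ b →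
  LinearlyIndependent b ×
  (∀ k → b k ∈Span column M) ×
  (∀ i → column M i ∈Span b)

-- Entrywise within each column, not the usual condition on row sums.
DiagonallyDominant : ∀ {m} → Matrix m m → Set
DiagonallyDominant M = ∀ i j → ∣ M j i ∣ ≤ ∣ M i i ∣

ApproximatelyLowerTriangular : ∀ {m} → ℝ → Matrix m m → Set
ApproximatelyLowerTriangular ε M =
  ∀ j i → j Fin.< i → ∣ M j i ∣ ≤ ε * ∣ M i i ∣

-- Suppose the rank r is small.  At a late index of the Cauchy sequences M becomes,
-- after clearing denominators and scaling columns, an integer matrix B A with inner
-- dimension r, constant diagonal D, entries at most 2D and at most D/Q above the
-- diagonal, where Q is about 1/ε.  Take n rows and columns with n about
-- min (1/ε², m).  For a sign vector x, the second moment shows that the part of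
-- M x above the diagonal is small in all but a few rows, so that x can be decoded
-- from a rough approximation of M x together with a few exceptional signs.  Hence
-- about 2^(cn) of the vectors M x are separated by a multiple of D.  But they
-- lie in the image of an r-dimensional lattice and have norm at most 2nD, so a
-- packing argument bounds their number by (Kn)^r.  Thus r ≥ c n / log n, which in
-- both cases of the minimum contradicts the assumption.  The conclusion x ≤ y is
-- stable under double negation, so arguing by contradiction is constructive.

module Submission where

-- The exponent 2 of 1/ε comes from using typical sign vectors only. Above the diagonal a row has up
-- to n terms of size at most D/Q; they may add up to nD/Q, but their root mean square over all
-- signs is at most √n D/Q, so n may grow like Q² and not just like Q. With n = 8p and
-- `64 * n ≤ Q * Q` an average sign vector has at most p/2 exceptional rows. Below the diagonal
-- nothing is small; that part is harmless because it depends only on signs that are already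
-- decoded.
--
-- Logarithms occur in the bound only as denominators, so they have to be estimated from below only:
-- `suc k` is at most 4 log x as soon as x is at least 2^(k+1) - 1/2. Everything else is done with
-- exponents of 2, and p itself is taken to be a power of two.
--
-- The constant 2^20 is 32² · 2^9 · 2. Here 32 comes from `a * suc k ≤ 32 * 2 ^ k`, the factor 2^9 =
-- 64 · 8 from the condition on n = 8p, and the last 2 from comparing 8 + e with `suc k` for p =
-- 2^e.

-- Finite counting: pigeonhole for lists, Markov's inequality, sparse patterns.

module Counting where

  open import Data.Bool using (Bool; true; false)
  open import Data.Fin using (Fin; zero; suc)
  open import Data.Fin.Properties using (injective⇒≤)
  open import Data.Integer using (ℤ; +_; -[1+_]; ∣_∣)
  open import Data.List using (List; []; _∷_; _++_; map; length; filter; upTo; lookup; cartesianProductWith)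
  open import Data.List.Membership.Propositional using (_∈_)
  open import Data.List.Membership.Propositional.Properties
  open import Data.List.Properties using (length-map; length-++; filter-accept; filter-reject)
  open import Data.List.Relation.Unary.All as All using (All; []; _∷_)
  open import Data.List.Relation.Unary.Any using (here; there; index)
  open import Data.List.Relation.Unary.AllPairs using ([]; _∷_)
  open import Data.List.Relation.Unary.Unique.Propositional using (Unique)
  import Data.List.Relation.Unary.Unique.Propositional.Properties as Unique
  open import Data.Maybe using (Maybe; nothing; just)
  open import Data.Nat
  open import Data.Nat.Properties
  open import Data.Nat.Tactic.RingSolver using (solve-∀)
  open import Data.Product using (∃; _×_; _,_)
  open import Data.Sum using (inj₁; inj₂)
  open import Data.Vec as Vec using (Vec; []; _∷_)
  open import Data.Vec.Relation.Unary.All using ([]; _∷_) renaming (All to AllV)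
  open import Data.Vec.Properties using (∷-injective)
  open import Function using (_∘_)
  open import Relation.Binary.PropositionalEquality
  open import Relation.Nullary using (yes; no; ¬_; contradiction)

  lookup-injective : ∀ {A : Set} {xs : List A} → Unique xs →
    ∀ i j → lookup xs i ≡ lookup xs j → i ≡ j
  lookup-injective (_ ∷ _) zero zero _ = refl
  lookup-injective (x∉ ∷ _) zero (suc j) eq = contradiction eq (All.lookup x∉ (∈-lookup j))
  lookup-injective (x∉ ∷ _) (suc i) zero eq = contradiction (sym eq) (All.lookup x∉ (∈-lookup i))
  lookup-injective (_ ∷ u) (suc i) (suc j) eq = cong suc (lookup-injective u i j eq)

  -- Injectivity is asked for on members only: the encoding in `packing` can be inverted only for
  -- pairs taken from the product list.
  injection⇒length≤ : ∀ {A B : Set} {xs : List A} (ys : List B) (f : A → B) → Unique xs →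
    (∀ {x} → x ∈ xs → f x ∈ ys) →
    (∀ {x y} → x ∈ xs → y ∈ xs → f x ≡ f y → x ≡ y) →
    length xs ≤ length ys
  injection⇒length≤ {xs = xs} ys f uniq f∈ inj = injective⇒≤ {f = g} λ {i} {j} eq →
    lookup-injective uniq i j (inj (∈-lookup i) (∈-lookup j)
      (index-injectiveₚ (f∈ (∈-lookup i)) (f∈ (∈-lookup j)) eq))
    where
    g : Fin (length xs) → Fin (length ys)
    g i = index (f∈ (∈-lookup i))
    index-injectiveₚ : ∀ {x y} {zs : List _} (x∈ : x ∈ zs) (y∈ : y ∈ zs) → index x∈ ≡ index y∈ → x ≡ y
    index-injectiveₚ (here refl) (here refl) _ = refl
    index-injectiveₚ (there x∈) (there y∈) eq = index-injectiveₚ x∈ y∈ (Data.Fin.Properties.suc-injective eq)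

  length-cartesianProductWith : ∀ {A B C : Set} (f : A → B → C) xs ys →
    length (cartesianProductWith f xs ys) ≡ length xs * length ys
  length-cartesianProductWith f [] ys = refl
  length-cartesianProductWith f (x ∷ xs) ys = trans (length-++ (map (f x) ys))
    (cong₂ _+_ (length-map (f x) ys) (length-cartesianProductWith f xs ys))

  tuples : ∀ {A : Set} → List A → ∀ n → List (Vec A n)
  tuples xs zero    = [] ∷ []
  tuples xs (suc n) = cartesianProductWith _∷_ xs (tuples xs n)

  length-tuples : ∀ {A : Set} (xs : List A) n → length (tuples xs n) ≡ length xs ^ n
  length-tuples xs zero    = refl
  length-tuples xs (suc n) = trans (length-cartesianProductWith _∷_ xs (tuples xs n))
    (cong (length xs *_) (length-tuples xs n))

  tuples-unique : ∀ {A : Set} {xs : List A} → Unique xs → ∀ n → Unique (tuples xs n)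
  tuples-unique u zero    = [] ∷ []
  tuples-unique u (suc n) = Unique.cartesianProductWith⁺ _∷_ ∷-injective u (tuples-unique u n)

  ∈-tuples⁺ : ∀ {A : Set} {xs : List A} {n} {v : Vec A n} → AllV (_∈ xs) v → v ∈ tuples xs n
  ∈-tuples⁺ []          = here refl
  ∈-tuples⁺ (x∈ ∷ v∈) = ∈-cartesianProductWith⁺ _∷_ x∈ (∈-tuples⁺ v∈)

  ∈-tuples⁻ : ∀ {A : Set} (xs : List A) {n} {v : Vec A n} → v ∈ tuples xs n → AllV (_∈ xs) v
  ∈-tuples⁻ xs {zero} {[]} _ = []
  ∈-tuples⁻ xs {suc n} v∈ with ∈-cartesianProductWith⁻ _∷_ xs (tuples xs n) v∈
  ... | _ , _ , x∈ , w∈ , refl = x∈ ∷ ∈-tuples⁻ xs w∈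

  ball : ℕ → List ℤ
  ball h = map +_ (upTo (suc h)) ++ map -[1+_] (upTo h)

  ∈-ball⁺ : ∀ {h} z → ∣ z ∣ ≤ h → z ∈ ball h
  ∈-ball⁺     (+ n)    n≤h = ∈-++⁺ˡ (∈-map⁺ +_ (∈-upTo⁺ (s≤s n≤h)))
  ∈-ball⁺ {h} -[1+ n ] n<h = ∈-++⁺ʳ (map +_ (upTo (suc h))) (∈-map⁺ -[1+_] (∈-upTo⁺ n<h))

  ∈-ball⁻ : ∀ h {z} → z ∈ ball h → ∣ z ∣ ≤ h
  ∈-ball⁻ h z∈ with ∈-++⁻ (map +_ (upTo (suc h))) z∈
  ... | inj₁ z∈₁ with ∈-map⁻ +_ z∈₁
  ...   | _ , n∈ , refl = ≤-pred (∈-upTo⁻ n∈)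
  ∈-ball⁻ h z∈ | inj₂ z∈₂ with ∈-map⁻ -[1+_] z∈₂
  ...   | _ , n∈ , refl = ∈-upTo⁻ n∈

  ball-unique : ∀ h → Unique (ball h)
  ball-unique h = Unique.++⁺
    (Unique.map⁺ (λ { refl → refl }) (Unique.upTo⁺ (suc h)))
    (Unique.map⁺ (λ { refl → refl }) (Unique.upTo⁺ h))
    λ { (z∈₁ , z∈₂) → disjoint (∈-map⁻ +_ z∈₁) (∈-map⁻ -[1+_] z∈₂) }
    where
    disjoint : ∀ {z} → (∃ λ n → n ∈ upTo (suc h) × z ≡ + n) → ¬ (∃ λ n → n ∈ upTo h × z ≡ -[1+ n ])
    disjoint (_ , _ , refl) (_ , _ , ())

  ∑ : ∀ {A : Set} → List A → (A → ℕ) → ℕ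
  ∑ []       f = 0
  ∑ (x ∷ xs) f = f x + ∑ xs f

  syntax ∑ xs (λ x → e) = ∑[ x ∈ xs ] e

  module _ {A : Set} where

    ∑-mono : ∀ (xs : List A) {f g : A → ℕ} → (∀ x → f x ≤ g x) → ∑ xs f ≤ ∑ xs g
    ∑-mono []       f≤g = z≤n
    ∑-mono (x ∷ xs) f≤g = +-mono-≤ (f≤g x) (∑-mono xs f≤g)

    ∑-cong : ∀ (xs : List A) {f g : A → ℕ} → (∀ x → f x ≡ g x) → ∑ xs f ≡ ∑ xs g
    ∑-cong []       f≡g = refl
    ∑-cong (x ∷ xs) f≡g = cong₂ _+_ (f≡g x) (∑-cong xs f≡g)

    ∑-distribˡ : ∀ (xs : List A) (f : A → ℕ) c → c * ∑ xs f ≡ ∑ xs (λ x → c * f x)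
    ∑-distribˡ []       f c = *-zeroʳ c
    ∑-distribˡ (x ∷ xs) f c = trans (*-distribˡ-+ c (f x) (∑ xs f)) (cong (_+_ _) (∑-distribˡ xs f c))

    ∑-+ : ∀ (xs : List A) (f g : A → ℕ) → ∑ xs (λ x → f x + g x) ≡ ∑ xs f + ∑ xs g
    ∑-+ []       f g = refl
    ∑-+ (x ∷ xs) f g = trans (cong (_+_ (f x + g x)) (∑-+ xs f g))
      (interchange (f x) (g x) (∑ xs f) (∑ xs g))
      where
      interchange : ∀ a b c d → (a + b) + (c + d) ≡ (a + c) + (b + d)
      interchange = solve-∀

    ∑-double : ∀ (xs : List A) (f : A → ℕ) → ∑ xs (λ x → f x + f x) ≡ 2 * ∑ xs f
    ∑-double xs f = trans (∑-+ xs f f) (cong (_+_ (∑ xs f)) (sym (+-identityʳ _)))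

    ∑-++ : ∀ (xs ys : List A) (f : A → ℕ) → ∑ (xs ++ ys) f ≡ ∑ xs f + ∑ ys f
    ∑-++ []       ys f = refl
    ∑-++ (x ∷ xs) ys f = trans (cong (_+_ (f x)) (∑-++ xs ys f)) (sym (+-assoc (f x) _ _))

    ∑-map : ∀ {B : Set} (xs : List B) (h : B → A) (f : A → ℕ) → ∑ (map h xs) f ≡ ∑ xs (λ x → f (h x))
    ∑-map []       h f = refl
    ∑-map (x ∷ xs) h f = cong (_+_ (f (h x))) (∑-map xs h f)

    -- Each element with `f x > p` pays at least `suc p` to the sum. Written without subtraction or
    -- division.
    markov : ∀ (xs : List A) (f : A → ℕ) p →
      suc p * length xs ≤ ∑ xs f + suc p * length (filter (λ x → f x ≤? p) xs)
    markov []       f p = ≤-refl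
    markov (x ∷ xs) f p with f x ≤? p
    ... | yes f≤p rewrite filter-accept (λ x → f x ≤? p) {x} {xs} f≤p = begin
      suc p * suc (length xs)                     ≡⟨ *-suc (suc p) (length xs) ⟩
      suc p + suc p * length xs                   ≤⟨ +-monoʳ-≤ (suc p) (markov xs f p) ⟩
      suc p + (∑ xs f + suc p * l)                ≡⟨ shuffle (suc p) (∑ xs f) l ⟩
      ∑ xs f + suc p * suc l                      ≤⟨ +-monoˡ-≤ (suc p * suc l) (m≤n+m (∑ xs f) (f x)) ⟩
      f x + ∑ xs f + suc p * suc l                ∎
      where
      open ≤-Reasoning
      l = length (filter (λ x → f x ≤? p) xs)
      shuffle : ∀ p s l → p + (s + p * l) ≡ s + p * suc l
      shuffle = solve-∀
    ... | no f≰p rewrite filter-reject (λ x → f x ≤? p) {x} {xs} f≰p = begin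
      suc p * suc (length xs)                     ≡⟨ *-suc (suc p) (length xs) ⟩
      suc p + suc p * length xs                   ≤⟨ +-mono-≤ (≰⇒> f≰p) (markov xs f p) ⟩
      f x + (∑ xs f + suc p * l)                  ≡⟨ sym (+-assoc (f x) _ _) ⟩
      f x + ∑ xs f + suc p * l                    ∎
      where
      open ≤-Reasoning
      l = length (filter (λ x → f x ≤? p) xs)

  ∑Fin : ∀ {n} → (Fin n → ℕ) → ℕ
  ∑Fin {zero}  g = 0
  ∑Fin {suc n} g = g zero + ∑Fin (g ∘ suc)

  ∑Fin-mono-const : ∀ {n} (g : Fin n → ℕ) b → (∀ j → g j ≤ b) → ∑Fin g ≤ n * b
  ∑Fin-mono-const {zero}  g b g≤b = z≤n
  ∑Fin-mono-const {suc n} g b g≤b = +-mono-≤ (g≤b zero) (∑Fin-mono-const (g ∘ suc) b (g≤b ∘ suc))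

  ∑Fin-distribˡ : ∀ {n} (g : Fin n → ℕ) c → c * ∑Fin g ≡ ∑Fin (λ j → c * g j)
  ∑Fin-distribˡ {zero}  g c = *-zeroʳ c
  ∑Fin-distribˡ {suc n} g c = trans (*-distribˡ-+ c (g zero) _) (cong (_+_ _) (∑Fin-distribˡ (g ∘ suc) c))

  ∑-∑Fin-comm : ∀ {A : Set} (xs : List A) {n} (g : A → Fin n → ℕ) →
    ∑ xs (λ x → ∑Fin (g x)) ≡ ∑Fin (λ j → ∑ xs (λ x → g x j))
  ∑-∑Fin-comm xs {zero}  g = ∑-0 xs
    where
    ∑-0 : ∀ ys → ∑ ys (λ _ → 0) ≡ 0
    ∑-0 []       = refl
    ∑-0 (_ ∷ ys) = ∑-0 ys
  ∑-∑Fin-comm xs {suc n} g = trans (∑-+ xs (λ x → g x zero) (λ x → ∑Fin (g x ∘ suc)))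
    (cong (_+_ _) (∑-∑Fin-comm xs (λ x → g x ∘ suc)))

  -- nothing: the sign can be decoded; just b: the sign b is recorded.
  marks : ∀ {n} → Vec (Maybe Bool) n → ℕ
  marks []            = 0
  marks (nothing ∷ v) = marks v
  marks (just _ ∷ v)  = suc (marks v)

  patterns : ∀ n → ℕ → List (Vec (Maybe Bool) n)
  patterns zero    p       = [] ∷ []
  patterns (suc n) zero    = map (nothing ∷_) (patterns n zero)
  patterns (suc n) (suc p) = map (nothing ∷_) (patterns n (suc p)) ++
    (map (just true ∷_) (patterns n p) ++ map (just false ∷_) (patterns n p))

  ∈-patterns⁺ : ∀ {n} p (v : Vec (Maybe Bool) n) → marks v ≤ p → v ∈ patterns n p
  ∈-patterns⁺ p       []                _       = here refl
  ∈-patterns⁺ zero    (nothing ∷ v)     m≤p     = ∈-map⁺ (nothing ∷_) (∈-patterns⁺ zero v m≤p)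
  ∈-patterns⁺ (suc p) (nothing ∷ v)     m≤p     = ∈-++⁺ˡ (∈-map⁺ (nothing ∷_) (∈-patterns⁺ (suc p) v m≤p))
  ∈-patterns⁺ {suc n} (suc p) (just true ∷ v)  (s≤s m≤p) = ∈-++⁺ʳ (map (nothing ∷_) (patterns n (suc p)))
    (∈-++⁺ˡ (∈-map⁺ (just true ∷_) (∈-patterns⁺ p v m≤p)))
  ∈-patterns⁺ {suc n} (suc p) (just false ∷ v) (s≤s m≤p) = ∈-++⁺ʳ (map (nothing ∷_) (patterns n (suc p)))
    (∈-++⁺ʳ (map (just true ∷_) (patterns n p)) (∈-map⁺ (just false ∷_) (∈-patterns⁺ p v m≤p)))

  -- Give an unmarked position weight 6 and each of the two marked values weight 1. All patterns
  -- together then weigh (6 + 2)^n, and one with at most p marks weighs at least 6^(n - p).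
  length-patterns : ∀ n p → length (patterns n p) * 6 ^ n ≤ 8 ^ n * 6 ^ p
  length-patterns zero p = begin
    1                ≤⟨ >-nonZero⁻¹ (6 ^ p) {{m^n≢0 6 p}} ⟩
    6 ^ p            ≡⟨ sym (+-identityʳ (6 ^ p)) ⟩
    6 ^ p + 0        ∎
    where open ≤-Reasoning
  length-patterns (suc n) zero = begin
    length (map (nothing ∷_) (patterns n zero)) * (6 * 6 ^ n)  ≡⟨ cong (_* (6 * 6 ^ n)) (length-map (nothing ∷_) (patterns n zero)) ⟩
    L * (6 * 6 ^ n)                       ≡⟨ shuffle L (6 ^ n) ⟩
    6 * (L * 6 ^ n)                       ≤⟨ *-mono-≤ {6} {8} (m≤m+n 6 2) (length-patterns n zero) ⟩
    8 * (8 ^ n * 1)                       ≡⟨ sym (*-assoc 8 (8 ^ n) 1) ⟩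
    8 * 8 ^ n * 1                         ∎
    where
    open ≤-Reasoning
    L = length (patterns n zero)
    shuffle : ∀ l x → l * (6 * x) ≡ 6 * (l * x)
    shuffle = solve-∀
  length-patterns (suc n) (suc p) = begin
    length (patterns (suc n) (suc p)) * (6 * 6 ^ n)   ≡⟨ cong (_* (6 * 6 ^ n)) len ⟩
    (L₁ + (L₀ + L₀)) * (6 * 6 ^ n)                     ≡⟨ split L₁ L₀ (6 ^ n) ⟩
    6 * (L₁ * 6 ^ n) + 12 * (L₀ * 6 ^ n)               ≤⟨ +-mono-≤ (*-monoʳ-≤ 6 (length-patterns n (suc p))) (*-monoʳ-≤ 12 (length-patterns n p)) ⟩
    6 * (8 ^ n * (6 * 6 ^ p)) + 12 * (8 ^ n * 6 ^ p)   ≡⟨ join (8 ^ n) (6 ^ p) ⟩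
    8 * 8 ^ n * (6 * 6 ^ p)                            ∎
    where
    open ≤-Reasoning
    L₁ = length (patterns n (suc p))
    L₀ = length (patterns n p)
    A = map (nothing ∷_) (patterns n (suc p))
    B = map (just true ∷_) (patterns n p)
    C = map (just false ∷_) (patterns n p)
    len : length (A ++ (B ++ C)) ≡ L₁ + (L₀ + L₀)
    len = trans (length-++ A) (cong₂ _+_ (length-map (nothing ∷_) (patterns n (suc p)))
      (trans (length-++ B) (cong₂ _+_ (length-map (just true ∷_) (patterns n p)) (length-map (just false ∷_) (patterns n p)))))
    split : ∀ a b x → (a + (b + b)) * (6 * x) ≡ 6 * (a * x) + 12 * (b * x)
    split = solve-∀
    join : ∀ x y → 6 * (x * (6 * y)) + 12 * (x * y) ≡ 8 * x * (6 * y)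
    join = solve-∀

-- Packing in the image of an integer lattice.

module Lattice where

  open Counting
  open import Data.Fin using (Fin; zero; suc)
  open import Data.Fin.Properties using (all?)
  open import Data.Integer as ℤ using (ℤ; +_; ∣_∣; _/ℕ_; _%ℕ_)
  import Data.Integer.DivMod as ℤ
  import Data.Integer.Properties as ℤ
  open import Algebra.Properties.AbelianGroup ℤ.+-0-abelianGroup using (∙-cancelˡ)
  import Data.Integer.Tactic.RingSolver as ℤ-Solver
  open import Data.List using (List; []; _∷_; map; length; filter; upTo; cartesianProduct)
  open import Data.List.Membership.Propositional using (_∈_)
  open import Data.List.Membership.Propositional.Properties
  open import Data.List.Properties using (length-upTo)
  open import Data.List.Relation.Unary.Any using (here; there)
  open import Data.List.Relation.Unary.Unique.Propositional using (Unique)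
  import Data.List.Relation.Unary.Unique.Propositional.Properties as Unique
  open import Data.Nat
  open import Data.Nat.Properties
  open import Data.Nat.Tactic.RingSolver using (solve-∀)
  open import Data.Product using (∃; _×_; _,_; proj₁; proj₂)
  open import Data.Vec as Vec using (Vec; []; _∷_)
  open import Data.Vec.Properties using (∷-injective; ≡-dec)
  open import Data.Vec.Relation.Unary.All as AllV using ([]; _∷_) renaming (All to AllV)
  import Data.Vec.Relation.Unary.All.Properties as AllV
  open import Relation.Binary.PropositionalEquality
  open import Relation.Nullary using (yes; no; contradiction)
  open import Relation.Unary using (Decidable)

  infixl 6 _⊕_

  _⊕_ : ∀ {r} → Vec ℤ r → Vec ℤ r → Vec ℤ r
  _⊕_ = Vec.zipWith ℤ._+_

  scale : ∀ {r} → ℤ → Vec ℤ r → Vec ℤ r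
  scale c = Vec.map (c ℤ.*_)

  dot : ∀ {r} → Vec ℤ r → Vec ℤ r → ℤ
  dot []      []      = + 0
  dot (b ∷ β) (t ∷ v) = b ℤ.* t ℤ.+ dot β v

  dot-⊕ : ∀ {r} (β u v : Vec ℤ r) → dot β (u ⊕ v) ≡ dot β u ℤ.+ dot β v
  dot-⊕ []      []      []      = refl
  dot-⊕ (b ∷ β) (x ∷ u) (y ∷ v) = trans (cong (ℤ._+_ (b ℤ.* (x ℤ.+ y))) (dot-⊕ β u v))
    (shuffle b x y (dot β u) (dot β v))
    where
    shuffle : ∀ b x y p q → b ℤ.* (x ℤ.+ y) ℤ.+ (p ℤ.+ q) ≡ (b ℤ.* x ℤ.+ p) ℤ.+ (b ℤ.* y ℤ.+ q)
    shuffle = ℤ-Solver.solve-∀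

  dot-scale : ∀ {r} (β : Vec ℤ r) c v → dot β (scale c v) ≡ c ℤ.* dot β v
  dot-scale []      c []      = sym (ℤ.*-zeroʳ c)
  dot-scale (b ∷ β) c (x ∷ v) = trans (cong (ℤ._+_ (b ℤ.* (c ℤ.* x))) (dot-scale β c v))
    (shuffle b c x (dot β v))
    where
    shuffle : ∀ b c x p → b ℤ.* (c ℤ.* x) ℤ.+ c ℤ.* p ≡ c ℤ.* (b ℤ.* x ℤ.+ p)
    shuffle = ℤ-Solver.solve-∀

  dot-zero : ∀ {r} (β : Vec ℤ r) → dot β (Vec.replicate r (+ 0)) ≡ + 0
  dot-zero []      = refl
  dot-zero (b ∷ β) = cong₂ ℤ._+_ (ℤ.*-zeroʳ b) (dot-zero β)

  ⊕-cancelˡ : ∀ {r} (u : Vec ℤ r) {v w} → u ⊕ v ≡ u ⊕ w → v ≡ w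
  ⊕-cancelˡ []      {[]}    {[]}    _  = refl
  ⊕-cancelˡ (x ∷ u) {y ∷ v} {z ∷ w} eq =
    cong₂ _∷_ (∙-cancelˡ x y z (proj₁ (∷-injective eq))) (⊕-cancelˡ u (proj₂ (∷-injective eq)))

  Bounded : ∀ {r} → ℕ → Vec ℤ r → Set
  Bounded h = AllV (λ z → ∣ z ∣ ≤ h)

  bounded-⊕ : ∀ {r g h} {u v : Vec ℤ r} → Bounded g u → Bounded h v → Bounded (g + h) (u ⊕ v)
  bounded-⊕ []       []       = []
  bounded-⊕ {u = x ∷ _} {y ∷ _} (p ∷ ps) (q ∷ qs) =
    ≤-trans (ℤ.∣i+j∣≤∣i∣+∣j∣ x y) (+-mono-≤ p q) ∷ bounded-⊕ ps qs

  commonBound : ∀ {r} (ws : List (Vec ℤ r)) → ∃ λ h → ∀ {w} → w ∈ ws → Bounded h w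
  commonBound []       = 0 , λ ()
  commonBound (w ∷ ws) =
    let h , ws≤h = commonBound ws
        g , w≤g  = entries w
    in g ⊔ h , λ { (here refl) → AllV.map (λ z≤ → ≤-trans z≤ (m≤m⊔n g h)) w≤g
                 ; (there w∈)  → AllV.map (λ z≤ → ≤-trans z≤ (m≤n⊔m g h)) (ws≤h w∈) }
    where
    entries : ∀ {r} (v : Vec ℤ r) → ∃ λ g → Bounded g v
    entries []      = 0 , []
    entries (z ∷ v) = let g , v≤g = entries v in
      ∣ z ∣ ⊔ g , m≤m⊔n ∣ z ∣ g ∷ AllV.map (λ z≤ → ≤-trans z≤ (m≤n⊔m ∣ z ∣ g)) v≤g

  module Residues (s : ℕ) .{{_ : NonZero s}} where

    residue : ∀ {r} → Vec ℤ r → Vec ℕ r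
    residue = Vec.map (_%ℕ s)

    quotient : ∀ {r} → Vec ℤ r → Vec ℤ r → Vec ℤ r
    quotient = Vec.zipWith (λ a b → a /ℕ s ℤ.- b /ℕ s)

    residue∈ : ∀ {r} (w : Vec ℤ r) → residue w ∈ tuples (upTo s) r
    residue∈ w = ∈-tuples⁺ (AllV.map⁺ (AllV.universal (λ z → ∈-upTo⁺ (ℤ.n%ℕd<d z s)) w))

    quotient-correct : ∀ {r} (w v : Vec ℤ r) → residue w ≡ residue v →
      w ≡ v ⊕ scale (+ s) (quotient w v)
    quotient-correct []      []      _  = refl
    quotient-correct (a ∷ w) (b ∷ v) eq =
      cong₂ _∷_ entry (quotient-correct w v (proj₂ (∷-injective eq)))
      where
      open ≡-Reasoning
      shuffle : ∀ m p q s → m ℤ.+ p ℤ.* s ≡ (m ℤ.+ q ℤ.* s) ℤ.+ s ℤ.* (p ℤ.- q)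
      shuffle = ℤ-Solver.solve-∀
      entry : a ≡ b ℤ.+ + s ℤ.* (a /ℕ s ℤ.- b /ℕ s)
      entry = begin
        a                                     ≡⟨ ℤ.a≡a%ℕn+[a/ℕn]*n a s ⟩
        + (a %ℕ s) ℤ.+ a /ℕ s ℤ.* + s         ≡⟨ cong (λ m → + m ℤ.+ a /ℕ s ℤ.* + s) (proj₁ (∷-injective eq)) ⟩
        + (b %ℕ s) ℤ.+ a /ℕ s ℤ.* + s         ≡⟨ shuffle (+ (b %ℕ s)) (a /ℕ s) (b /ℕ s) (+ s) ⟩
        (+ (b %ℕ s) ℤ.+ b /ℕ s ℤ.* + s) ℤ.+ + s ℤ.* (a /ℕ s ℤ.- b /ℕ s)
                                              ≡⟨ cong (ℤ._+ + s ℤ.* (a /ℕ s ℤ.- b /ℕ s)) (sym (ℤ.a≡a%ℕn+[a/ℕn]*n b s)) ⟩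
        b ℤ.+ + s ℤ.* (a /ℕ s ℤ.- b /ℕ s)     ∎

    ∣quotient∣≤ : ∀ a b q c h → a ≡ b ℤ.+ + s ℤ.* q → ∣ a ∣ ≤ c → ∣ b ∣ ≤ c → 2 * c ≤ s * h →
      ∣ q ∣ ≤ h
    ∣quotient∣≤ a b q c h eq a≤c b≤c 2c≤sh = *-cancelˡ-≤ s (begin
      s * ∣ q ∣             ≡⟨ sym (ℤ.abs-* (+ s) q) ⟩
      ∣ + s ℤ.* q ∣         ≡⟨ cong ∣_∣ (shuffle b (+ s ℤ.* q)) ⟩
      ∣ b ℤ.+ + s ℤ.* q ℤ.- b ∣ ≡⟨ cong (λ a → ∣ a ℤ.- b ∣) (sym eq) ⟩
      ∣ a ℤ.- b ∣           ≤⟨ ℤ.∣i-j∣≤∣i∣+∣j∣ a b ⟩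
      ∣ a ∣ + ∣ b ∣         ≤⟨ +-mono-≤ a≤c b≤c ⟩
      c + c                 ≡⟨ cong (_+_ c) (sym (+-identityʳ c)) ⟩
      2 * c                 ≤⟨ 2c≤sh ⟩
      s * h                 ∎)
      where
      open ≤-Reasoning
      shuffle : ∀ b x → x ≡ b ℤ.+ x ℤ.- b
      shuffle = ℤ-Solver.solve-∀

    bounded-quotient : ∀ {r} (w v q : Vec ℤ r) c h → w ≡ v ⊕ scale (+ s) q →
      Bounded c w → Bounded c v → 2 * c ≤ s * h → Bounded h q
    bounded-quotient []      []      []      c h eq []       []       le = []
    bounded-quotient (a ∷ w) (b ∷ v) (q ∷ qs) c h eq (p ∷ ps) (p′ ∷ ps′) le =
      ∣quotient∣≤ a b q c h (proj₁ (∷-injective eq)) p p′ le ∷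
      bounded-quotient w v qs c h (proj₂ (∷-injective eq)) ps ps′ le

    -- A choice that depends on the residue alone, so that the residue and the quotient together
    -- determine the vector. The zero vector is returned only for residues that do not occur in the
    -- list.
    representative : ∀ {r} → List (Vec ℤ r) → Vec ℕ r → Vec ℤ r
    representative []       ρ = Vec.replicate _ (+ 0)
    representative (w ∷ ws) ρ with ≡-dec _≟_ (residue w) ρ
    ... | yes _ = w
    ... | no _  = representative ws ρ

    representative-correct : ∀ {r} (ws : List (Vec ℤ r)) {w} → w ∈ ws →
      let v = representative ws (residue w) in v ∈ ws × residue w ≡ residue v
    representative-correct (w ∷ ws) {v} v∈ with ≡-dec _≟_ (residue w) (residue v)
    representative-correct (w ∷ ws) v∈          | yes eq = here refl , sym eq
    representative-correct (w ∷ ws) (here refl) | no neq = contradiction refl neq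
    representative-correct (w ∷ ws) (there v∈)  | no neq =
      let v∈′ , eq = representative-correct ws v∈ in there v∈′ , eq

  -- Let K be the lattice points of norm at most ρ.  The sums α x + t with t ∈ K
  -- have norm at most R + ρ, so two of them that agree modulo s differ by s times
  -- an element of K: there are at most s ^ r ∙ |K| sums.  No volume is needed.
  packing : ∀ {T P : Set} {n r} (s R ρ : ℕ) (β : Fin n → Vec ℤ r)
    {X : List T} (Ps : List P) (α : T → Vec ℤ r) (π : T → P) →
    4 ≤ s → 2 * (R + ρ) ≤ s * ρ → Unique X →
    (∀ {x} → x ∈ X → π x ∈ Ps) →
    (∀ {x} → x ∈ X → ∀ j → ∣ dot (β j) (α x) ∣ ≤ R) →
    (∀ {x y} → x ∈ X → y ∈ X →
      (∀ j → ∣ dot (β j) (α x) ℤ.- dot (β j) (α y) ∣ ≤ 2 * ρ) → π x ≡ π y → x ≡ y) →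
    length X ≤ s ^ r * length Ps
  packing {T} {P} {n} {r} s@(suc _) R ρ β {X} Ps α π 4≤s R≤ X-unique π∈ α≤R separated =
    *-cancelʳ-≤ (length X) (s ^ r * length Ps) (length K) {{K-nonZero}} (begin
      length X * length K                            ≡⟨ sym (length-cartesianProductWith _,_ X K) ⟩
      length XK                                      ≤⟨ injection⇒length≤ target f XK-unique f∈ f-injective ⟩
      length target                                  ≡⟨ length-cartesianProductWith _,_ (tuples (upTo s) r) (cartesianProduct K Ps) ⟩
      length (tuples (upTo s) r) * length (cartesianProduct K Ps)
        ≡⟨ cong₂ _*_ (trans (length-tuples (upTo s) r) (cong (_^ r) (length-upTo s))) (length-cartesianProductWith _,_ K Ps) ⟩
      s ^ r * (length K * length Ps)                 ≡⟨ shuffle (s ^ r) (length K) (length Ps) ⟩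
      s ^ r * length Ps * length K                   ∎)
    where
    open ≤-Reasoning
    open Residues s
    shuffle : ∀ a b c → a * (b * c) ≡ a * c * b
    shuffle = solve-∀

    Small : Vec ℤ r → Set
    Small t = ∀ j → ∣ dot (β j) t ∣ ≤ ρ

    small? : Decidable Small
    small? t = all? (λ j → ∣ dot (β j) t ∣ ≤? ρ)

    -- The forms `β j` may have a common kernel, so smallness alone would not make `K` finite;
    -- coefficients are also confined to a box. The box of the vectors `α x` is large enough: a sum
    -- lies in the box 2h, a difference of two sums in 4h, and dividing by s ≥ 4 returns to h.
    h = proj₁ (commonBound (map α X))

    K : List (Vec ℤ r)
    K = filter small? (tuples (ball h) r)

    ∈K⁺ : ∀ {t} → Bounded h t → Small t → t ∈ K
    ∈K⁺ t≤h small = ∈-filter⁺ small? (∈-tuples⁺ (AllV.map (λ {z} → ∈-ball⁺ z) t≤h)) small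

    ∈K⁻ : ∀ {t} → t ∈ K → Bounded h t × Small t
    ∈K⁻ t∈ = let t∈′ , small = ∈-filter⁻ small? t∈ in
      AllV.map (∈-ball⁻ h) (∈-tuples⁻ (ball h) t∈′) , small

    K-unique : Unique K
    K-unique = Unique.filter⁺ small? (tuples-unique (ball-unique h) r)

    zeros : ∀ k → Bounded h (Vec.replicate k (+ 0))
    zeros zero    = []
    zeros (suc k) = z≤n ∷ zeros k

    K-nonZero : NonZero (length K)
    K-nonZero with K | ∈K⁺ (zeros r) (λ j → subst (λ z → ∣ z ∣ ≤ ρ) (sym (dot-zero (β j))) z≤n)
    ... | _ ∷ _ | _ = _

    XK : List (T × Vec ℤ r)
    XK = cartesianProduct X K

    XK-unique : Unique XK
    XK-unique = Unique.cartesianProduct⁺ X-unique K-unique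

    value : T × Vec ℤ r → Vec ℤ r
    value (x , t) = α x ⊕ t

    values = map value XK

    base : T × Vec ℤ r → Vec ℤ r
    base e = representative values (residue (value e))

    target = cartesianProduct (tuples (upTo s) r) (cartesianProduct K Ps)

    f : T × Vec ℤ r → Vec ℕ r × Vec ℤ r × P
    f e = residue (value e) , quotient (value e) (base e) , π (proj₁ e)

    value-bounded : ∀ {w} → w ∈ values → Bounded (h + h) w
    value-bounded w∈ with ∈-map⁻ value w∈
    ... | (x , t) , e∈ , refl with ∈-cartesianProduct⁻ X K e∈
    ... | x∈ , t∈ = bounded-⊕ (proj₂ (commonBound (map α X)) (∈-map⁺ α x∈)) (proj₁ (∈K⁻ t∈))

    value-small : ∀ {w} → w ∈ values → ∀ j → ∣ dot (β j) w ∣ ≤ R + ρ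
    value-small w∈ j with ∈-map⁻ value w∈
    ... | (x , t) , e∈ , refl with ∈-cartesianProduct⁻ X K e∈
    ... | x∈ , t∈ rewrite dot-⊕ (β j) (α x) t =
      ≤-trans (ℤ.∣i+j∣≤∣i∣+∣j∣ (dot (β j) (α x)) _) (+-mono-≤ (α≤R x∈ j) (proj₂ (∈K⁻ t∈) j))

    module _ {e} (e∈ : e ∈ XK) where
      base∈ : base e ∈ values
      base∈ = proj₁ (representative-correct values (∈-map⁺ value e∈))

      value≡ : value e ≡ base e ⊕ scale (+ s) (quotient (value e) (base e))
      value≡ = quotient-correct (value e) (base e)
        (proj₂ (representative-correct values (∈-map⁺ value e∈)))

      dot-value≡ : ∀ j → dot (β j) (value e) ≡
        dot (β j) (base e) ℤ.+ + s ℤ.* dot (β j) (quotient (value e) (base e))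
      dot-value≡ j = trans (cong (dot (β j)) value≡) (trans (dot-⊕ (β j) (base e) _)
        (cong (ℤ._+_ (dot (β j) (base e))) (dot-scale (β j) (+ s) _)))

      f∈ : f e ∈ target
      f∈ = ∈-cartesianProduct⁺ (residue∈ (value e)) (∈-cartesianProduct⁺
        (∈K⁺
          (bounded-quotient (value e) (base e) _ (h + h) h value≡
            (value-bounded (∈-map⁺ value e∈)) (value-bounded base∈)
            (≤-trans (≤-reflexive (four h)) (*-monoˡ-≤ h 4≤s)))
          (λ j → ∣quotient∣≤ _ (dot (β j) (base e)) (dot (β j) (quotient (value e) (base e))) (R + ρ) ρ (dot-value≡ j)
            (value-small (∈-map⁺ value e∈) j) (value-small base∈ j) R≤))
        (π∈ (proj₁ (∈-cartesianProduct⁻ X K e∈))))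
        where
        four : ∀ h → 2 * (h + h) ≡ 4 * h
        four = solve-∀

    -- Equal residues give the same `base`, and with equal quotients the sums agree: α x + t = α y +
    -- u. Then α x - α y = u - t is a difference of two small vectors, which `separated` excludes
    -- unless x = y.
    f-injective : ∀ {e e′} → e ∈ XK → e′ ∈ XK → f e ≡ f e′ → e ≡ e′
    f-injective {x , t} {y , u} e∈ e′∈ eq
      with ∈-cartesianProduct⁻ X K e∈ | ∈-cartesianProduct⁻ X K e′∈
    ... | x∈ , t∈ | y∈ , u∈ = finish (separated x∈ y∈ close (cong (λ p → proj₂ (proj₂ p)) eq))
      where
      values≡ : α x ⊕ t ≡ α y ⊕ u
      values≡ = trans (value≡ e∈) (trans
        (cong₂ (λ v q → v ⊕ scale (+ s) q) (cong (representative values) (cong proj₁ eq))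
          (cong (λ p → proj₁ (proj₂ p)) eq))
        (sym (value≡ e′∈)))
      difference : ∀ a b c d → a ℤ.+ b ≡ c ℤ.+ d → a ℤ.- c ≡ d ℤ.- b
      difference a b c d eq = trans (expand a b c) (trans (cong (λ z → z ℤ.- b ℤ.- c) eq) (collapse b c d))
        where
        expand : ∀ a b c → a ℤ.- c ≡ a ℤ.+ b ℤ.- b ℤ.- c
        expand = ℤ-Solver.solve-∀
        collapse : ∀ b c d → c ℤ.+ d ℤ.- b ℤ.- c ≡ d ℤ.- b
        collapse = ℤ-Solver.solve-∀
      close : ∀ j → ∣ dot (β j) (α x) ℤ.- dot (β j) (α y) ∣ ≤ 2 * ρ
      close j = begin
        ∣ dot (β j) (α x) ℤ.- dot (β j) (α y) ∣   ≡⟨ cong ∣_∣ (difference (dot (β j) (α x)) (dot (β j) t) (dot (β j) (α y)) (dot (β j) u)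
          (trans (sym (dot-⊕ (β j) (α x) t)) (trans (cong (dot (β j)) values≡) (dot-⊕ (β j) (α y) u)))) ⟩
        ∣ dot (β j) u ℤ.- dot (β j) t ∣           ≤⟨ ℤ.∣i-j∣≤∣i∣+∣j∣ (dot (β j) u) _ ⟩
        ∣ dot (β j) u ∣ + ∣ dot (β j) t ∣         ≤⟨ +-mono-≤ (proj₂ (∈K⁻ u∈) j) (proj₂ (∈K⁻ t∈) j) ⟩
        ρ + ρ                                     ≡⟨ cong (_+_ ρ) (sym (+-identityʳ ρ)) ⟩
        2 * ρ                                     ∎
      finish : x ≡ y → (x , t) ≡ (y , u)
      finish refl = cong (x ,_) (⊕-cancelˡ (α x) values≡)

-- Random sign vectors: second moment, decoding, and the integer rank bound.

module SignVectors where

  open Counting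
  open Lattice
  open import Data.Bool using (Bool; true; false)
  open import Data.Fin as Fin using (Fin; zero; suc)
  import Data.Fin.Induction as Fin
  open import Data.Integer as ℤ using (ℤ; +_; -[1+_]; ∣_∣)
  import Data.Integer.Properties as ℤ
  import Data.Integer.Tactic.RingSolver as ℤ-Solver
  open import Data.List using (List; []; _∷_; length; filter)
  open import Data.List.Membership.Propositional using (_∈_)
  open import Data.List.Membership.Propositional.Properties using (∈-filter⁻)
  open import Data.List.Relation.Unary.AllPairs using ([]; _∷_)
  open import Data.List.Relation.Unary.All using ([]; _∷_)
  open import Data.List.Relation.Unary.Unique.Propositional using (Unique)
  import Data.List.Relation.Unary.Unique.Propositional.Properties as Unique
  open import Data.Maybe using (Maybe; nothing; just)
  open import Data.Maybe.Properties using (just-injective)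
  open import Data.Nat
  open import Data.Nat.Properties
  open import Data.Nat.Tactic.RingSolver using (solve-∀)
  open import Data.Product using (proj₂)
  open import Data.Vec as Vec using (Vec; []; _∷_; lookup; tabulate)
  open import Data.Vec.Properties using (lookup∘tabulate; tabulate∘lookup; tabulate-cong)
  open import Function using (_∘_)
  open import Induction.WellFounded using (Acc; acc)
  open import Relation.Binary.PropositionalEquality
  open import Relation.Nullary using (yes; no; contradiction)

  signed : Bool → ℤ → ℤ
  signed true  z = z
  signed false z = ℤ.- z

  ∣signed∣ : ∀ b z → ∣ signed b z ∣ ≡ ∣ z ∣
  ∣signed∣ true  z = refl
  ∣signed∣ false z = ℤ.∣-i∣≡∣i∣ z

  pair : ∀ {n} → (Fin n → ℤ) → Vec Bool n → ℤ
  pair u []      = + 0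
  pair u (b ∷ x) = signed b (u zero) ℤ.+ pair (u ∘ suc) x

  before after : ∀ {n} → Fin n → (Fin n → ℤ) → Vec Bool n → ℤ
  before zero    u (b ∷ x) = + 0
  before (suc j) u (b ∷ x) = signed b (u zero) ℤ.+ before j (u ∘ suc) x
  after zero    u (b ∷ x) = pair (u ∘ suc) x
  after (suc j) u (b ∷ x) = after j (u ∘ suc) x

  pair-split : ∀ {n} j (u : Fin n → ℤ) x →
    pair u x ≡ before j u x ℤ.+ signed (lookup x j) (u j) ℤ.+ after j u x
  pair-split zero    u (b ∷ x) = cong (ℤ._+ pair (u ∘ suc) x) (sym (ℤ.+-identityˡ (signed b (u zero))))
  pair-split (suc j) u (b ∷ x) = trans (cong (ℤ._+_ (signed b (u zero))) (pair-split j (u ∘ suc) x))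
    (assoc (signed b (u zero)) (before j (u ∘ suc) x) (signed (lookup x j) (u (suc j))) (after j (u ∘ suc) x))
    where
    assoc : ∀ p q r s → p ℤ.+ (q ℤ.+ r ℤ.+ s) ≡ p ℤ.+ q ℤ.+ r ℤ.+ s
    assoc = ℤ-Solver.solve-∀

  before-cong : ∀ {n} j (u : Fin n → ℤ) x y → (∀ i → i Fin.< j → lookup x i ≡ lookup y i) →
    before j u x ≡ before j u y
  before-cong zero    u (b ∷ x) (c ∷ y) x≡y = refl
  before-cong (suc j) u (b ∷ x) (c ∷ y) x≡y = cong₂ ℤ._+_
    (cong (λ d → signed d (u zero)) (x≡y zero (s≤s z≤n)))
    (before-cong j (u ∘ suc) x y (λ i i<j → x≡y (suc i) (s≤s i<j)))

  ∣pair∣≤ : ∀ {n} (u : Fin n → ℤ) x b → (∀ i → ∣ u i ∣ ≤ b) → ∣ pair u x ∣ ≤ n * b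
  ∣pair∣≤ u []      b u≤b = z≤n
  ∣pair∣≤ u (c ∷ x) b u≤b = ≤-trans (ℤ.∣i+j∣≤∣i∣+∣j∣ (signed c (u zero)) _)
    (+-mono-≤ (≤-trans (≤-reflexive (∣signed∣ c (u zero))) (u≤b zero)) (∣pair∣≤ (u ∘ suc) x b (u≤b ∘ suc)))

  combine : ∀ {n r} → (Fin n → Vec ℤ r) → Vec Bool n → Vec ℤ r
  combine a []          = Vec.replicate _ (+ 0)
  combine a (true ∷ x)  = a zero ⊕ combine (a ∘ suc) x
  combine a (false ∷ x) = scale ℤ.-1ℤ (a zero) ⊕ combine (a ∘ suc) x

  dot-combine : ∀ {n r} (β : Vec ℤ r) (a : Fin n → Vec ℤ r) x →
    dot β (combine a x) ≡ pair (λ i → dot β (a i)) x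
  dot-combine β a []          = dot-zero β
  dot-combine β a (true ∷ x)  = trans (dot-⊕ β (a zero) _) (cong (ℤ._+_ (dot β (a zero))) (dot-combine β (a ∘ suc) x))
  dot-combine β a (false ∷ x) = trans (dot-⊕ β (scale ℤ.-1ℤ (a zero)) _)
    (cong₂ ℤ._+_ (trans (dot-scale β ℤ.-1ℤ (a zero)) (ℤ.-1*i≡-i _)) (dot-combine β (a ∘ suc) x))

  sq : ℤ → ℕ
  sq z = ∣ z ∣ * ∣ z ∣

  +sq : ∀ z → + sq z ≡ z ℤ.* z
  +sq z = trans (ℤ.pos-* ∣ z ∣ ∣ z ∣) (abs*abs z)
    where
    abs*abs : ∀ z → + ∣ z ∣ ℤ.* + ∣ z ∣ ≡ z ℤ.* z
    abs*abs (+ n)    = refl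
    abs*abs -[1+ n ] = refl

  parallelogram : ∀ c u → sq (c ℤ.+ u) + sq (c ℤ.+ ℤ.- u) ≡ 2 * (sq c + sq u)
  parallelogram c u = ℤ.+-injective (begin
    + (sq (c ℤ.+ u) + sq (c ℤ.+ ℤ.- u))             ≡⟨ ℤ.pos-+ (sq (c ℤ.+ u)) _ ⟩
    + sq (c ℤ.+ u) ℤ.+ + sq (c ℤ.+ ℤ.- u)           ≡⟨ cong₂ ℤ._+_ (+sq (c ℤ.+ u)) (+sq (c ℤ.+ ℤ.- u)) ⟩
    (c ℤ.+ u) ℤ.* (c ℤ.+ u) ℤ.+ (c ℤ.+ ℤ.- u) ℤ.* (c ℤ.+ ℤ.- u)  ≡⟨ identity c u ⟩
    + 2 ℤ.* (c ℤ.* c ℤ.+ u ℤ.* u)                   ≡⟨ cong (ℤ._*_ (+ 2)) (cong₂ ℤ._+_ (sym (+sq c)) (sym (+sq u))) ⟩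
    + 2 ℤ.* (+ sq c ℤ.+ + sq u)                     ≡⟨ cong (ℤ._*_ (+ 2)) (sym (ℤ.pos-+ (sq c) (sq u))) ⟩
    + 2 ℤ.* + (sq c + sq u)                         ≡⟨ sym (ℤ.pos-* 2 (sq c + sq u)) ⟩
    + (2 * (sq c + sq u))                           ∎)
    where
    open ≡-Reasoning
    identity : ∀ c u → (c ℤ.+ u) ℤ.* (c ℤ.+ u) ℤ.+ (c ℤ.+ ℤ.- u) ℤ.* (c ℤ.+ ℤ.- u) ≡ + 2 ℤ.* (c ℤ.* c ℤ.+ u ℤ.* u)
    identity = ℤ-Solver.solve-∀

  cube : ∀ n → List (Vec Bool n)
  cube = tuples (true ∷ false ∷ [])

  cube-unique : ∀ n → Unique (cube n)
  cube-unique = tuples-unique (((λ ()) ∷ []) ∷ [] ∷ [])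

  ∑-cube-suc : ∀ n (f : Vec Bool (suc n) → ℕ) →
    ∑ (cube (suc n)) f ≡ ∑[ x ∈ cube n ] (f (true ∷ x) + f (false ∷ x))
  ∑-cube-suc n f = begin
    ∑ (cube (suc n)) f                                     ≡⟨ ∑-++ (Data.List.map (true ∷_) (cube n)) _ f ⟩
    ∑ (Data.List.map (true ∷_) (cube n)) f + _             ≡⟨ cong₂ _+_ (∑-map (cube n) (true ∷_) f)
      (trans (∑-++ (Data.List.map (false ∷_) (cube n)) [] f) (trans (+-identityʳ _) (∑-map (cube n) (false ∷_) f))) ⟩
    ∑ (cube n) (f ∘ (true ∷_)) + ∑ (cube n) (f ∘ (false ∷_)) ≡⟨ sym (∑-+ (cube n) _ _) ⟩
    ∑[ x ∈ cube n ] (f (true ∷ x) + f (false ∷ x))         ∎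
    where open ≡-Reasoning

  module SecondMoment (W b : ℕ) where

    -- Cross terms cancel on average over the signs. The offset `c` holds the terms already fixed,
    -- so that the induction splits on the first sign by the parallelogram law; the factor `W`
    -- avoids dividing in the bound on the entries.
    secondMoment : ∀ {n} (u : Fin n → ℤ) c → (∀ i → W * sq (u i) ≤ b) →
      W * ∑[ x ∈ cube n ] sq (c ℤ.+ pair u x) ≤ 2 ^ n * (W * sq c + n * b)
    secondMoment {zero}  u c u≤b = ≤-reflexive (trans
      (cong (λ z → W * (sq z + 0)) (ℤ.+-identityʳ c)) (shuffle W (sq c)))
      where
      shuffle : ∀ w s → w * (s + 0) ≡ 1 * (w * s + 0)
      shuffle = solve-∀
    secondMoment {suc n} u c u≤b = begin
      W * ∑[ x ∈ cube (suc n) ] sq (c ℤ.+ pair u x)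
        ≡⟨ cong (W *_) (trans (∑-cube-suc n _) (trans (∑-cong (cube n) λ x →
             cong₂ (λ p q → sq p + sq q) (sym (ℤ.+-assoc c (u zero) _)) (sym (ℤ.+-assoc c (ℤ.- u zero) _))) (∑-+ (cube n) _ _))) ⟩
      W * (S (c ℤ.+ u zero) + S (c ℤ.+ ℤ.- u zero))
        ≡⟨ *-distribˡ-+ W (S (c ℤ.+ u zero)) _ ⟩
      W * S (c ℤ.+ u zero) + W * S (c ℤ.+ ℤ.- u zero)
        ≤⟨ +-mono-≤ (secondMoment (u ∘ suc) (c ℤ.+ u zero) (u≤b ∘ suc))
                    (secondMoment (u ∘ suc) (c ℤ.+ ℤ.- u zero) (u≤b ∘ suc)) ⟩
      2 ^ n * (W * sq (c ℤ.+ u zero) + n * b) + 2 ^ n * (W * sq (c ℤ.+ ℤ.- u zero) + n * b)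
        ≡⟨ gather (2 ^ n) W (sq (c ℤ.+ u zero)) (sq (c ℤ.+ ℤ.- u zero)) (n * b) ⟩
      2 ^ n * (W * (sq (c ℤ.+ u zero) + sq (c ℤ.+ ℤ.- u zero)) + 2 * (n * b))
        ≡⟨ cong (λ z → 2 ^ n * (W * z + 2 * (n * b))) (parallelogram c (u zero)) ⟩
      2 ^ n * (W * (2 * (sq c + sq (u zero))) + 2 * (n * b))
        ≡⟨ regroup (2 ^ n) W (sq c) (sq (u zero)) (n * b) ⟩
      2 * 2 ^ n * (W * sq c + (W * sq (u zero) + n * b))
        ≤⟨ *-monoʳ-≤ (2 * 2 ^ n) (+-monoʳ-≤ (W * sq c) (+-monoˡ-≤ (n * b) (u≤b zero))) ⟩
      2 * 2 ^ n * (W * sq c + (b + n * b)) ∎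
      where
      open ≤-Reasoning
      S : ℤ → ℕ
      S d = ∑[ x ∈ cube n ] sq (d ℤ.+ pair (u ∘ suc) x)
      gather : ∀ N w p q m → N * (w * p + m) + N * (w * q + m) ≡ N * (w * (p + q) + 2 * m)
      gather = solve-∀
      regroup : ∀ N w p q m → N * (w * (2 * (p + q)) + 2 * m) ≡ 2 * N * (w * p + (w * q + m))
      regroup = solve-∀

    -- The signs up to position j do not occur in `after j`; each of them merely doubles the sum
    -- over the cube.
    secondMoment-after : ∀ {n} j (u : Fin n → ℤ) → (∀ i → j Fin.< i → W * sq (u i) ≤ b) →
      W * ∑[ x ∈ cube n ] sq (after j u x) ≤ 2 ^ n * (n * b)
    secondMoment-after {suc n} zero u u≤b = begin
      W * ∑[ x ∈ cube (suc n) ] sq (after zero u x)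
        ≡⟨ cong (W *_) (trans (∑-cube-suc n _) (∑-double (cube n) _)) ⟩
      W * (2 * S)                                   ≡⟨ swap W S ⟩
      2 * (W * S)                                   ≡⟨ cong (λ z → 2 * (W * z)) (∑-cong (cube n) λ x → cong sq (sym (ℤ.+-identityˡ (pair (u ∘ suc) x)))) ⟩
      2 * (W * ∑[ x ∈ cube n ] sq (+ 0 ℤ.+ pair (u ∘ suc) x))
        ≤⟨ *-monoʳ-≤ 2 (secondMoment (u ∘ suc) (+ 0) (λ i → u≤b (suc i) (s≤s z≤n))) ⟩
      2 * (2 ^ n * (W * 0 + n * b))                 ≡⟨ cong (λ z → 2 * (2 ^ n * (z + n * b))) (*-zeroʳ W) ⟩
      2 * (2 ^ n * (n * b))                         ≡⟨ sym (*-assoc 2 (2 ^ n) _) ⟩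
      2 * 2 ^ n * (n * b)                           ≤⟨ *-monoʳ-≤ (2 * 2 ^ n) (m≤n+m (n * b) b) ⟩
      2 * 2 ^ n * (b + n * b)                       ∎
      where
      open ≤-Reasoning
      S = ∑[ x ∈ cube n ] sq (pair (u ∘ suc) x)
      swap : ∀ w s → w * (2 * s) ≡ 2 * (w * s)
      swap = solve-∀
    secondMoment-after {suc n} (suc j) u u≤b = begin
      W * ∑[ x ∈ cube (suc n) ] sq (after (suc j) u x)
        ≡⟨ cong (W *_) (trans (∑-cube-suc n _) (∑-double (cube n) _)) ⟩
      W * (2 * S)                                   ≡⟨ swap W S ⟩
      2 * (W * S)                                   ≤⟨ *-monoʳ-≤ 2 (secondMoment-after j (u ∘ suc) (λ i j<i → u≤b (suc i) (s≤s j<i))) ⟩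
      2 * (2 ^ n * (n * b))                         ≡⟨ sym (*-assoc 2 (2 ^ n) _) ⟩
      2 * 2 ^ n * (n * b)                           ≤⟨ *-monoʳ-≤ (2 * 2 ^ n) (m≤n+m (n * b) b) ⟩
      2 * 2 ^ n * (b + n * b)                       ∎
      where
      open ≤-Reasoning
      S = ∑[ x ∈ cube n ] sq (after j (u ∘ suc) x)
      swap : ∀ w s → w * (2 * s) ≡ 2 * (w * s)
      swap = solve-∀

  -- Markov's inequality across the rows: every mark is paid for by at least `d` in its own row.
  marks-tabulate : ∀ {n} (f : Fin n → Maybe Bool) (g : Fin n → ℕ) d →
    (∀ j {b} → f j ≡ just b → d ≤ g j) → d * marks (tabulate f) ≤ ∑Fin g
  marks-tabulate {zero}  f g d d≤g = ≤-reflexive (*-zeroʳ d)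
  marks-tabulate {suc n} f g d d≤g with f zero in eq
  ... | nothing = ≤-trans (marks-tabulate (f ∘ suc) (g ∘ suc) d (d≤g ∘ suc)) (m≤n+m _ (g zero))
  ... | just b  = ≤-trans (≤-reflexive (*-suc d _))
    (+-mono-≤ (d≤g zero eq) (marks-tabulate (f ∘ suc) (g ∘ suc) d (d≤g ∘ suc)))

  signed-gap : ∀ {b c} d → b ≢ c → ∣ signed b (+ d) ℤ.- signed c (+ d) ∣ ≡ d + d
  signed-gap {true}  {true}  d b≢c = contradiction refl b≢c
  signed-gap {true}  {false} d b≢c = cong (λ z → ∣ + d ℤ.+ z ∣) (ℤ.neg-involutive (+ d))
  signed-gap {false} {true}  d b≢c = trans (cong ∣_∣ (sym (ℤ.neg-distrib-+ (+ d) (+ d)))) (ℤ.∣-i∣≡∣i∣ (+ d ℤ.+ + d))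
  signed-gap {false} {false} d b≢c = contradiction refl b≢c

  -- A sign vector x is decoded from an approximation of M x one entry at a time:
  -- once the entries before j are known, the j-th row determines the j-th sign,
  -- except where the part of M above the diagonal contributes too much.  Those
  -- exceptions are recorded in the pattern of x; the second moment shows that a
  -- typical x has few of them.
  module Decoding {p r : ℕ} (Q ρ : ℕ) (B a : Fin (8 * p) → Vec ℤ r)
    (0<p : 0 < p) (0<ρ : 0 < ρ)
    (diagonal : ∀ i → dot (B i) (a i) ≡ + (4 * ρ))
    (dominant : ∀ j i → ∣ dot (B j) (a i) ∣ ≤ 8 * ρ)
    (lower : ∀ j i → j Fin.< i → Q * ∣ dot (B j) (a i) ∣ ≤ 4 * ρ)
    (64n≤Q² : 64 * (8 * p) ≤ Q * Q)
    where

    n = 8 * p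

    instance
      p≢0 : NonZero p
      p≢0 = >-nonZero 0<p
      ρ≢0 : NonZero ρ
      ρ≢0 = >-nonZero 0<ρ
      n≢0 : NonZero n
      n≢0 = m*n≢0 8 p

    M : Fin n → Fin n → ℤ
    M j i = dot (B j) (a i)

    -- The threshold is half the diagonal entry 4ρ. A wrong sign shifts a row by 8ρ, while two
    -- errors below 2ρ and the tolerance 2ρ together stay below 6ρ.
    defect : Vec Bool n → Fin n → Maybe Bool
    defect x j with 2 * ρ ≤? ∣ after j (M j) x ∣
    ... | yes _ = just (lookup x j)
    ... | no _  = nothing

    patternOf : Vec Bool n → Vec (Maybe Bool) n
    patternOf x = tabulate (defect x)

    defect-large : ∀ x j {b} → defect x j ≡ just b → 4 * (ρ * ρ) ≤ sq (after j (M j) x)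
    defect-large x j eq with 2 * ρ ≤? ∣ after j (M j) x ∣
    ... | yes le = ≤-trans (≤-reflexive (square ρ)) (*-mono-≤ le le)
      where
      square : ∀ ρ → 4 * (ρ * ρ) ≡ 2 * ρ * (2 * ρ)
      square = solve-∀

    total = ∑[ x ∈ cube n ] marks (patternOf x)

    upper² : ∀ j i → j Fin.< i → Q * Q * sq (M j i) ≤ 16 * (ρ * ρ)
    upper² j i j<i = begin
      Q * Q * sq (M j i)                      ≡⟨ interchange Q ∣ M j i ∣ ⟩
      Q * ∣ M j i ∣ * (Q * ∣ M j i ∣)         ≤⟨ *-mono-≤ (lower j i j<i) (lower j i j<i) ⟩
      4 * ρ * (4 * ρ)                         ≡⟨ square ρ ⟩
      16 * (ρ * ρ)                            ∎
      where
      open ≤-Reasoning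
      interchange : ∀ q m → q * q * (m * m) ≡ q * m * (q * m)
      interchange = solve-∀
      square : ∀ ρ → 4 * ρ * (4 * ρ) ≡ 16 * (ρ * ρ)
      square = solve-∀

    -- Chebyshev: the mean square of the part after the diagonal is at most n (4ρ/Q)², so a row
    -- reaches 2ρ with probability at most 4n/Q² ≤ 1/16. There are 8p rows, hence p/2 defects on
    -- average.
    2total≤ : 2 * total ≤ p * 2 ^ n
    2total≤ = *-cancelˡ-≤ (32 * n * (4 * (ρ * ρ))) {{m*n≢0 (32 * n) (4 * (ρ * ρ)) {{m*n≢0 32 n}} {{m*n≢0 4 (ρ * ρ) {{_}} {{m*n≢0 ρ ρ}}}}}} (begin
      32 * n * (4 * (ρ * ρ)) * (2 * total)             ≡⟨ shuffle₁ n (4 * (ρ * ρ)) total ⟩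
      64 * n * (4 * (ρ * ρ) * total)                   ≤⟨ *-monoˡ-≤ (4 * (ρ * ρ) * total) 64n≤Q² ⟩
      Q * Q * (4 * (ρ * ρ) * total)                    ≡⟨ cong (Q * Q *_) (∑-distribˡ (cube n) (marks ∘ patternOf) (4 * (ρ * ρ))) ⟩
      Q * Q * ∑[ x ∈ cube n ] (4 * (ρ * ρ) * marks (patternOf x))
        ≤⟨ *-monoʳ-≤ (Q * Q) (∑-mono (cube n) λ x → marks-tabulate (defect x) (λ j → sq (after j (M j) x)) _ (defect-large x)) ⟩
      Q * Q * ∑[ x ∈ cube n ] ∑Fin (λ j → sq (after j (M j) x))
        ≡⟨ cong (Q * Q *_) (∑-∑Fin-comm (cube n) (λ x j → sq (after j (M j) x))) ⟩
      Q * Q * ∑Fin (λ j → ∑[ x ∈ cube n ] sq (after j (M j) x))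
        ≡⟨ ∑Fin-distribˡ {n} (λ j → ∑[ x ∈ cube n ] sq (after j (M j) x)) (Q * Q) ⟩
      ∑Fin (λ j → Q * Q * ∑[ x ∈ cube n ] sq (after j (M j) x))
        ≤⟨ ∑Fin-mono-const _ _ (λ j → secondMoment-after j (M j) (upper² j)) ⟩
      n * (2 ^ n * (n * (16 * (ρ * ρ))))               ≡⟨ shuffle₂ p (2 ^ n) (ρ * ρ) ⟩
      32 * n * (4 * (ρ * ρ)) * (p * 2 ^ n)             ∎)
      where
      open ≤-Reasoning
      open SecondMoment (Q * Q) (16 * (ρ * ρ))
      shuffle₁ : ∀ n d t → 32 * n * d * (2 * t) ≡ 64 * n * (d * t)
      shuffle₁ = solve-∀
      shuffle₂ : ∀ p N d → 8 * p * (N * (8 * p * (16 * d))) ≡ 32 * (8 * p) * (4 * d) * (p * N)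
      shuffle₂ = solve-∀

    X : List (Vec Bool n)
    X = filter (λ x → marks (patternOf x) ≤? p) (cube n)

    -- With mean at most p/2, Markov leaves a fraction of at most p / (2(p + 1)) < 1/2 with more
    -- than p marks. The factor 2 + p arises from 2(p + 1) = p + (2 + p).
    2ⁿ≤2∣X∣ : 2 ^ n ≤ 2 * length X
    2ⁿ≤2∣X∣ = *-cancelˡ-≤ (2 + p) (+-cancelˡ-≤ (p * 2 ^ n) _ _ (begin
      p * 2 ^ n + (2 + p) * 2 ^ n                  ≡⟨ shuffle₁ p (2 ^ n) ⟩
      2 * (suc p * 2 ^ n)                          ≡⟨ cong (λ N → 2 * (suc p * N)) (sym (length-tuples (true ∷ false ∷ []) n)) ⟩
      2 * (suc p * length (cube n))                ≤⟨ *-monoʳ-≤ 2 (markov (cube n) (marks ∘ patternOf) p) ⟩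
      2 * (total + suc p * length X)               ≡⟨ *-distribˡ-+ 2 total _ ⟩
      2 * total + 2 * (suc p * length X)           ≤⟨ +-monoˡ-≤ _ 2total≤ ⟩
      p * 2 ^ n + 2 * (suc p * length X)           ≤⟨ +-monoʳ-≤ (p * 2 ^ n) (*-monoʳ-≤ 2 (*-monoˡ-≤ (length X) (n≤1+n (suc p)))) ⟩
      p * 2 ^ n + 2 * ((2 + p) * length X)         ≡⟨ cong (_+_ (p * 2 ^ n)) (shuffle₂ (2 + p) (length X)) ⟩
      p * 2 ^ n + (2 + p) * (2 * length X)         ∎))
      where
      open ≤-Reasoning
      shuffle₁ : ∀ p N → p * N + (2 + p) * N ≡ 2 * (suc p * N)
      shuffle₁ = solve-∀
      shuffle₂ : ∀ q l → 2 * (q * l) ≡ q * (2 * l)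
      shuffle₂ = solve-∀

    module _ (x y : Vec Bool n)
      (close : ∀ j → ∣ dot (B j) (combine a x) ℤ.- dot (B j) (combine a y) ∣ ≤ 2 * ρ)
      (same : patternOf x ≡ patternOf y) where

      defect≡ : ∀ j → defect x j ≡ defect y j
      defect≡ j = trans (sym (lookup∘tabulate (defect x) j))
        (trans (cong (λ v → lookup v j) same) (lookup∘tabulate (defect y) j))

      -- The parts before j coincide and cancel, and the diagonal terms differ by 2 · 4ρ. Only the
      -- tolerance 2ρ and the two parts after j can make up for this.
      gap : ∀ j → (∀ i → i Fin.< j → lookup x i ≡ lookup y i) → lookup x j ≢ lookup y j →
        8 * ρ ≤ 2 * ρ + (∣ after j (M j) x ∣ + ∣ after j (M j) y ∣)
      gap j x≡y x≢y = begin
        8 * ρ                                  ≡⟨ double ρ ⟩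
        4 * ρ + 4 * ρ                          ≡⟨ sym (signed-gap (4 * ρ) x≢y) ⟩
        ∣ signed (lookup x j) (+ (4 * ρ)) ℤ.- signed (lookup y j) (+ (4 * ρ)) ∣
          ≡⟨ cong ∣_∣ (identity (before j (M j) x) (signed (lookup x j) (+ (4 * ρ))) (signed (lookup y j) (+ (4 * ρ))) A A′) ⟩
        ∣ (P ℤ.- P′) ℤ.- (A ℤ.- A′) ∣
          ≤⟨ ℤ.∣i-j∣≤∣i∣+∣j∣ (P ℤ.- P′) (A ℤ.- A′) ⟩
        ∣ P ℤ.- P′ ∣ + ∣ A ℤ.- A′ ∣
          ≡⟨ cong (λ z → ∣ z ∣ + ∣ A ℤ.- A′ ∣) (cong₂ ℤ._-_ (sym (row x refl)) (sym (row y (before-cong j (M j) x y x≡y)))) ⟩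
        ∣ dot (B j) (combine a x) ℤ.- dot (B j) (combine a y) ∣ + ∣ A ℤ.- A′ ∣
          ≤⟨ +-mono-≤ (close j) (ℤ.∣i-j∣≤∣i∣+∣j∣ A A′) ⟩
        2 * ρ + (∣ A ∣ + ∣ A′ ∣)               ∎
        where
        open ≤-Reasoning
        A  = after j (M j) x
        A′ = after j (M j) y
        P  = before j (M j) x ℤ.+ signed (lookup x j) (+ (4 * ρ)) ℤ.+ A
        P′ = before j (M j) x ℤ.+ signed (lookup y j) (+ (4 * ρ)) ℤ.+ A′
        double : ∀ ρ → 8 * ρ ≡ 4 * ρ + 4 * ρ
        double = solve-∀
        identity : ∀ b s t a c → s ℤ.- t ≡ (b ℤ.+ s ℤ.+ a ℤ.- (b ℤ.+ t ℤ.+ c)) ℤ.- (a ℤ.- c)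
        identity = ℤ-Solver.solve-∀
        row : ∀ z → before j (M j) x ≡ before j (M j) z →
          dot (B j) (combine a z) ≡ before j (M j) x ℤ.+ signed (lookup z j) (+ (4 * ρ)) ℤ.+ after j (M j) z
        row z eq = trans (dot-combine (B j) a z) (trans (pair-split j (M j) z)
          (cong₂ (λ b d → b ℤ.+ signed (lookup z j) d ℤ.+ after j (M j) z) (sym eq) (diagonal j)))

      decode-step : ∀ j → (∀ i → i Fin.< j → lookup x i ≡ lookup y i) → lookup x j ≡ lookup y j
      decode-step j x≡y with lookup x j Data.Bool.≟ lookup y j
      ... | yes eq = eq
      ... | no x≢y with 2 * ρ ≤? ∣ after j (M j) x ∣ | 2 * ρ ≤? ∣ after j (M j) y ∣ | defect≡ j
      -- Equal patterns exclude the mixed cases. In a row exceptional for both vectors the recorded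
      -- signs are compared directly.
      ...   | yes _ | yes _ | eq = just-injective eq
      ...   | no s  | no t  | _  = contradiction (gap j x≡y x≢y) (<⇒≱ (begin-strict
        2 * ρ + (∣ after j (M j) x ∣ + ∣ after j (M j) y ∣)  <⟨ +-monoʳ-< (2 * ρ) (+-mono-< (≰⇒> s) (≰⇒> t)) ⟩
        2 * ρ + (2 * ρ + 2 * ρ)                              ≡⟨ six ρ ⟩
        6 * ρ                                                ≤⟨ *-monoˡ-≤ ρ (m≤m+n 6 2) ⟩
        8 * ρ                                                ∎))
        where
        open ≤-Reasoning
        six : ∀ ρ → 2 * ρ + (2 * ρ + 2 * ρ) ≡ 6 * ρ
        six = solve-∀

      decode : x ≡ y
      decode = trans (sym (tabulate∘lookup x)) (trans (tabulate-cong (λ j → go j (Fin.<-wellFounded j))) (tabulate∘lookup y))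
        where
        go : ∀ j → Acc Fin._<_ j → lookup x j ≡ lookup y j
        go j (acc rs) = decode-step j (λ i i<j → go i (rs i<j))

    ∣X∣≤ : length X ≤ (32 * n) ^ r * length (patterns n p)
    -- n entries of size at most 8ρ give R = 8nρ, and s = 32n is ample for 2(R + ρ) = 16nρ + 2ρ ≤
    -- sρ.
    ∣X∣≤ = packing (32 * n) (8 * p * (8 * ρ)) ρ B (patterns n p) (combine a) patternOf
      (≤-trans (m≤m+n 4 28) (m≤m*n 32 n))
      (begin
        2 * (n * (8 * ρ) + ρ)           ≡⟨ shuffle₁ n ρ ⟩
        16 * n * ρ + 2 * ρ              ≤⟨ +-monoʳ-≤ (16 * n * ρ) (*-monoˡ-≤ ρ (≤-trans (m≤m+n 2 14) (m≤m*n 16 n))) ⟩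
        16 * n * ρ + 16 * n * ρ         ≡⟨ shuffle₂ n ρ ⟩
        32 * n * ρ                      ∎)
      (Unique.filter⁺ _ (cube-unique n))
      (λ {x} x∈ → ∈-patterns⁺ p (patternOf x) (proj₂ (∈-filter⁻ (λ x → marks (patternOf x) ≤? p) {xs = cube n} x∈)))
      (λ {x} _ j → ≤-trans (≤-reflexive (cong ∣_∣ (dot-combine (B j) a x))) (∣pair∣≤ (M j) x (8 * ρ) (dominant j)))
      (λ {x} {y} _ _ → decode x y)
      where
      open ≤-Reasoning
      shuffle₁ : ∀ n ρ → 2 * (n * (8 * ρ) + ρ) ≡ 16 * n * ρ + 2 * ρ
      shuffle₁ = solve-∀
      shuffle₂ : ∀ n ρ → 16 * n * ρ + 16 * n * ρ ≡ 32 * n * ρ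
      shuffle₂ = solve-∀

    -- The weight 6 of an unmarked position makes 2 ^ 18 ≤ 6 ^ 7 the decisive inequality.
    rankBound : 2 ^ (2 * p) ≤ 2 * (32 * n) ^ r
    rankBound = *-cancelʳ-≤ _ _ (2 ^ (24 * p) * 6 ^ p) {{m*n≢0 (2 ^ (24 * p)) (6 ^ p) {{m^n≢0 2 (24 * p)}} {{m^n≢0 6 p}}}} (begin
      2 ^ (2 * p) * (2 ^ (24 * p) * 6 ^ p)         ≡⟨ cong (λ e → 2 ^ (2 * p) * (e * 6 ^ p)) (trans (cong (2 ^_) (twenty-four p)) (^-distribˡ-+-* 2 (6 * p) (18 * p))) ⟩
      2 ^ (2 * p) * (2 ^ (6 * p) * 2 ^ (18 * p) * 6 ^ p)
        ≡⟨ regroup (2 ^ (2 * p)) (2 ^ (6 * p)) (2 ^ (18 * p)) (6 ^ p) ⟩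
      2 ^ (2 * p) * 2 ^ (6 * p) * (2 ^ (18 * p) * 6 ^ p)
        ≡⟨ cong (_* (2 ^ (18 * p) * 6 ^ p)) (trans (sym (^-distribˡ-+-* 2 (2 * p) (6 * p))) (cong (2 ^_) (eight p))) ⟩
      2 ^ n * (2 ^ (18 * p) * 6 ^ p)               ≤⟨ *-mono-≤ 2ⁿ≤2∣X∣ (*-monoˡ-≤ (6 ^ p) 2¹⁸ᵖ≤6⁷ᵖ) ⟩
      2 * length X * (6 ^ (7 * p) * 6 ^ p)         ≡⟨ cong (2 * length X *_) (trans (sym (^-distribˡ-+-* 6 (7 * p) p)) (cong (6 ^_) (eight′ p))) ⟩
      2 * length X * 6 ^ n                         ≤⟨ *-monoˡ-≤ (6 ^ n) (*-monoʳ-≤ 2 ∣X∣≤) ⟩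
      2 * ((32 * n) ^ r * length (patterns n p)) * 6 ^ n
        ≡⟨ assoc ((32 * n) ^ r) (length (patterns n p)) (6 ^ n) ⟩
      2 * (32 * n) ^ r * (length (patterns n p) * 6 ^ n)
        ≤⟨ *-monoʳ-≤ (2 * (32 * n) ^ r) (length-patterns n p) ⟩
      2 * (32 * n) ^ r * (8 ^ n * 6 ^ p)           ≡⟨ cong (λ e → 2 * (32 * n) ^ r * (e * 6 ^ p)) (trans (^-*-assoc 2 3 n) (cong (2 ^_) (three p))) ⟩
      2 * (32 * n) ^ r * (2 ^ (24 * p) * 6 ^ p)    ∎)
      where
      open ≤-Reasoning
      2¹⁸ᵖ≤6⁷ᵖ : 2 ^ (18 * p) ≤ 6 ^ (7 * p)
      2¹⁸ᵖ≤6⁷ᵖ = subst₂ _≤_ (^-*-assoc 2 18 p) (^-*-assoc 6 7 p) (^-monoˡ-≤ p (≤ᵇ⇒≤ (2 ^ 18) (6 ^ 7) _))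
      twenty-four : ∀ p → 24 * p ≡ 6 * p + 18 * p
      twenty-four = solve-∀
      eight : ∀ p → 2 * p + 6 * p ≡ 8 * p
      eight = solve-∀
      eight′ : ∀ p → 7 * p + p ≡ 8 * p
      eight′ = solve-∀
      three : ∀ p → 3 * (8 * p) ≡ 24 * p
      three = solve-∀
      regroup : ∀ a b c d → a * (b * c * d) ≡ a * b * (c * d)
      regroup = solve-∀
      assoc : ∀ s l x → 2 * (s * l) * x ≡ 2 * s * (l * x)
      assoc = solve-∀

-- From a rational factorization to an integral one with constant diagonal.

module ClearingDenominators where

  open Lattice using (dot; scale; dot-scale)
  open SignVectors using (module Decoding)
  open import Data.Fin as Fin using (Fin; zero; suc)
  open import Data.Integer as ℤ using (ℤ; +_; -[1+_])
  import Data.Integer.Properties as ℤ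
  import Data.Integer.Tactic.RingSolver as ℤ-Solver
  open import Data.Nat as ℕ using (ℕ; zero; suc; s≤s; z≤n)
  import Data.Nat.Properties as ℕ
  import Data.Nat.Tactic.RingSolver as ℕ-Solver
  open import Data.Product using (∃; _×_; _,_; proj₁; proj₂)
  open import Data.Rational as ℚ using (ℚ; mkℚ; 0ℚ; _+_; _*_; _≤_; _<_; ∣_∣; _/_; *≤*; *<*; ↧ₙ_)
  open import Data.Rational.Literals using (fromℤ)
  open import Data.Rational.Properties as ℚ using (toℚᵘ-injective; toℚᵘ-homo-*; ↥p/↧p≡p)
  open import Algebra.Definitions.RawSemiring ℚ.+-*-rawSemiring using (sum)
  open import Data.Rational.Solver using (module +-*-Solver)
  import Data.Rational.Unnormalised as ℚᵘ
  import Data.Rational.Unnormalised.Properties as ℚᵘ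
  open import Data.Vec using (Vec; tabulate)
  open import Function using (_∘_)
  open import Relation.Binary.PropositionalEquality

  fromℤ-+ : ∀ a b → fromℤ (a ℤ.+ b) ≡ fromℤ a + fromℤ b
  fromℤ-+ a b = trans (sym (↥p/↧p≡p (fromℤ (a ℤ.+ b))))
    (cong (_/ 1) (sym (cong₂ ℤ._+_ (ℤ.*-identityʳ a) (ℤ.*-identityʳ b))))

  fromℤ-* : ∀ a b → fromℤ (a ℤ.* b) ≡ fromℤ a * fromℤ b
  fromℤ-* a b = sym (↥p/↧p≡p (fromℤ (a ℤ.* b)))

  fromℤ-mono-≤ : ∀ {a b} → a ℤ.≤ b → fromℤ a ≤ fromℤ b
  fromℤ-mono-≤ {a} {b} a≤b = *≤* (subst₂ ℤ._≤_ (sym (ℤ.*-identityʳ a)) (sym (ℤ.*-identityʳ b)) a≤b)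

  fromℤ-cancel-≤ : ∀ {a b} → fromℤ a ≤ fromℤ b → a ℤ.≤ b
  fromℤ-cancel-≤ {a} {b} (*≤* a≤b) = subst₂ ℤ._≤_ (ℤ.*-identityʳ a) (ℤ.*-identityʳ b) a≤b

  fromℤ-mono-< : ∀ {a b} → a ℤ.< b → fromℤ a < fromℤ b
  fromℤ-mono-< {a} {b} a<b = *<* (subst₂ ℤ._<_ (sym (ℤ.*-identityʳ a)) (sym (ℤ.*-identityʳ b)) a<b)

  fromℤ-cancel-< : ∀ {a b} → fromℤ a < fromℤ b → a ℤ.< b
  fromℤ-cancel-< {a} {b} (*<* a<b) = subst₂ ℤ._<_ (ℤ.*-identityʳ a) (ℤ.*-identityʳ b) a<b


  -- Abstract in the property so that one induction serves both for denominators in two nested index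
  -- families and for multiples of the diagonal entries.
  commonMultiple : ∀ {n} (P : Fin n → ℕ → Set) →
    (∀ i F G → 0 ℕ.< G → P i F → P i (G ℕ.* F)) →
    (∀ i → ∃ λ F → 0 ℕ.< F × P i F) → ∃ λ F → 0 ℕ.< F × ∀ i → P i F
  commonMultiple {zero}  P mult each = 1 , s≤s z≤n , λ ()
  commonMultiple {suc n} P mult each =
    let F , 0<F , PF = each zero
        G , 0<G , PG = commonMultiple (P ∘ suc) (mult ∘ suc) (each ∘ suc)
    in G ℕ.* F , ℕ.*-mono-< 0<G 0<F , λ
      { zero    → mult zero F G 0<G PF
      ; (suc i) → subst (P (suc i)) (ℕ.*-comm F G) (mult (suc i) G F 0<F (PG i)) }

  Cleared : ℚ → ℕ → Set
  Cleared q F = ∃ λ z → fromℤ (+ F) * q ≡ fromℤ z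

  cleared-* : ∀ q F G → Cleared q F → Cleared q (G ℕ.* F)
  cleared-* q F G (z , eq) = + G ℤ.* z , (begin
    fromℤ (+ (G ℕ.* F)) * q                ≡⟨ cong (λ x → fromℤ x * q) (ℤ.pos-* G F) ⟩
    fromℤ (+ G ℤ.* + F) * q                ≡⟨ cong (_* q) (fromℤ-* (+ G) (+ F)) ⟩
    fromℤ (+ G) * fromℤ (+ F) * q          ≡⟨ ℚ.*-assoc (fromℤ (+ G)) (fromℤ (+ F)) q ⟩
    fromℤ (+ G) * (fromℤ (+ F) * q)        ≡⟨ cong (fromℤ (+ G) *_) eq ⟩
    fromℤ (+ G) * fromℤ z                  ≡⟨ sym (fromℤ-* (+ G) z) ⟩
    fromℤ (+ G ℤ.* z)                      ∎)
    where open ≡-Reasoning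

  cleared-↧ : ∀ q → Cleared q (↧ₙ q)
  cleared-↧ q@(mkℚ z d _) = z , toℚᵘ-injective (ℚᵘ.≃-trans (toℚᵘ-homo-* (fromℤ (+ suc d)) q)
    (ℚᵘ.*≡* (shuffle (+ suc d) z)))
    where
    shuffle : ∀ d z → d ℤ.* z ℤ.* (+ 1) ≡ z ℤ.* (+ 1 ℤ.* d)
    shuffle = ℤ-Solver.solve-∀

  clear : ∀ {m n} (f : Fin m → Fin n → ℚ) → ∃ λ F → 0 ℕ.< F × ∀ i j → Cleared (f i j) F
  clear f = commonMultiple (λ i F → ∀ j → Cleared (f i j) F)
    (λ i F G _ cl j → cleared-* (f i j) F G (cl j))
    (λ i → commonMultiple (λ j → Cleared (f i j)) (λ j F G _ → cleared-* (f i j) F G)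
      (λ j → ↧ₙ f i j , s≤s z≤n , cleared-↧ (f i j)))

  absMultiple : ∀ z → ∃ λ s → s ℤ.* z ≡ + ℤ.∣ z ∣
  absMultiple (+ n)    = ℤ.1ℤ , ℤ.*-identityˡ (+ n)
  absMultiple -[1+ n ] = ℤ.-1ℤ , ℤ.-1*i≡-i -[1+ n ]

  dot-tabulate : ∀ {r} (f g : Fin r → ℚ) (F G : ℚ) (β γ : Fin r → ℤ) →
    (∀ k → F * f k ≡ fromℤ (β k)) → (∀ k → G * g k ≡ fromℤ (γ k)) →
    fromℤ (dot (tabulate β) (tabulate γ)) ≡ F * G * sum (λ k → g k * f k)
  dot-tabulate {zero}  f g F G β γ _ _ = sym (ℚ.*-zeroʳ (F * G))
  dot-tabulate {suc r} f g F G β γ Ff Gg = begin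
    fromℤ (β zero ℤ.* γ zero ℤ.+ dot (tabulate (β ∘ suc)) (tabulate (γ ∘ suc)))
      ≡⟨ fromℤ-+ (β zero ℤ.* γ zero) _ ⟩
    fromℤ (β zero ℤ.* γ zero) + fromℤ (dot (tabulate (β ∘ suc)) (tabulate (γ ∘ suc)))
      ≡⟨ cong₂ _+_ (trans (fromℤ-* (β zero) (γ zero)) (cong₂ _*_ (sym (Ff zero)) (sym (Gg zero))))
          (dot-tabulate (f ∘ suc) (g ∘ suc) F G (β ∘ suc) (γ ∘ suc) (Ff ∘ suc) (Gg ∘ suc)) ⟩
    F * f zero * (G * g zero) + F * G * S
      ≡⟨ solve 5 (λ F G a b S → F :* a :* (G :* b) :+ F :* G :* S := F :* G :* (b :* a :+ S)) refl F G (f zero) (g zero) S ⟩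
    F * G * (g zero * f zero + S)             ∎
    where
    open ≡-Reasoning
    open +-*-Solver
    S = sum (λ k → g (suc k) * f (suc k))

  module _ {p r : ℕ} (Q : ℕ) (b : Fin r → Fin (8 ℕ.* p) → ℚ) (c : Fin (8 ℕ.* p) → Fin r → ℚ) where

    entry : Fin (8 ℕ.* p) → Fin (8 ℕ.* p) → ℚ
    entry j i = sum (λ k → c i k * b k j)

    -- Denominators are cleared in the two factors and not in the product, which keeps the inner
    -- dimension r. All entries are thereby multiplied by the same `s`, and afterwards each column
    -- by its own factor, so ratios to the diagonal entry of the column are preserved.
    rankBoundℚ : 0 ℕ.< p →
      (∀ i → 0ℚ < ∣ entry i i ∣) →
      (∀ j i → ∣ entry j i ∣ ≤ fromℤ (+ 2) * ∣ entry i i ∣) →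
      (∀ j i → j Fin.< i → fromℤ (+ Q) * ∣ entry j i ∣ ≤ ∣ entry i i ∣) →
      64 ℕ.* (8 ℕ.* p) ℕ.≤ Q ℕ.* Q →
      2 ℕ.^ (2 ℕ.* p) ℕ.≤ 2 ℕ.* (32 ℕ.* (8 ℕ.* p)) ℕ.^ r
    rankBoundℚ 0<p nonzero dominant lower 64n≤Q² =
      Decoding.rankBound Q ρ B a 0<p 0<ρ diagonal dominant′ lower′ 64n≤Q²
      where
      open ℕ.≤-Reasoning
      clear-b = clear b
      clear-c = clear c
      F = proj₁ clear-b
      G = proj₁ clear-c
      s = fromℤ (+ F) * fromℤ (+ G)

      instance
        s-pos : ℚ.Positive s
        s-pos = ℚ.pos*pos⇒pos (fromℤ (+ F)) {{ℚ.positive (fromℤ-mono-< (ℤ.+<+ (proj₁ (proj₂ clear-b))))}}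
          (fromℤ (+ G)) {{ℚ.positive (fromℤ-mono-< (ℤ.+<+ (proj₁ (proj₂ clear-c))))}}
        s-nonNeg : ℚ.NonNegative s
        s-nonNeg = ℚ.pos⇒nonNeg s

      B γ : Fin (8 ℕ.* p) → Vec ℤ r
      B j = tabulate (λ k → proj₁ (proj₂ (proj₂ clear-b) k j))
      γ i = tabulate (λ k → proj₁ (proj₂ (proj₂ clear-c) i k))

      N : Fin (8 ℕ.* p) → Fin (8 ℕ.* p) → ℤ
      N j i = dot (B j) (γ i)

      ∣N∣ : ∀ j i → fromℤ (+ ℤ.∣ N j i ∣) ≡ s * ∣ entry j i ∣
      ∣N∣ j i = trans (cong ∣_∣ (dot-tabulate (λ k → b k j) (c i) (fromℤ (+ F)) (fromℤ (+ G)) _ _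
          (λ k → proj₂ (proj₂ (proj₂ clear-b) k j)) (λ k → proj₂ (proj₂ (proj₂ clear-c) i k))))
        (trans (ℚ.∣p*q∣≡∣p∣*∣q∣ s (entry j i)) (cong (_* ∣ entry j i ∣) (ℚ.0≤p⇒∣p∣≡p (ℚ.nonNegative⁻¹ s))))

      N≢0 : ∀ i → 0 ℕ.< ℤ.∣ N i i ∣
      N≢0 i = ℤ.drop‿+<+ (fromℤ-cancel-< (subst (0ℚ <_) (sym (∣N∣ i i))
        (ℚ.positive⁻¹ _ {{ℚ.pos*pos⇒pos s (∣ entry i i ∣) {{ℚ.positive (nonzero i)}}}})))

      N-scaled : ∀ q₁ q₂ j i → fromℤ (+ q₁) * ∣ entry j i ∣ ≤ fromℤ (+ q₂) * ∣ entry i i ∣ →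
        q₁ ℕ.* ℤ.∣ N j i ∣ ℕ.≤ q₂ ℕ.* ℤ.∣ N i i ∣
      N-scaled q₁ q₂ j i le = ℤ.drop‿+≤+ (fromℤ-cancel-≤ (subst₂ _≤_ (scaled q₁ j i) (scaled q₂ i i)
        (ℚ.*-monoˡ-≤-nonNeg s le)))
        where
        scaled : ∀ q j i → s * (fromℤ (+ q) * ∣ entry j i ∣) ≡ fromℤ (+ (q ℕ.* ℤ.∣ N j i ∣))
        scaled q j i = sym (trans (cong fromℤ (ℤ.pos-* q ℤ.∣ N j i ∣)) (trans (fromℤ-* (+ q) (+ ℤ.∣ N j i ∣))
          (trans (cong (fromℤ (+ q) *_) (∣N∣ j i))
            (solve 3 (λ q s e → q :* (s :* e) := s :* (q :* e)) refl (fromℤ (+ q)) s ∣ entry j i ∣))))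
          where open +-*-Solver

      Multiple : Fin (8 ℕ.* p) → ℕ → Set
      Multiple i ρ = ∃ λ l → l ℤ.* N i i ≡ + ρ

      multiples : ∃ λ ρ → 0 ℕ.< ρ × ∀ i → Multiple i ρ
      multiples = commonMultiple Multiple
        (λ { i F G _ (l , eq) → + G ℤ.* l , trans (ℤ.*-assoc (+ G) l (N i i)) (trans (cong (ℤ._*_ (+ G)) eq) (sym (ℤ.pos-* G F))) })
        (λ i → ℤ.∣ N i i ∣ , N≢0 i , absMultiple (N i i))

      ρ = proj₁ multiples
      0<ρ = proj₁ (proj₂ multiples)

      -- The multiplier may be negative: it also makes the diagonal entry positive. The extra factor
      -- 4 leaves the integers ρ and 2ρ as tolerances below the diagonal value 4ρ.
      l : Fin (8 ℕ.* p) → ℤ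
      l i = + 4 ℤ.* proj₁ (proj₂ (proj₂ multiples) i)

      a : Fin (8 ℕ.* p) → Vec ℤ r
      a i = scale (l i) (γ i)

      diagonal : ∀ i → dot (B i) (a i) ≡ + (4 ℕ.* ρ)
      diagonal i = trans (dot-scale (B i) (l i) (γ i)) (trans (ℤ.*-assoc (+ 4) (proj₁ (proj₂ (proj₂ multiples) i)) (N i i))
        (trans (cong (ℤ._*_ (+ 4)) (proj₂ (proj₂ (proj₂ multiples) i))) (sym (ℤ.pos-* 4 ρ))))

      ∣a∣ : ∀ j i → ℤ.∣ dot (B j) (a i) ∣ ≡ ℤ.∣ l i ∣ ℕ.* ℤ.∣ N j i ∣
      ∣a∣ j i = trans (cong ℤ.∣_∣ (dot-scale (B j) (l i) (γ i))) (ℤ.abs-* (l i) (N j i))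

      scaled-≤ : ∀ q₁ q₂ j i → q₁ ℕ.* ℤ.∣ N j i ∣ ℕ.≤ q₂ ℕ.* ℤ.∣ N i i ∣ →
        q₁ ℕ.* ℤ.∣ dot (B j) (a i) ∣ ℕ.≤ q₂ ℕ.* (4 ℕ.* ρ)
      scaled-≤ q₁ q₂ j i le = begin
        q₁ ℕ.* ℤ.∣ dot (B j) (a i) ∣              ≡⟨ cong (q₁ ℕ.*_) (∣a∣ j i) ⟩
        q₁ ℕ.* (ℤ.∣ l i ∣ ℕ.* ℤ.∣ N j i ∣)        ≡⟨ swap q₁ ℤ.∣ l i ∣ ℤ.∣ N j i ∣ ⟩
        ℤ.∣ l i ∣ ℕ.* (q₁ ℕ.* ℤ.∣ N j i ∣)        ≤⟨ ℕ.*-monoʳ-≤ ℤ.∣ l i ∣ le ⟩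
        ℤ.∣ l i ∣ ℕ.* (q₂ ℕ.* ℤ.∣ N i i ∣)        ≡⟨ swap ℤ.∣ l i ∣ q₂ ℤ.∣ N i i ∣ ⟩
        q₂ ℕ.* (ℤ.∣ l i ∣ ℕ.* ℤ.∣ N i i ∣)        ≡⟨ cong (q₂ ℕ.*_) (trans (sym (∣a∣ i i)) (cong ℤ.∣_∣ (diagonal i))) ⟩
        q₂ ℕ.* (4 ℕ.* ρ)                          ∎
        where
        swap : ∀ a b c → a ℕ.* (b ℕ.* c) ≡ b ℕ.* (a ℕ.* c)
        swap = ℕ-Solver.solve-∀

      dominant′ : ∀ j i → ℤ.∣ dot (B j) (a i) ∣ ℕ.≤ 8 ℕ.* ρ
      dominant′ j i = begin
        ℤ.∣ dot (B j) (a i) ∣             ≡⟨ sym (ℕ.*-identityˡ _) ⟩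
        1 ℕ.* ℤ.∣ dot (B j) (a i) ∣       ≤⟨ scaled-≤ 1 2 j i (N-scaled 1 2 j i (subst (_≤ _) (sym (ℚ.*-identityˡ _)) (dominant j i))) ⟩
        2 ℕ.* (4 ℕ.* ρ)                   ≡⟨ sym (ℕ.*-assoc 2 4 ρ) ⟩
        8 ℕ.* ρ                           ∎

      lower′ : ∀ j i → j Fin.< i → Q ℕ.* ℤ.∣ dot (B j) (a i) ∣ ℕ.≤ 4 ℕ.* ρ
      lower′ j i j<i = begin
        Q ℕ.* ℤ.∣ dot (B j) (a i) ∣       ≤⟨ scaled-≤ Q 1 j i (N-scaled Q 1 j i (subst (fromℤ (+ Q) * ∣ entry j i ∣ ≤_) (sym (ℚ.*-identityˡ _)) (lower j i j<i))) ⟩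
        1 ℕ.* (4 ℕ.* ρ)                   ≡⟨ ℕ.*-identityˡ (4 ℕ.* ρ) ⟩
        4 ℕ.* ρ                           ∎

-- Powers of rationals and a lower bound for logarithms.

module RationalPowers where

  open ClearingDenominators using (fromℤ-+; fromℤ-*; fromℤ-mono-≤)
  open import Data.Bool using (T; not; true)
  open import Data.Empty using (⊥; ⊥-elim)
  open import Data.Integer as ℤ using (ℤ; +_)
  import Data.Integer.Properties as ℤ
  open import Data.Nat as ℕ using (ℕ; zero; suc; z≤n)
  import Data.Nat.Properties as ℕ
  open import Data.Product using (∃; _,_)
  open import Data.Rational
  open import Data.Rational.Literals using (fromℤ)
  open import Data.Rational.Properties
  open import Algebra.Definitions.RawSemiring +-*-rawSemiring using (_^_)
  open import Algebra.Bundles using (CommutativeRing)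
  open import Algebra.Properties.Semiring.Exp (CommutativeRing.semiring +-*-commutativeRing) using (^-assocʳ)
  open import Data.Rational.Solver using (module +-*-Solver)
  open import Data.Sum using (inj₁; inj₂)
  import Data.Integer.Tactic.RingSolver as ℤ-Solver
  import Data.Rational.Unnormalised as ℚᵘ
  import Data.Rational.Unnormalised.Properties as ℚᵘ
  open import Relation.Binary.PropositionalEquality
  open import Relation.Nullary using (yes; no)

  fromℕ : ℕ → ℚ
  fromℕ n = fromℤ (+ n)

  0≤fromℕ : ∀ n → 0ℚ ≤ fromℕ n
  0≤fromℕ n = fromℤ-mono-≤ (ℤ.+≤+ z≤n)

  fromℕ-+ : ∀ m n → fromℕ (m ℕ.+ n) ≡ fromℕ m + fromℕ n
  fromℕ-+ m n = trans (cong fromℤ (ℤ.pos-+ m n)) (fromℤ-+ (+ m) (+ n))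

  fromℕ-* : ∀ m n → fromℕ (m ℕ.* n) ≡ fromℕ m * fromℕ n
  fromℕ-* m n = trans (cong fromℤ (ℤ.pos-* m n)) (fromℤ-* (+ m) (+ n))

  fromℕ-mono-≤ : ∀ {m n} → m ℕ.≤ n → fromℕ m ≤ fromℕ n
  fromℕ-mono-≤ m≤n = fromℤ-mono-≤ (ℤ.+≤+ m≤n)

  fromℕ-suc : ∀ n → fromℕ (suc n) ≡ 1ℚ + fromℕ n
  fromℕ-suc n = fromℕ-+ 1 n

  -- Linear inequalities are proved by exhibiting q - p as a combination of
  -- nonnegative terms.

  p≤q⇒0≤q-p : ∀ {p q} → p ≤ q → 0ℚ ≤ q - p
  p≤q⇒0≤q-p {p} {q} p≤q = subst (_≤ q - p) (+-inverseʳ p) (+-monoˡ-≤ (- p) p≤q)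

  infixl 6 _⊕_
  infixr 7 _⊗_

  _⊕_ : ∀ {p q} → 0ℚ ≤ p → 0ℚ ≤ q → 0ℚ ≤ p + q
  _⊕_ = +-mono-≤

  _⊗_ : ∀ {p q} → 0ℚ ≤ p → 0ℚ ≤ q → 0ℚ ≤ p * q
  _⊗_ {p} {q} 0≤p 0≤q = nonNegative⁻¹ (p * q)
    {{nonNeg*nonNeg⇒nonNeg p {{nonNegative 0≤p}} q {{nonNegative 0≤q}}}}

  by-difference : ∀ {p q s} → 0ℚ ≤ s → q ≡ p + s → p ≤ q
  by-difference {p} {q} {s} 0≤s eq = subst₂ _≤_ (+-identityʳ p) (sym eq) (+-monoʳ-≤ p 0≤s)

  0≤½ : 0ℚ ≤ ½
  0≤½ = ≤ᵇ⇒≤ _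

  0≤1 : 0ℚ ≤ 1ℚ
  0≤1 = ≤ᵇ⇒≤ _

  *-mono-≤ : ∀ {p q r s} → 0ℚ ≤ p → 0ℚ ≤ r → p ≤ q → r ≤ s → p * r ≤ q * s
  *-mono-≤ {p} {q} {r} {s} 0≤p 0≤r p≤q r≤s = ≤-trans
    (*-monoʳ-≤-nonNeg r {{nonNegative 0≤r}} p≤q)
    (*-monoˡ-≤-nonNeg q {{nonNegative (≤-trans 0≤p p≤q)}} r≤s)

  0≤^ : ∀ {p} n → 0ℚ ≤ p → 0ℚ ≤ p ^ n
  0≤^ zero    0≤p = 0≤1
  0≤^ (suc n) 0≤p = 0≤p ⊗ 0≤^ n 0≤p

  ^-mono-≤ : ∀ {p q} n → 0ℚ ≤ p → p ≤ q → p ^ n ≤ q ^ n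
  ^-mono-≤ zero    0≤p p≤q = ≤-refl
  ^-mono-≤ (suc n) 0≤p p≤q = *-mono-≤ 0≤p (0≤^ n 0≤p) p≤q (^-mono-≤ n 0≤p p≤q)

  fromℕ-^ : ∀ m n → fromℕ (m ℕ.^ n) ≡ fromℕ m ^ n
  fromℕ-^ m zero    = refl
  fromℕ-^ m (suc n) = trans (fromℕ-* m (m ℕ.^ n)) (cong (fromℕ m *_) (fromℕ-^ m n))

  -- This is the upper estimate (1 + u)^n ≤ 1 / (1 - nu) without the division. It holds because (1 +
  -- u)(1 - (n + 1)u) = 1 - nu - (n + 1)u².
  bernoulli : ∀ u n → 0ℚ ≤ u → (1ℚ + u) ^ n * (1ℚ - fromℕ n * u) ≤ 1ℚ
  bernoulli u zero    0≤u = ≤-reflexive (trans (*-identityˡ _) (solve 1 (λ u → con 1ℚ :- con 0ℚ :* u := con 1ℚ) refl u))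
    where open +-*-Solver
  bernoulli u (suc n) 0≤u = ≤-trans (by-difference
      (0≤^ n (0≤1 ⊕ 0≤u) ⊗ (0≤fromℕ (suc n) ⊗ (0≤u ⊗ 0≤u)))
      (trans (solve 3 (λ P u n → P :* (con 1ℚ :- n :* u) :=
          (con 1ℚ :+ u) :* P :* (con 1ℚ :- (con 1ℚ :+ n) :* u) :+ P :* ((con 1ℚ :+ n) :* (u :* u)))
          refl ((1ℚ + u) ^ n) u (fromℕ n))
        (cong (λ m → (1ℚ + u) * (1ℚ + u) ^ n * (1ℚ - m * u) + (1ℚ + u) ^ n * (m * (u * u))) (sym (fromℕ-suc n)))))
    (bernoulli u n 0≤u)
    where open +-*-Solver

  ⁴⁄₃ : ℚ
  ⁴⁄₃ = + 4 / 3

  ¼ : ℚ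
  ¼ = + 1 / 4

  [1+¼/n]^n≤⁴⁄₃ : ∀ u n → 0ℚ ≤ u → fromℕ n * u ≡ ¼ → (1ℚ + u) ^ n ≤ ⁴⁄₃
  [1+¼/n]^n≤⁴⁄₃ u n 0≤u nu≡¼ = by-difference (≤ᵇ⇒≤ {0ℚ} {⁴⁄₃} _ ⊗ p≤q⇒0≤q-p (bernoulli u n 0≤u))
    (trans (solve 1 (λ P → con ⁴⁄₃ := P :+ con ⁴⁄₃ :* (con 1ℚ :- P :* (con 1ℚ :- con ¼))) refl ((1ℚ + u) ^ n))
      (cong (λ x → (1ℚ + u) ^ n + ⁴⁄₃ * (1ℚ - (1ℚ + u) ^ n * (1ℚ - x))) (sym nu≡¼)))
    where open +-*-Solver

  -- The ratio 2/3 is dictated by exponent 1, where equality holds. It leaves a third of the power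
  -- of two, at least 2/3, which exceeds the error 1/2 + 1/16 in `log-lower`.
  3[⁴⁄₃]^n≤2∙2^n : ∀ n → fromℕ 3 * ⁴⁄₃ ^ suc n ≤ fromℕ 2 * fromℕ 2 ^ suc n
  3[⁴⁄₃]^n≤2∙2^n zero    = ≤ᵇ⇒≤ _
  3[⁴⁄₃]^n≤2∙2^n (suc n) = by-difference
    (≤ᵇ⇒≤ {0ℚ} {⁴⁄₃} _ ⊗ p≤q⇒0≤q-p (3[⁴⁄₃]^n≤2∙2^n n) ⊕ (≤ᵇ⇒≤ {0ℚ} {⁴⁄₃} _ ⊗ 0≤^ (suc n) (0≤fromℕ 2)))
    (solve 2 (λ P T → con (fromℕ 2) :* (con (fromℕ 2) :* T) :=
      con (fromℕ 3) :* (con ⁴⁄₃ :* P) :+ (con ⁴⁄₃ :* (con (fromℕ 2) :* T :- con (fromℕ 3) :* P) :+ con ⁴⁄₃ :* T))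
      refl (⁴⁄₃ ^ suc n) (fromℕ 2 ^ suc n))
    where open +-*-Solver

  1≤2^n : ∀ n → 1ℚ ≤ fromℕ 2 ^ n
  1≤2^n zero    = ≤-refl
  1≤2^n (suc n) = *-mono-≤ 0≤1 0≤1 (≤ᵇ⇒≤ {1ℚ} {fromℕ 2} _) (1≤2^n n)

  p≤∣p∣ : ∀ p → p ≤ ∣ p ∣
  p≤∣p∣ p with ≤-total 0ℚ p
  ... | inj₁ 0≤p = ≤-reflexive (sym (0≤p⇒∣p∣≡p 0≤p))
  ... | inj₂ p≤0 = ≤-trans p≤0 (0≤∣p∣ p)

  ∣p-q∣≤d⇒p≤q+d : ∀ p q {d} → ∣ p - q ∣ ≤ d → p ≤ q + d
  ∣p-q∣≤d⇒p≤q+d p q {d} h = by-difference (p≤q⇒0≤q-p (≤-trans (p≤∣p∣ (p - q)) h))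
    (solve 3 (λ p q d → q :+ d := p :+ (d :- (p :- q))) refl p q d)
    where open +-*-Solver

  ∣p-q∣≤d⇒q≤p+d : ∀ p q {d} → ∣ p - q ∣ ≤ d → q ≤ p + d
  ∣p-q∣≤d⇒q≤p+d p q {d} h = ∣p-q∣≤d⇒p≤q+d q p (subst (_≤ d)
    (trans (sym (∣-p∣≡∣p∣ (p - q))) (cong ∣_∣ (solve 2 (λ p q → :- (p :- q) := q :- p) refl p q))) h)
    where open +-*-Solver

  -- Refutation by certificate: nonnegative terms are combined into a sum that simplifies to a
  -- negative constant. The hidden argument has the sign of `c` checked by evaluation.
  absurd-≤ : ∀ {s c} → 0ℚ ≤ s → s ≡ c → {_ : T (not (0ℚ ≤ᵇ c))} → ⊥
  absurd-≤ {s} {c} 0≤s refl {neg} with 0ℚ ≤ᵇ c | ≤⇒≤ᵇ 0≤s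
  ... | true | _ = neg

  1/16 : ℚ
  1/16 = + 1 / 16

  -- If l were below k/4, then (1 + l/(Nk))^(Nk) ≤ (1 + 1/(4N))^(Nk) ≤ (4/3)^k, well below 2^k.
  log-lower : ∀ k N t x l → let K = suc N ℕ.* suc k in
    0ℚ ≤ t → fromℕ K * t ≡ 1ℚ → - fromℕ K ≤ l →
    ∣ (1ℚ + t * l) ^ K - x ∣ ≤ 1/16 → fromℕ 2 ^ suc k - ½ ≤ x →
    fromℕ (suc k) ≤ fromℕ 4 * l
  log-lower k N t x l 0≤t Kt≡1 -K≤l close x≥ with fromℕ (suc k) ≤? fromℕ 4 * l
  ... | yes k≤4l = k≤4l
  ... | no k≰4l = ⊥-elim (absurd-≤ {c = - (+ 5 / 16)}
      (0≤fromℕ 3 ⊗ p≤q⇒0≤q-p x≥ ⊕ 0≤fromℕ 3 ⊗ p≤q⇒0≤q-p (∣p-q∣≤d⇒q≤p+d ((1ℚ + t * l) ^ K) x close) ⊕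
        0≤fromℕ 3 ⊗ p≤q⇒0≤q-p P≤W ⊕ p≤q⇒0≤q-p (3[⁴⁄₃]^n≤2∙2^n k) ⊕ 0≤fromℕ 2 ⊗ p≤q⇒0≤q-p (1≤2^n k))
      (solve 4 (λ x P W T → let three = con (fromℕ 3); two = con (fromℕ 2) in
        three :* (x :- (two :* T :- con ½)) :+ three :* (P :+ con 1/16 :- x) :+ three :* (W :- P) :+
        (two :* (two :* T) :- three :* W) :+ two :* (T :- con 1ℚ) := con (- (+ 5 / 16)))
        refl x ((1ℚ + t * l) ^ K) (⁴⁄₃ ^ suc k) (fromℕ 2 ^ k)))
    where
    open +-*-Solver
    K = suc N ℕ.* suc k
    u = ¼ * fromℕ (suc k) * t
    0≤u : 0ℚ ≤ u
    0≤u = (≤ᵇ⇒≤ {0ℚ} {¼} _ ⊗ 0≤fromℕ (suc k)) ⊗ 0≤t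
    Nu≡¼ : fromℕ (suc N) * u ≡ ¼
    Nu≡¼ = trans (solve 3 (λ N k t → N :* (con ¼ :* k :* t) := con ¼ :* (N :* k :* t)) refl (fromℕ (suc N)) (fromℕ (suc k)) t)
      (trans (cong (λ x → ¼ * (x * t)) (sym (fromℕ-* (suc N) (suc k)))) (trans (cong (¼ *_) Kt≡1) (*-identityʳ ¼)))
    -- Powers are monotone only for a nonnegative base; the lower bound on l provides it.
    0≤1+tl : 0ℚ ≤ 1ℚ + t * l
    0≤1+tl = subst (0ℚ ≤_) (trans (solve 3 (λ t l K → t :* (l :- (:- K)) := K :* t :+ t :* l) refl t l (fromℕ K))
      (cong (_+ t * l) Kt≡1)) (0≤t ⊗ p≤q⇒0≤q-p -K≤l)
    tl≤u : 1ℚ + t * l ≤ 1ℚ + u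
    tl≤u = by-difference (≤ᵇ⇒≤ {0ℚ} {¼} _ ⊗ (0≤t ⊗ p≤q⇒0≤q-p (<⇒≤ (≰⇒> k≰4l))))
      (solve 3 (λ t l k → con 1ℚ :+ con ¼ :* k :* t := con 1ℚ :+ t :* l :+ con ¼ :* (t :* (k :- con (fromℕ 4) :* l)))
        refl t l (fromℕ (suc k)))
    P≤W : (1ℚ + t * l) ^ K ≤ ⁴⁄₃ ^ suc k
    P≤W = ≤-trans (^-mono-≤ K 0≤1+tl tl≤u) (subst (_≤ ⁴⁄₃ ^ suc k) (^-assocʳ (1ℚ + u) (suc N) (suc k))
      (^-mono-≤ (suc k) (0≤^ (suc N) (0≤1 ⊕ 0≤u)) ([1+¼/n]^n≤⁴⁄₃ u (suc N) 0≤u Nu≡¼)))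

  1/n>0 : ∀ n → 0ℚ ≤ + 1 / suc n
  1/n>0 n = nonNegative⁻¹ (+ 1 / suc n) {{normalize-nonNeg 1 (suc n)}}

  n*1/n≡1 : ∀ n → fromℕ (suc n) * (+ 1 / suc n) ≡ 1ℚ
  n*1/n≡1 n = toℚᵘ-injective (ℚᵘ.≃-trans (toℚᵘ-homo-* (fromℕ (suc n)) (+ 1 / suc n))
    (ℚᵘ.≃-trans (ℚᵘ.*-congˡ (toℚᵘ-fromℚᵘ (ℚᵘ.mkℚᵘ (+ 1) n))) (ℚᵘ.*≡* (shuffle (+ suc n)))))
    where
    shuffle : ∀ d → d ℤ.* + 1 ℤ.* + 1 ≡ + 1 ℤ.* (+ 1 ℤ.* d)
    shuffle = ℤ-Solver.solve-∀

  archimedean : ∀ q → ∃ λ n → q ≤ fromℕ n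
  archimedean q@(mkℚ z d _) = ℤ.∣ z ∣ , *≤* (begin
    z ℤ.* + 1                   ≡⟨ ℤ.*-identityʳ z ⟩
    z                           ≤⟨ i≤∣i∣ z ⟩
    + ℤ.∣ z ∣                   ≤⟨ ℤ.+≤+ (ℕ.m≤m*n ℤ.∣ z ∣ (suc d)) ⟩
    + (ℤ.∣ z ∣ ℕ.* suc d)       ≡⟨ ℤ.pos-* ℤ.∣ z ∣ (suc d) ⟩
    + ℤ.∣ z ∣ ℤ.* + suc d       ∎)
    where
    open ℤ.≤-Reasoning
    i≤∣i∣ : ∀ i → i ℤ.≤ + ℤ.∣ i ∣
    i≤∣i∣ (+ n)      = ℤ.≤-refl
    i≤∣i∣ ℤ.-[1+ n ] = ℤ.-≤+

-- Perturbation estimates for samples of the real data.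

module RationalEstimates where

  open ClearingDenominators using (fromℤ-cancel-≤)
  open RationalPowers
  open import Data.Empty using (⊥-elim)
  open import Data.Integer as ℤ using (+_)
  import Data.Integer.Properties as ℤ
  open import Data.Nat as ℕ using (ℕ; zero; suc)
  import Data.Nat.Properties as ℕ
  open import Data.Product using (∃; _×_; _,_)
  open import Data.Rational
  open import Data.Rational.Properties
  open import Algebra.Definitions.RawSemiring +-*-rawSemiring using (_^_)
  open import Data.Rational.Solver using (module +-*-Solver)
  open import Relation.Binary.PropositionalEquality
  open import Relation.Nullary using (yes; no)

  infixl 7 _≥0⊗_

  _≥0⊗_ : ∀ c {p} → .{{NonNegative c}} → 0ℚ ≤ p → 0ℚ ≤ c * p
  c ≥0⊗ 0≤p = nonNegative⁻¹ c ⊗ 0≤p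

  ⅛ ¾ 1/64 : ℚ
  ⅛ = + 1 / 8
  ¾ = + 3 / 4
  1/64 = + 1 / 64

  fromℕ-cancel-≤ : ∀ {m n} → fromℕ m ≤ fromℕ n → m ℕ.≤ n
  fromℕ-cancel-≤ le = ℤ.drop‿+≤+ (fromℤ-cancel-≤ le)

  -- The search descends from an exponent that is surely large enough, and 2 ≤ q settles its last
  -- case. The smallest exponent is 1, so that the resulting lower bound for log q is positive.
  dyadic : ∀ q → fromℕ 2 ≤ q → ∃ λ k → fromℕ 2 ^ suc k ≤ q × q ≤ fromℕ 2 ^ suc (suc k)
  dyadic q 2≤q = let n , q≤n = archimedean q in search n (≤-trans q≤n (n≤2^ n))
    where
    n≤2^ : ∀ n → fromℕ n ≤ fromℕ 2 ^ suc (suc n)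
    n≤2^ n = ≤-trans (fromℕ-mono-≤ (ℕ.≤-trans (ℕ.<⇒≤ (n<2^n n)) (ℕ.^-monoʳ-≤ 2 (ℕ.m≤n+m n 2))))
      (≤-reflexive (fromℕ-^ 2 (2 ℕ.+ n)))
      where
      n<2^n : ∀ n → n ℕ.< 2 ℕ.^ n
      n<2^n zero    = ℕ.≤-refl
      n<2^n (suc n) = ℕ.≤-trans (ℕ.+-mono-≤ (ℕ.m^n>0 2 n) (n<2^n n)) (ℕ.≤-reflexive (cong (ℕ._+_ (2 ℕ.^ n)) (sym (ℕ.+-identityʳ _))))
    search : ∀ j → q ≤ fromℕ 2 ^ suc (suc j) → ∃ λ k → fromℕ 2 ^ suc k ≤ q × q ≤ fromℕ 2 ^ suc (suc k)
    search zero    q≤ = 0 , 2≤q , q≤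
    search (suc j) q≤ with q ≤? fromℕ 2 ^ suc (suc j)
    ... | yes q≤′ = search j q≤′
    ... | no q≰ = suc j , <⇒≤ (≰⇒> q≰) , q≤

  -- Here q is one fixed sample of 1/ε and i a later one. The scale t is chosen for q + 1/4, and the
  -- shift is repaid by the loss of 1/2.
  sample-≥ : ∀ {i q t} → ∣ i - q ∣ ≤ ⅛ → t ≤ q + ¼ → t - ½ ≤ i
  sample-≥ {i} {q} {t} near t≤ = by-difference
    (p≤q⇒0≤q-p (∣p-q∣≤d⇒q≤p+d i q near) ⊕ p≤q⇒0≤q-p t≤ ⊕ nonNegative⁻¹ ⅛)
    (solve 3 (λ i q t → i := t :- con ½ :+ ((i :+ con ⅛ :- q) :+ (q :+ con ¼ :- t) :+ con ⅛)) refl i q t)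
    where open +-*-Solver

  sample-≤ : ∀ {i q t} → ∣ i - q ∣ ≤ ⅛ → q + ¼ ≤ t → i ≤ t
  sample-≤ {i} {q} {t} near ≤t = by-difference
    (p≤q⇒0≤q-p (∣p-q∣≤d⇒p≤q+d i q near) ⊕ p≤q⇒0≤q-p ≤t ⊕ nonNegative⁻¹ ⅛)
    (solve 3 (λ i q t → t := i :+ ((q :+ con ⅛ :- i) :+ (t :- (q :+ con ¼)) :+ con ⅛)) refl i q t)
    where open +-*-Solver

  module _ (ε inv : ℚ) (0≤ε : 0ℚ ≤ ε) where

    open +-*-Solver

    inv≥15/8 : ∣ inv * ε - 1ℚ ∣ ≤ 1/64 → ε ≤ ½ + 1/64 → + 15 / 8 ≤ inv
    inv≥15/8 close ε≤ with + 15 / 8 ≤? inv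
    ... | yes le = le
    ... | no ≰ = ⊥-elim (absurd-≤ {c = - (+ 9 / 512)}
      (0≤ε ⊗ p≤q⇒0≤q-p (<⇒≤ (≰⇒> ≰)) ⊕ (+ 15 / 8) ≥0⊗ p≤q⇒0≤q-p ε≤ ⊕ p≤q⇒0≤q-p (∣p-q∣≤d⇒q≤p+d (inv * ε) 1ℚ close))
      (solve 2 (λ e i → e :* (con (+ 15 / 8) :- i) :+ con (+ 15 / 8) :* (con (½ + 1/64) :- e) :+ (i :* e :+ con 1/64 :- con 1ℚ)
        := con (- (+ 9 / 512))) refl ε inv))

    module _ (T : ℚ) (1≤T : 1ℚ ≤ T) (close : ∣ inv * ε - 1ℚ ∣ ≤ ⅛) where

      -- As T ≥ 1, the sample of 1/ε is at least 2T - 1/2 ≥ 3T/2, and its product with ε is at most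
      -- 9/8; the quotient is 3/4. What is missing to 1 pays for the errors in `lower-approx`.
      Tε≤¾ : fromℕ 2 * T - ½ ≤ inv → T * ε ≤ ¾
      Tε≤¾ inv≥ = by-difference
        ((+ 2 / 3) ≥0⊗ (0≤ε ⊗ p≤q⇒0≤q-p inv≥ ⊕ p≤q⇒0≤q-p (∣p-q∣≤d⇒p≤q+d (inv * ε) 1ℚ close) ⊕ 0≤½ ⊗ (0≤ε ⊗ p≤q⇒0≤q-p 1≤T)))
        (solve 3 (λ T e i → con ¾ := T :* e :+ con (+ 2 / 3) :* (e :* (i :- (con (fromℕ 2) :* T :- con ½)) :+
          (con 1ℚ :+ con ⅛ :- i :* e) :+ con ½ :* (e :* (T :- con 1ℚ)))) refl T ε inv)

      module _ (L κ a : ℚ) (inv≤ : inv ≤ fromℕ 2 * (fromℕ 2 * T)) (0≤κ : 0ℚ ≤ κ) (κ≤4L : κ ≤ fromℕ 4 * L)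
        (a-close : ∣ a * (ε * L) - 1ℚ ∣ ≤ ⅛) where

        a≥0 : 0ℚ ≤ a
        a≥0 with 0ℚ ≤? a
        ... | yes le = le
        ... | no ≰ = ⊥-elim (absurd-≤ {c = - (+ 7 / 2)}
          (p≤q⇒0≤q-p (<⇒≤ (≰⇒> ≰)) ⊗ (0≤ε ⊗ (0≤κ ⊕ p≤q⇒0≤q-p κ≤4L)) ⊕
            fromℕ 4 ≥0⊗ p≤q⇒0≤q-p (∣p-q∣≤d⇒q≤p+d (a * (ε * L)) 1ℚ a-close))
          (solve 4 (λ a e k L → (con 0ℚ :- a) :* (e :* (k :+ (con (fromℕ 4) :* L :- k))) :+
            con (fromℕ 4) :* (a :* (e :* L) :+ con ⅛ :- con 1ℚ) := con (- (+ 7 / 2))) refl a ε κ L))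

        -- For exact data a = 1/(εL) with 1/ε ≤ 4T and L ≥ κ/4, which gives 16T. Doubling absorbs
        -- the two errors of 1/8.
        aκ≤32T : a * κ ≤ fromℕ 32 * T
        aκ≤32T = by-difference
          ((+ 8 / 7) ≥0⊗
            ((+ 7 / 8) ≥0⊗ (a≥0 ⊗ p≤q⇒0≤q-p κ≤4L) ⊕
             (a≥0 ⊗ (0≤κ ⊕ p≤q⇒0≤q-p κ≤4L)) ⊗ (0≤ε ⊗ p≤q⇒0≤q-p inv≤ ⊕ p≤q⇒0≤q-p (∣p-q∣≤d⇒q≤p+d (inv * ε) 1ℚ close)) ⊕
             fromℕ 16 ≥0⊗ ((0≤1 ⊕ p≤q⇒0≤q-p 1≤T) ⊗ p≤q⇒0≤q-p (∣p-q∣≤d⇒p≤q+d (a * (ε * L)) 1ℚ a-close)))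
            ⊕ (+ 80 / 7) ≥0⊗ (0≤1 ⊕ p≤q⇒0≤q-p 1≤T))
          (solve 6 (λ T e i L k a → let four = con (fromℕ 4); one = con 1ℚ; two = con (fromℕ 2) in
            con (fromℕ 32) :* T := a :* k :+ (con (+ 8 / 7) :*
              (con (+ 7 / 8) :* (a :* (four :* L :- k)) :+
               (a :* (k :+ (four :* L :- k))) :* (e :* (two :* (two :* T) :- i) :+ (i :* e :+ con ⅛ :- one)) :+
               con (fromℕ 16) :* ((one :+ (T :- one)) :* (one :+ con ⅛ :- a :* (e :* L))))
              :+ con (+ 80 / 7) :* (one :+ (T :- one)))) refl T ε inv L κ a)

  -- The chain is bκ ≤ 4bl ≤ 4(m + 1) ≤ 8U + 4, and U ≥ 1.
  bκ≤16U : ∀ b l m κ U → 0ℚ ≤ b → κ ≤ fromℕ 4 * l → ∣ b * l - m ∣ ≤ 1ℚ → m ≤ fromℕ 2 * U → 1ℚ ≤ U →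
    b * κ ≤ fromℕ 16 * U
  bκ≤16U b l m κ U 0≤b κ≤4l close m≤2U 1≤U = by-difference
    (0≤b ⊗ p≤q⇒0≤q-p κ≤4l ⊕ fromℕ 4 ≥0⊗ p≤q⇒0≤q-p (∣p-q∣≤d⇒p≤q+d (b * l) m close) ⊕ fromℕ 4 ≥0⊗ p≤q⇒0≤q-p m≤2U
      ⊕ fromℕ 8 ≥0⊗ p≤q⇒0≤q-p 1≤U ⊕ 0≤fromℕ 4)
    (solve 5 (λ b l m k U → let four = con (fromℕ 4); one = con 1ℚ; eight = con (fromℕ 8) in
      con (fromℕ 16) :* U := b :* k :+ (b :* (four :* l :- k) :+ four :* (m :+ one :- b :* l) :+ four :* (con (fromℕ 2) :* U :- m)
        :+ eight :* (U :- one) :+ four)) refl b l m κ U)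
    where open +-*-Solver

  ∣∣-near : ∀ p q d → ∣ p - q ∣ ≤ d → ∣ q ∣ ≤ ∣ p ∣ + d × ∣ p ∣ ≤ ∣ q ∣ + d
  ∣∣-near p q d close = half p q (≤-trans (≤-reflexive flip) close) , half q p close
    where
    open +-*-Solver
    flip : ∣ q - p ∣ ≡ ∣ p - q ∣
    flip = trans (sym (∣-p∣≡∣p∣ (q - p))) (cong ∣_∣ (solve 2 (λ p q → :- (q :- p) := p :- q) refl p q))
    half : ∀ p q → ∣ q - p ∣ ≤ d → ∣ q ∣ ≤ ∣ p ∣ + d
    half p q h = ≤-trans (≤-reflexive (cong ∣_∣ (solve 2 (λ p q → q := p :+ (q :- p)) refl p q)))
      (≤-trans (∣p+q∣≤∣p∣+∣q∣ p (q - p)) (+-monoʳ-≤ ∣ p ∣ h))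

  -- X, Y are the absolute values of an entry and of the diagonal entry in its
  -- column, E, F those of their approximations.
  module _ (T τ X Y E F : ℚ) (1≤T : 1ℚ ≤ T) (0≤τ : 0ℚ ≤ τ) (16Tτ≤Y : fromℕ 16 * T * τ ≤ Y)
    (E≤ : E ≤ X + τ) (Y≤ : Y ≤ F + τ) (F≤ : F ≤ Y + τ) where

    open +-*-Solver

    15Tτ≤F : fromℕ 15 * T * τ ≤ F
    15Tτ≤F = by-difference (p≤q⇒0≤q-p 16Tτ≤Y ⊕ p≤q⇒0≤q-p Y≤ ⊕ p≤q⇒0≤q-p 1≤T ⊗ 0≤τ)
      (solve 4 (λ T t Y F → F := con (fromℕ 15) :* T :* t :+ (Y :- con (fromℕ 16) :* T :* t :+ (F :+ t :- Y) :+ (T :- con 1ℚ) :* t))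
        refl T τ Y F)

    dominant-approx : X ≤ Y + τ → E ≤ fromℕ 2 * F
    dominant-approx X≤ = by-difference
      (p≤q⇒0≤q-p E≤ ⊕ p≤q⇒0≤q-p X≤ ⊕ p≤q⇒0≤q-p Y≤ ⊕ p≤q⇒0≤q-p 15Tτ≤F ⊕ fromℕ 15 ≥0⊗ (p≤q⇒0≤q-p 1≤T ⊗ 0≤τ) ⊕ fromℕ 12 ≥0⊗ 0≤τ)
      (solve 6 (λ T t X Y E F → con (fromℕ 2) :* F := E :+ ((X :+ t :- E) :+ (Y :+ t :- X) :+ (F :+ t :- Y) :+
        (F :- con (fromℕ 15) :* T :* t) :+ con (fromℕ 15) :* ((T :- con 1ℚ) :* t) :+ con (fromℕ 12) :* t)) refl T τ X Y E F)

    -- Passing to the approximations costs TE ≤ (3/4)F + (3/4)τ + 2Tτ. The remaining quarter of F is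
    -- at least (15/4)Tτ and covers the error terms; this is why τ is taken 16T times smaller than
    -- the diagonal.
    lower-approx : ∀ ε → 0ℚ ≤ ε → T * ε ≤ ¾ → X ≤ ε * Y + τ → 0ℚ ≤ Y → T * E ≤ F
    lower-approx ε 0≤ε Tε≤¾ X≤ 0≤Y = by-difference
      ((0≤1 ⊕ p≤q⇒0≤q-p 1≤T) ⊗ p≤q⇒0≤q-p E≤ ⊕ (0≤1 ⊕ p≤q⇒0≤q-p 1≤T) ⊗ p≤q⇒0≤q-p X≤ ⊕ p≤q⇒0≤q-p Tε≤¾ ⊗ 0≤Y
        ⊕ ¾ ≥0⊗ p≤q⇒0≤q-p Y≤ ⊕ ¼ ≥0⊗ p≤q⇒0≤q-p 15Tτ≤F ⊕ ¾ ≥0⊗ (p≤q⇒0≤q-p 1≤T ⊗ 0≤τ) ⊕ (0≤1 ⊕ p≤q⇒0≤q-p 1≤T) ⊗ 0≤τ)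
      (solve 7 (λ T t X Y E F e → let one = con 1ℚ in
        F := T :* E :+ ((one :+ (T :- one)) :* (X :+ t :- E) :+ (one :+ (T :- one)) :* (e :* Y :+ t :- X) :+ (con ¾ :- T :* e) :* Y
          :+ con ¾ :* (F :+ t :- Y) :+ con ¼ :* (F :- con (fromℕ 15) :* T :* t) :+ con ¾ :* ((T :- one) :* t)
          :+ (one :+ (T :- one)) :* t)) refl T τ X Y E F ε)

  ≤-scaled : ∀ {W c r δ z} → W * c ≡ 1ℚ → 0ℚ ≤ W → 0ℚ ≤ δ → r + δ ≤ c * z → W * r ≤ z
  ≤-scaled {W} {c} {r} {δ} {z} Wc≡1 0≤W 0≤δ le = by-difference (0≤W ⊗ p≤q⇒0≤q-p le ⊕ 0≤W ⊗ 0≤δ)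
    (trans (sym (*-identityˡ z)) (trans (cong (_* z) (sym Wc≡1))
      (solve 5 (λ W c r d z → W :* c :* z := W :* r :+ (W :* (c :* z :- (r :+ d)) :+ W :* d)) refl W c r δ z)))
    where open +-*-Solver

-- Choice of p and the final numerical contradiction.

module Exponents where

  open import Data.Empty using (⊥)
  open import Data.Nat
  open import Data.Nat.Properties
  open import Data.Nat.Tactic.RingSolver using (solve-∀)
  open import Data.Product using (_,_)
  open import Data.Sum using (inj₁; inj₂)
  open import Relation.Binary.PropositionalEquality
  open import Relation.Nullary using (yes; no)

  ^-cancelʳ-≤ : ∀ {m n} → 2 ^ m ≤ 2 ^ n → m ≤ n
  ^-cancelʳ-≤ {m} {n} le = ≮⇒≥ λ n<m → <⇒≱ (^-monoʳ-< 2 (n<1+n 1) n<m) le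

  ^-split : ∀ {a} b c → a ≡ b + c → 2 ^ a ≡ 2 ^ b * 2 ^ c
  ^-split b c eq = trans (cong (2 ^_) eq) (^-distribˡ-+-* 2 b c)

  -- With p = 2^e and 32 · 8 = 2^8 both sides are powers of 2, and comparing exponents gives 2p ≤ 1
  -- + (8 + e)r. The 1 is absorbed by one p.
  exponents : ∀ e r → let p = 2 ^ e in
    2 ^ (2 * p) ≤ 2 * (32 * (8 * p)) ^ r → p ≤ (8 + e) * r
  exponents e r le = +-cancelˡ-≤ 1 _ _ (begin
    1 + 2 ^ e                  ≤⟨ +-monoˡ-≤ (2 ^ e) (>-nonZero⁻¹ (2 ^ e) {{m^n≢0 2 e}}) ⟩
    2 ^ e + 2 ^ e              ≡⟨ cong (2 ^ e +_) (sym (+-identityʳ (2 ^ e))) ⟩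
    2 * 2 ^ e                  ≤⟨ ^-cancelʳ-≤ (≤-trans le (≤-reflexive power)) ⟩
    1 + (8 + e) * r            ∎)
    where
    open ≤-Reasoning
    power : 2 * (32 * (8 * 2 ^ e)) ^ r ≡ 2 ^ (1 + (8 + e) * r)
    power = cong (2 *_) (trans (cong (_^ r) (trans (sym (*-assoc 32 8 (2 ^ e))) (sym (^-distribˡ-+-* 2 8 e)))) (^-*-assoc 2 (8 + e) r))

  -- `T` stands for 1/C and 2^k for Q. The hypotheses `above₁` and `above₂` express that r is too
  -- small for the two terms of the minimum, multiplied out with the lower bounds for the
  -- logarithms.
  module _ (T m r k K : ℕ) (T-large : 1024 * 1024 < T) (1≤r : 1 ≤ r) (2^K≤m : 2 ^ suc K ≤ m)
    (bound : ∀ p → 0 < p → 8 * p ≤ m → 64 * (8 * p) ≤ 2 ^ k * 2 ^ k → 2 ^ (2 * p) ≤ 2 * (32 * (8 * p)) ^ r)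
    (above₁ : T * (r * (suc k * suc k)) ≤ 1024 * (2 ^ k * 2 ^ k))
    (above₂ : T * (r * suc K) ≤ 16 * 2 ^ suc K)
    where

    open ≤-Reasoning

    T≰ : ∀ c x → c ≤ 1024 * 1024 → 1 ≤ x → T * x ≤ c * x → ⊥
    T≰ c x c≤ 1≤x le = <⇒≱ T-large (≤-trans (*-cancelʳ-≤ T c x {{>-nonZero 1≤x}} le) c≤)

    T≰′ : ∀ c x → c ≤ 1024 * 1024 → 1 ≤ x → T * x ≤ c → ⊥
    T≰′ c x c≤ 1≤x le = T≰ c x c≤ 1≤x (≤-trans le (m≤m*n c x {{>-nonZero 1≤x}}))

    1≤rK : 1 ≤ r * suc K
    1≤rK = *-mono-≤ {1} {r} {1} {suc K} 1≤r (s≤s z≤n)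

    1≤rkk : 1 ≤ r * (suc k * suc k)
    1≤rkk = *-mono-≤ {1} {r} {1} {suc k * suc k} 1≤r (s≤s z≤n)

    -- With e = K - 2 the size n = 8 · 2^e is 2^(K+1), the power of two known to be at most m.
    large-m : ∀ e → suc K ≡ 3 + e → 2 ^ e ≤ (8 + e) * r → ⊥
    large-m e K≡ le = T≰ (16 * 2 ^ 3 * 8) (r * suc K) (≤ᵇ⇒≤ (16 * 2 ^ 3 * 8) (1024 * 1024) _) 1≤rK (begin
      T * (r * suc K)                ≤⟨ above₂ ⟩
      16 * 2 ^ suc K                 ≡⟨ cong (16 *_) (^-split 3 e K≡) ⟩
      16 * (2 ^ 3 * 2 ^ e)           ≤⟨ *-monoʳ-≤ 16 (*-monoʳ-≤ (2 ^ 3) le) ⟩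
      16 * (2 ^ 3 * ((8 + e) * r))   ≤⟨ *-monoʳ-≤ 16 (*-monoʳ-≤ (2 ^ 3) (*-monoˡ-≤ r 8+e≤)) ⟩
      16 * (2 ^ 3 * (8 * suc K * r)) ≡⟨ collect 16 (2 ^ 3) 8 (suc K) r ⟩
      16 * 2 ^ 3 * 8 * (r * suc K)   ∎)
      where
      expand : ∀ e → 8 + e + (16 + 7 * e) ≡ 8 * (3 + e)
      expand = solve-∀
      8+e≤ : 8 + e ≤ 8 * suc K
      8+e≤ = ≤-trans (m≤m+n (8 + e) (16 + 7 * e)) (≤-reflexive (trans (expand e) (cong (8 *_) (sym K≡))))
      collect : ∀ a b c x r → a * (b * (c * x * r)) ≡ a * b * c * (r * x)
      collect = solve-∀

    -- With e = 2k - 9 the requirement 64n ≤ Q² is met with equality.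
    small-ε : ∀ e → k + k ≡ 9 + e → 2 ^ e ≤ (8 + e) * r → ⊥
    small-ε e k≡ le = T≰ (1024 * 2 ^ 9 * 2) (r * (suc k * suc k)) (≤ᵇ⇒≤ (1024 * 2 ^ 9 * 2) (1024 * 1024) _) 1≤rkk (begin
      T * (r * (suc k * suc k))                  ≤⟨ above₁ ⟩
      1024 * (2 ^ k * 2 ^ k)                     ≡⟨ cong (1024 *_) (trans (sym (^-distribˡ-+-* 2 k k)) (^-split 9 e k≡)) ⟩
      1024 * (2 ^ 9 * 2 ^ e)                     ≤⟨ *-monoʳ-≤ 1024 (*-monoʳ-≤ (2 ^ 9) le) ⟩
      1024 * (2 ^ 9 * ((8 + e) * r))             ≤⟨ *-monoʳ-≤ 1024 (*-monoʳ-≤ (2 ^ 9) (*-monoˡ-≤ r 8+e≤)) ⟩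
      -- A single logarithm would do here; it is enlarged to the square that the claimed bound
      -- contains.
      1024 * (2 ^ 9 * (2 * suc k * r))           ≤⟨ *-monoʳ-≤ 1024 (*-monoʳ-≤ (2 ^ 9) (*-monoˡ-≤ r (*-monoʳ-≤ 2 (m≤m*n (suc k) (suc k))))) ⟩
      1024 * (2 ^ 9 * (2 * (suc k * suc k) * r)) ≡⟨ collect 1024 (2 ^ 9) 2 (suc k * suc k) r ⟩
      1024 * 2 ^ 9 * 2 * (r * (suc k * suc k))   ∎)
      where
      expand : ∀ k → 2 * suc k ≡ 2 + (k + k)
      expand = solve-∀
      8+e≤ : 8 + e ≤ 2 * suc k
      8+e≤ = ≤-trans (m≤n+m (8 + e) 3) (≤-reflexive (trans (cong (2 +_) (sym k≡)) (sym (expand k))))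
      collect : ∀ a b c x r → a * (b * (c * x * r)) ≡ a * b * c * (r * x)
      collect = solve-∀

    use-bound : ∀ e → 3 + e ≤ suc K → 9 + e ≤ k + k → 2 ^ e ≤ (8 + e) * r
    use-bound e e≤K e≤k = exponents e r (bound (2 ^ e) (>-nonZero⁻¹ (2 ^ e) {{m^n≢0 2 e}})
      (≤-trans (≤-reflexive (sym (^-split 3 e refl))) (≤-trans (^-monoʳ-≤ 2 e≤K) 2^K≤m))
      (begin
        64 * (8 * 2 ^ e)       ≡⟨ sym (*-assoc 64 8 (2 ^ e)) ⟩
        64 * 8 * 2 ^ e         ≡⟨ sym (^-split 9 e refl) ⟩
        2 ^ (9 + e)            ≤⟨ ^-monoʳ-≤ 2 e≤k ⟩
        2 ^ (k + k)            ≡⟨ ^-distribˡ-+-* 2 k k ⟩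
        2 ^ k * 2 ^ k          ∎))

    2k≡ : ∀ k′ → 5 + k′ ≡ k → k + k ≡ 9 + (1 + 2 * k′)
    2k≡ k′ k≡ = trans (cong (λ k → k + k) (sym k≡)) (double k′)
      where
      double : ∀ k → (5 + k) + (5 + k) ≡ 9 + (1 + 2 * k)
      double = solve-∀

    endgame : ⊥
    endgame with K <? 2 | k <? 5
    -- If m or 1/ε is bounded, there is no room for the construction, but then the minimum is
    -- bounded too and r ≥ 1 suffices.
    ... | yes K<2 | _ = T≰′ (16 * 2 ^ 2) (r * suc K) (≤ᵇ⇒≤ (16 * 2 ^ 2) (1024 * 1024) _) 1≤rK
      (≤-trans above₂ (*-monoʳ-≤ 16 {2 ^ suc K} {2 ^ 2} (^-monoʳ-≤ 2 K<2)))
    ... | no _ | yes k<5 = T≰′ (1024 * (2 ^ 4 * 2 ^ 4)) (r * (suc k * suc k))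
      (≤ᵇ⇒≤ (1024 * (2 ^ 4 * 2 ^ 4)) (1024 * 1024) _) 1≤rkk
      (≤-trans above₁ (*-monoʳ-≤ 1024 {2 ^ k * 2 ^ k} {2 ^ 4 * 2 ^ 4} (*-mono-≤ 2^k≤ 2^k≤)))
      where
      2^k≤ : 2 ^ k ≤ 2 ^ 4
      2^k≤ = ^-monoʳ-≤ 2 (≤-pred k<5)
    ... | no K≮2 | no k≮5 with m≤n⇒∃[o]m+o≡n (≮⇒≥ K≮2) | m≤n⇒∃[o]m+o≡n (≮⇒≥ k≮5)
    -- The admissible exponents are e ≤ K′ from m and e ≤ 1 + 2k′ from ε. The smaller one is used,
    -- and it contradicts the hypothesis on the corresponding term of the minimum.
    ...   | K′ , K≡ | k′ , k≡ with ≤-total K′ (1 + 2 * k′)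
    ...     | inj₁ K′≤ = large-m K′ (cong suc (sym K≡))
      (use-bound K′ (≤-reflexive (cong suc K≡)) (≤-trans (+-monoʳ-≤ 9 K′≤) (≤-reflexive (sym (2k≡ k′ k≡)))))
    ...     | inj₂ ≤K′ = small-ε (1 + 2 * k′) (2k≡ k′ k≡)
      (use-bound (1 + 2 * k′) (≤-trans (+-monoʳ-≤ 3 ≤K′) (≤-reflexive (cong suc K≡))) (≤-reflexive (sym (2k≡ k′ k≡))))

-- The contradiction for rational data at a single index.

module FixedIndex where

  open ClearingDenominators using (rankBoundℚ)
  open Exponents using (endgame)
  open RationalEstimates
  open RationalPowers using (0≤fromℕ; fromℕ-*; fromℕ-^; 1≤2^n) renaming (fromℕ to ℕ→ℚ; _⊗_ to _⊗≥0_; *-mono-≤ to *-mono-≤ℚ)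
  open import Data.Empty using (⊥)
  open import Data.Fin as Fin using (Fin; zero; suc; inject≤)
  open import Data.Fin.Properties using (toℕ-inject≤)
  open import Data.Nat as ℕ using (ℕ; zero; suc; s≤s; z≤n)
  import Data.Nat.Properties as ℕ
  open import Data.Product using (_×_; proj₁; proj₂)
  open import Data.Rational as ℚ using (ℚ; 0ℚ; 1ℚ; ½)
  import Data.Rational.Properties as ℚ
  open import Algebra.Definitions.RawSemiring ℚ.+-*-rawSemiring using () renaming (_^_ to _^ℚ_; sum to sumℚ)
  open import Data.Rational.Solver using (module +-*-Solver)
  open import Relation.Binary.PropositionalEquality

  nonempty : ∀ {r} (f : Fin r → ℚ) → 0ℚ ℚ.< ℚ.∣ sumℚ f ∣ → 1 ℕ.≤ r
  nonempty {zero}  f 0<0 with () ← ℚ.<-irrefl refl 0<0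
  nonempty {suc r} f _   = s≤s z≤n

  module AtIndex
    (m r k K W : ℕ) (M : Fin m → Fin m → ℚ) (basis : Fin r → Fin m → ℚ) (coefficient : Fin m → Fin r → ℚ)
    (ε inv L a logm b c δ η τ : ℚ) (2≤m : 2 ℕ.≤ m)
    (W-large : 1024 ℕ.* 1024 ℕ.< W) (Wc≡1 : ℕ→ℚ W ℚ.* c ≡ 1ℚ)
    (0≤δ : 0ℚ ℚ.≤ δ) (0<τ : 0ℚ ℚ.< τ) (16Tτ≡η : ℕ→ℚ 16 ℚ.* ℕ→ℚ 2 ^ℚ k ℚ.* τ ≡ η)
    (U≤m : ℕ→ℚ 2 ^ℚ suc K ℚ.≤ ℕ→ℚ m) (m≤2U : ℕ→ℚ m ℚ.≤ ℕ→ℚ 2 ^ℚ suc (suc K))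
    (0≤ε : 0ℚ ℚ.≤ ε)
    (inv-close : ℚ.∣ inv ℚ.* ε ℚ.- 1ℚ ∣ ℚ.≤ ⅛)
    (inv≥ : ℕ→ℚ 2 ^ℚ suc k ℚ.- ½ ℚ.≤ inv)
    (inv≤ : inv ℚ.≤ ℕ→ℚ 2 ^ℚ suc (suc k))
    (L≥ : ℕ→ℚ (suc k) ℚ.≤ ℕ→ℚ 4 ℚ.* L)
    (a-close : ℚ.∣ a ℚ.* (ε ℚ.* L) ℚ.- 1ℚ ∣ ℚ.≤ ⅛)
    (logm≥ : ℕ→ℚ (suc K) ℚ.≤ ℕ→ℚ 4 ℚ.* logm)
    (b-close : ℚ.∣ b ℚ.* logm ℚ.- ℕ→ℚ m ∣ ℚ.≤ 1ℚ)
    (small-rank : ℕ→ℚ r ℚ.+ δ ℚ.≤ c ℚ.* ((a ℚ.* (a ℚ.* 1ℚ)) ℚ.⊓ b))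
    (η≤ : ∀ i → η ℚ.≤ ℚ.∣ M i i ∣)
    (close : ∀ i j → ℚ.∣ M j i ℚ.- sumℚ (λ l → coefficient i l ℚ.* basis l j) ∣ ℚ.≤ τ)
    (dominant : ∀ i j → ℚ.∣ M j i ∣ ℚ.≤ ℚ.∣ M i i ∣ ℚ.+ τ)
    (lower : ∀ i j → j Fin.< i → ℚ.∣ M j i ∣ ℚ.≤ ε ℚ.* ℚ.∣ M i i ∣ ℚ.+ τ)
    where

    open +-*-Solver using (solve; _:*_; _:=_; con)

    T U : ℚ
    T = ℕ→ℚ 2 ^ℚ k
    U = ℕ→ℚ 2 ^ℚ suc K

    1≤T : 1ℚ ℚ.≤ T
    1≤T = 1≤2^n k

    entry : Fin m → Fin m → ℚ
    entry j i = sumℚ (λ l → coefficient i l ℚ.* basis l j)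

    E X : Fin m → Fin m → ℚ
    E j i = ℚ.∣ entry j i ∣
    X j i = ℚ.∣ M j i ∣

    near : ∀ j i → E j i ℚ.≤ X j i ℚ.+ τ × X j i ℚ.≤ E j i ℚ.+ τ
    near j i = ∣∣-near (M j i) (entry j i) τ (close i j)

    16Tτ≤ : ∀ i → ℕ→ℚ 16 ℚ.* T ℚ.* τ ℚ.≤ X i i
    16Tτ≤ i = ℚ.≤-trans (ℚ.≤-reflexive 16Tτ≡η) (η≤ i)

    0<E : ∀ i → 0ℚ ℚ.< E i i
    0<E i = ℚ.<-≤-trans (ℚ.positive⁻¹ _ {{ℚ.pos*pos⇒pos (ℕ→ℚ 15 ℚ.* T)
        {{ℚ.pos*pos⇒pos (ℕ→ℚ 15) T {{ℚ.positive (ℚ.<-≤-trans (ℚ.positive⁻¹ 1ℚ) 1≤T)}}}} τ {{ℚ.positive 0<τ}}}})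
      (15Tτ≤F T τ (X i i) (X i i) (E i i) (E i i) 1≤T (ℚ.<⇒≤ 0<τ) (16Tτ≤ i) (proj₁ (near i i)) (proj₂ (near i i)) (proj₁ (near i i)))

    E-dominant : ∀ j i → E j i ℚ.≤ ℕ→ℚ 2 ℚ.* E i i
    E-dominant j i = dominant-approx T τ (X j i) (X i i) (E j i) (E i i) 1≤T (ℚ.<⇒≤ 0<τ) (16Tτ≤ i)
      (proj₁ (near j i)) (proj₂ (near i i)) (proj₁ (near i i)) (dominant i j)

    E-lower : ∀ j i → j Fin.< i → ℕ→ℚ (2 ℕ.^ k) ℚ.* E j i ℚ.≤ E i i
    E-lower j i j<i = subst (λ t → t ℚ.* E j i ℚ.≤ E i i) (sym (fromℕ-^ 2 k))
      (lower-approx T τ (X j i) (X i i) (E j i) (E i i) 1≤T (ℚ.<⇒≤ 0<τ) (16Tτ≤ i)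
        (proj₁ (near j i)) (proj₂ (near i i)) (proj₁ (near i i)) ε 0≤ε
        (Tε≤¾ ε inv 0≤ε T 1≤T inv-close inv≥) (lower i j j<i) (ℚ.0≤∣p∣ (M i i)))

    bound : ∀ p → 0 ℕ.< p → 8 ℕ.* p ℕ.≤ m → 64 ℕ.* (8 ℕ.* p) ℕ.≤ 2 ℕ.^ k ℕ.* 2 ℕ.^ k →
      2 ℕ.^ (2 ℕ.* p) ℕ.≤ 2 ℕ.* (32 ℕ.* (8 ℕ.* p)) ℕ.^ r
    -- Restriction to the leading 8p rows and columns: it keeps the inner dimension and, since
    -- `inject≤` preserves the order, the triangular shape.
    bound p 0<p 8p≤m = rankBoundℚ {p} {r} (2 ℕ.^ k)
      (λ l j → basis l (inject≤ j 8p≤m)) (λ i l → coefficient (inject≤ i 8p≤m) l) 0<p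
      (λ i → 0<E (inject≤ i 8p≤m))
      (λ j i → E-dominant (inject≤ j 8p≤m) (inject≤ i 8p≤m))
      (λ j i j<i → E-lower (inject≤ j 8p≤m) (inject≤ i 8p≤m)
        (subst₂ ℕ._<_ (sym (toℕ-inject≤ j 8p≤m)) (sym (toℕ-inject≤ i 8p≤m)) j<i))

    1≤r : 1 ℕ.≤ r
    1≤r = nonempty (λ l → coefficient i₀ l ℚ.* basis l i₀) (0<E i₀)
      where
      i₀ : Fin m
      i₀ = inject≤ zero (ℕ.≤-trans (s≤s z≤n) 2≤m)

    w κ ρ λₘ : ℚ
    w = ℕ→ℚ W
    κ = ℕ→ℚ (suc k)
    ρ = ℕ→ℚ r
    λₘ = ℕ→ℚ (suc K)

    wρ≤min : w ℚ.* ρ ℚ.≤ (a ℚ.* (a ℚ.* 1ℚ)) ℚ.⊓ b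
    wρ≤min = ≤-scaled {w} {c} {ρ} {δ} {(a ℚ.* (a ℚ.* 1ℚ)) ℚ.⊓ b} Wc≡1 (0≤fromℕ W) 0≤δ small-rank

    wρ≤a² : w ℚ.* ρ ℚ.≤ a ℚ.* (a ℚ.* 1ℚ)
    wρ≤a² = ℚ.≤-trans wρ≤min (ℚ.p⊓q≤p _ b)

    wρ≤b : w ℚ.* ρ ℚ.≤ b
    wρ≤b = ℚ.≤-trans wρ≤min (ℚ.p⊓q≤q (a ℚ.* (a ℚ.* 1ℚ)) _)

    0≤a : 0ℚ ℚ.≤ a
    0≤a = a≥0 ε inv 0≤ε T 1≤T inv-close L κ a inv≤ (0≤fromℕ (suc k)) L≥ a-close

    aκ≤ : a ℚ.* κ ℚ.≤ ℕ→ℚ 32 ℚ.* T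
    aκ≤ = aκ≤32T ε inv 0≤ε T 1≤T inv-close L κ a inv≤ (0≤fromℕ (suc k)) L≥ a-close

    0≤κ : 0ℚ ℚ.≤ κ
    0≤κ = 0≤fromℕ (suc k)

    above₁ : W ℕ.* (r ℕ.* (suc k ℕ.* suc k)) ℕ.≤ 1024 ℕ.* (2 ℕ.^ k ℕ.* 2 ℕ.^ k)
    above₁ = fromℕ-cancel-≤ (begin
      ℕ→ℚ (W ℕ.* (r ℕ.* (suc k ℕ.* suc k)))        ≡⟨ trans (fromℕ-* W (r ℕ.* (suc k ℕ.* suc k))) (cong (w ℚ.*_) (trans (fromℕ-* r (suc k ℕ.* suc k)) (cong (ρ ℚ.*_) (fromℕ-* (suc k) (suc k))))) ⟩
      w ℚ.* (ρ ℚ.* (κ ℚ.* κ))                      ≡⟨ solve 3 (λ w r k → w :* (r :* (k :* k)) := w :* r :* (k :* k)) refl w ρ κ ⟩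
      w ℚ.* ρ ℚ.* (κ ℚ.* κ)                        ≤⟨ ℚ.*-monoʳ-≤-nonNeg (κ ℚ.* κ) {{ℚ.nonNegative (0≤κ ⊗≥0 0≤κ)}} wρ≤a² ⟩
      a ℚ.* (a ℚ.* 1ℚ) ℚ.* (κ ℚ.* κ)   ≡⟨ solve 2 (λ a k → a :* (a :* con 1ℚ) :* (k :* k) := a :* k :* (a :* k)) refl a κ ⟩
      a ℚ.* κ ℚ.* (a ℚ.* κ)            ≤⟨ *-mono-≤ℚ (0≤a ⊗≥0 0≤κ) (0≤a ⊗≥0 0≤κ) aκ≤ aκ≤ ⟩
      ℕ→ℚ 32 ℚ.* T ℚ.* (ℕ→ℚ 32 ℚ.* T)              ≡⟨ solve 1 (λ t → con (ℕ→ℚ 32) :* t :* (con (ℕ→ℚ 32) :* t) := con (ℕ→ℚ 1024) :* (t :* t)) refl T ⟩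
      ℕ→ℚ 1024 ℚ.* (T ℚ.* T)                       ≡⟨ sym (trans (fromℕ-* 1024 (2 ℕ.^ k ℕ.* 2 ℕ.^ k)) (cong (ℕ→ℚ 1024 ℚ.*_) (trans (fromℕ-* (2 ℕ.^ k) (2 ℕ.^ k)) (cong₂ ℚ._*_ (fromℕ-^ 2 k) (fromℕ-^ 2 k))))) ⟩
      ℕ→ℚ (1024 ℕ.* (2 ℕ.^ k ℕ.* 2 ℕ.^ k))         ∎)
      where open ℚ.≤-Reasoning

    above₂ : W ℕ.* (r ℕ.* suc K) ℕ.≤ 16 ℕ.* 2 ℕ.^ suc K
    above₂ = fromℕ-cancel-≤ (begin
      ℕ→ℚ (W ℕ.* (r ℕ.* suc K))     ≡⟨ trans (fromℕ-* W _) (cong (w ℚ.*_) (fromℕ-* r (suc K))) ⟩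
      w ℚ.* (ρ ℚ.* λₘ)              ≡⟨ sym (ℚ.*-assoc w ρ λₘ) ⟩
      w ℚ.* ρ ℚ.* λₘ                ≤⟨ ℚ.*-monoʳ-≤-nonNeg λₘ wρ≤b ⟩
      b ℚ.* λₘ                ≤⟨ bκ≤16U b logm (ℕ→ℚ m) λₘ U
        (ℚ.≤-trans (0≤fromℕ W ⊗≥0 0≤fromℕ r) wρ≤b) logm≥
        b-close m≤2U (1≤2^n (suc K)) ⟩
      ℕ→ℚ 16 ℚ.* U                  ≡⟨ sym (trans (fromℕ-* 16 (2 ℕ.^ suc K)) (cong (ℕ→ℚ 16 ℚ.*_) (fromℕ-^ 2 (suc K)))) ⟩
      ℕ→ℚ (16 ℕ.* 2 ℕ.^ suc K)      ∎)
      where open ℚ.≤-Reasoning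

    2^K≤m : 2 ℕ.^ suc K ℕ.≤ m
    2^K≤m = fromℕ-cancel-≤ (ℚ.≤-trans (ℚ.≤-reflexive (fromℕ-^ 2 (suc K))) U≤m)

    absurd : ⊥
    absurd = endgame W m r k K W-large 1≤r 2^K≤m bound above₁ above₂

open import Defs
open import Data.Nat as ℕ using (ℕ)
open import Data.Product using (Σ; _×_)
open import Data.Rational using (½)
open import Relation.Nullary using (¬_)

-- Constructive order on Cauchy reals and logarithms at late indices.

module Reals where

  open RationalPowers using (p≤q⇒0≤q-p; by-difference; _⊕_; _⊗_; ∣p-q∣≤d⇒p≤q+d; ∣p-q∣≤d⇒q≤p+d;
    log-lower; archimedean; 1/n>0; n*1/n≡1; fromℕ-mono-≤) renaming (fromℕ to ℕ→ℚ)
  open RationalEstimates using (⅛)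
  open import Data.Fin using (Fin; zero; suc)
  open import Data.Integer using (+_)
  open import Data.Nat as ℕ using (ℕ; zero; suc; _⊔_)
  import Data.Nat.Properties as ℕ
  open import Data.Product using (∃; _×_; _,_; proj₁; proj₂)
  open import Data.Rational as ℚ using (ℚ; 0ℚ; 1ℚ; ½)
  import Data.Rational.Properties as ℚ
  open import Algebra.Definitions.RawSemiring ℚ.+-*-rawSemiring using () renaming (_^_ to _^ℚ_; sum to sumℚ)
  open import Data.Rational.Solver using (module +-*-Solver)
  open import Data.Sum using (_⊎_; inj₁; inj₂; [_,_]′)
  open import Function using (_∘_; id; case_of_)
  open import Relation.Binary.PropositionalEquality
  open import Relation.Nullary using (¬_; yes; no; contradiction)

  infixr 4 _and_

  _and_ : ∀ {P Q : ℕ → Set} → Eventually P → Eventually Q → Eventually (λ n → P n × Q n)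
  (M , p) and (N , q) = M ⊔ N , λ n ≤n → p n (ℕ.m⊔n≤o⇒m≤o M N ≤n) , q n (ℕ.m⊔n≤o⇒n≤o M N ≤n)

  eventually-∀ : ∀ {m} {P : Fin m → ℕ → Set} → (∀ i → Eventually (P i)) → Eventually (λ n → ∀ i → P i n)
  eventually-∀ {zero}  h = 0 , λ _ _ ()
  eventually-∀ {suc m} h = let N , both = h zero and eventually-∀ (h ∘ suc) in
    N , λ n ≤n → λ { zero → proj₁ (both n ≤n) ; (suc i) → proj₂ (both n ≤n) i }

  witness : ∀ {P : ℕ → Set} → Eventually P → ∃ P
  witness (N , p) = N , p N ℕ.≤-refl

  seq-^ : ∀ x k n → seq (x ^ k) n ≡ seq x n ^ℚ k
  seq-^ x zero    n = refl
  seq-^ x (suc k) n = cong (seq x n ℚ.*_) (seq-^ x k n)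

  seq-sum : ∀ {k} (v : Fin k → ℝ) n → seq (sum v) n ≡ sumℚ (λ i → seq (v i) n)
  seq-sum {zero}  v n = refl
  seq-sum {suc k} v n = cong (seq (v zero) n ℚ.+_) (seq-sum (v ∘ suc) n)

  seq-fromℕ : ∀ m n → seq (fromℕ m) n ≡ ℕ→ℚ m
  seq-fromℕ m n = ℚ.↥p/↧p≡p (ℕ→ℚ m)

  0<⅛* : ∀ {δ} → 0ℚ ℚ.< δ → 0ℚ ℚ.< ⅛ ℚ.* δ
  0<⅛* {δ} 0<δ = ℚ.positive⁻¹ _ {{ℚ.pos*pos⇒pos ⅛ δ {{ℚ.positive 0<δ}}}}

  module _ (x y : ℝ) (δ : ℚ) (0<δ : 0ℚ ℚ.< δ) where

    private
      M = proj₁ (cauchy x (⅛ ℚ.* δ) (0<⅛* 0<δ))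
      N = proj₁ (cauchy y (⅛ ℚ.* δ) (0<⅛* 0<δ))
      X = seq x (M ⊔ N)
      Y = seq y (M ⊔ N)

      x-near : ∀ n → M ⊔ N ℕ.≤ n → ℚ.∣ seq x n ℚ.- X ∣ ℚ.≤ ⅛ ℚ.* δ
      x-near n ≤n = proj₂ (cauchy x (⅛ ℚ.* δ) (0<⅛* 0<δ)) n (M ⊔ N) (ℕ.m⊔n≤o⇒m≤o M N ≤n) (ℕ.m≤m⊔n M N)

      y-near : ∀ n → M ⊔ N ℕ.≤ n → ℚ.∣ seq y n ℚ.- Y ∣ ℚ.≤ ⅛ ℚ.* δ
      y-near n ≤n = proj₂ (cauchy y (⅛ ℚ.* δ) (0<⅛* 0<δ)) n (M ⊔ N) (ℕ.m⊔n≤o⇒n≤o M N ≤n) (ℕ.m≤n⊔m M N)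

      below : X ℚ.≤ Y ℚ.+ ½ ℚ.* δ → ∀ n → M ⊔ N ℕ.≤ n → seq x n ℚ.≤ seq y n ℚ.+ δ
      below le n ≤n = by-difference
        (p≤q⇒0≤q-p (∣p-q∣≤d⇒p≤q+d (seq x n) X (x-near n ≤n))
          ⊕ p≤q⇒0≤q-p (∣p-q∣≤d⇒q≤p+d (seq y n) Y (y-near n ≤n))
          ⊕ p≤q⇒0≤q-p le ⊕ ℚ.≤ᵇ⇒≤ {0ℚ} {+ 1 ℚ./ 4} _ ⊗ ℚ.<⇒≤ 0<δ)
        (solve 5 (λ x X y Y d → y :+ d := x :+ ((X :+ con ⅛ :* d :- x) :+ (y :+ con ⅛ :* d :- Y) :+ (Y :+ con ½ :* d :- X) :+ con (+ 1 ℚ./ 4) :* d))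
          refl (seq x n) X (seq y n) Y δ)
        where open +-*-Solver

      above : Y ℚ.+ ½ ℚ.* δ ℚ.≤ X → ∀ n → M ⊔ N ℕ.≤ n → seq y n ℚ.+ ⅛ ℚ.* δ ℚ.≤ seq x n
      above ge n ≤n = by-difference
        (p≤q⇒0≤q-p (∣p-q∣≤d⇒q≤p+d (seq x n) X (x-near n ≤n))
          ⊕ p≤q⇒0≤q-p (∣p-q∣≤d⇒p≤q+d (seq y n) Y (y-near n ≤n))
          ⊕ p≤q⇒0≤q-p ge ⊕ ℚ.≤ᵇ⇒≤ {0ℚ} {⅛} _ ⊗ ℚ.<⇒≤ 0<δ)
        (solve 5 (λ x X y Y d → x := y :+ con ⅛ :* d :+ ((x :+ con ⅛ :* d :- X) :+ (Y :+ con ⅛ :* d :- y) :+ (X :- (Y :+ con ½ :* d)) :+ con ⅛ :* d))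
          refl (seq x n) X (seq y n) Y δ)
        where open +-*-Solver

    -- The order of reals is not decidable, but with tolerance δ a comparison of two rational
    -- samples decides. The threshold δ/2 leaves room on either side for two Cauchy errors of δ/8.
    ≤-or-< : Eventually (λ n → seq x n ℚ.≤ seq y n ℚ.+ δ) ⊎ y < x
    ≤-or-< = case X ℚ.≤? Y ℚ.+ ½ ℚ.* δ of λ
      { (yes le) → inj₁ (M ⊔ N , below le)
      ; (no ≰)   → inj₂ (⅛ ℚ.* δ , 0<⅛* 0<δ , M ⊔ N , above (ℚ.<⇒≤ (ℚ.≰⇒> ≰))) }

  ≮⇒≥ : ∀ x y → ¬ (y < x) → x ≤ y
  ≮⇒≥ x y y≮x δ 0<δ = [ id , (λ y<x → contradiction y<x y≮x) ]′ (≤-or-< x y δ 0<δ)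

  -- Extracting a positive lower bound from x ≉ 0 would be Markov's principle; only its double
  -- negation is available.
  nonzero⇒¬¬0<∣∣ : ∀ x → ¬ (x ≈ 0ℝ) → ¬ ¬ (0ℝ < ∣ x ∣)
  nonzero⇒¬¬0<∣∣ x x≉0 ∣x∣≯0 = x≉0 λ δ 0<δ → let N , h = ≮⇒≥ ∣ x ∣ 0ℝ ∣x∣≯0 δ 0<δ in
    N , λ n ≤n → subst₂ ℚ._≤_ (cong ℚ.∣_∣ (sym (ℚ.+-identityʳ (seq x n)))) (ℚ.+-identityˡ δ) (h n ≤n)

  ¬¬-∀ : ∀ {m} {P : Fin m → Set} → (∀ i → ¬ ¬ P i) → ¬ ¬ (∀ i → P i)
  ¬¬-∀ {zero}  h k = k λ ()
  ¬¬-∀ {suc m} h k = h zero λ p → ¬¬-∀ (h ∘ suc) λ ps → k λ { zero → p ; (suc i) → ps i }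

  module _ {x l : ℝ} (k : ℕ)
    (x≥ : Eventually (λ n → ℕ→ℚ 2 ^ℚ suc k ℚ.- ½ ℚ.≤ seq x n)) (log : IsLog x l) where

    private
      -- One 1/32 is spent on the limit defining exp, one on the inequality between reals; together
      -- they are the 1/16 of `log-lower`.
      1/32 = + 1 ℚ./ 32

      0<1/32 : 0ℚ ℚ.< 1/32
      0<1/32 = ℚ.positive⁻¹ 1/32

      N₀ = proj₁ (cauchy l 1ℚ (ℚ.positive⁻¹ 1ℚ))
      N₁ = proj₁ (log 1/32 0<1/32)
      -- After N₀ the sequence l stays above its sample minus 1, hence above -B.
      B = proj₁ (archimedean (1ℚ ℚ.- seq l N₀))
      N = N₁ ⊔ B
      -- `IsLog` shifts the exponent by one, and `suc j` is `suc N * suc k`. Divisibility by `suc k`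
      -- lets the power be taken in two stages in `log-lower`.
      j = k ℕ.+ N ℕ.* suc k
      t = + 1 ℚ./ suc j

      N₁≤j : N₁ ℕ.≤ j
      N₁≤j = ℕ.≤-trans (ℕ.m≤m⊔n N₁ B) (ℕ.≤-trans (ℕ.m≤m*n N (suc k)) (ℕ.m≤n+m _ k))

      power-close : Eventually (λ n → ℚ.∣ seq ((1ℝ + fromℚ t * l) ^ suc j) n ℚ.- seq x n ∣ ℚ.≤ 1/32 ℚ.+ 1/32)
      power-close = proj₂ (log 1/32 0<1/32) j N₁≤j 1/32 0<1/32

      B≤K : B ℕ.≤ suc N ℕ.* suc k
      B≤K = ℕ.≤-trans (ℕ.≤-trans (ℕ.m≤n⊔m N₁ B) (ℕ.n≤1+n N)) (ℕ.m≤m*n (suc N) (suc k))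

      -K≤l : ∀ n → N₀ ℕ.≤ n → ℚ.- ℕ→ℚ (suc N ℕ.* suc k) ℚ.≤ seq l n
      -K≤l n ≤n = by-difference
        (p≤q⇒0≤q-p (∣p-q∣≤d⇒q≤p+d (seq l n) (seq l N₀) (proj₂ (cauchy l 1ℚ (ℚ.positive⁻¹ 1ℚ)) n N₀ ≤n ℕ.≤-refl))
          ⊕ p≤q⇒0≤q-p (proj₂ (archimedean (1ℚ ℚ.- seq l N₀))) ⊕ p≤q⇒0≤q-p (fromℕ-mono-≤ B≤K))
        (solve 4 (λ l L B K → l := :- K :+ ((l :+ con 1ℚ :- L) :+ (B :- (con 1ℚ :- L)) :+ (K :- B)))
          refl (seq l n) (seq l N₀) (ℕ→ℚ B) (ℕ→ℚ (suc N ℕ.* suc k)))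
        where open +-*-Solver

    log-lowerℝ : Eventually (λ n → ℕ→ℚ (suc k) ℚ.≤ ℕ→ℚ 4 ℚ.* seq l n)
    log-lowerℝ = let M , h = (N₀ , -K≤l) and power-close and x≥ in
      M , λ n ≤n → let lower , close , x≥ₙ = h n ≤n in
      log-lower k N t (seq x n) (seq l n) (1/n>0 j) (n*1/n≡1 j) lower
        (subst (λ p → ℚ.∣ p ℚ.- seq x n ∣ ℚ.≤ 1/32 ℚ.+ 1/32) (seq-^ (1ℝ + fromℚ t * l) (suc j) n) close)
        x≥ₙ

-- Reduction of the real statement to one late index.

module LateIndex where

  open FixedIndex using (module AtIndex)
  open RationalEstimates
  open RationalPowers using (0≤½; p≤q⇒0≤q-p; by-difference; fromℕ-*; fromℕ-^; fromℕ-mono-≤;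
    ∣p-q∣≤d⇒p≤q+d; n*1/n≡1; ¼) renaming (fromℕ to ℕ→ℚ; _⊕_ to _⊕≥0_)
  open Reals
  open import Data.Empty using (⊥)
  open import Data.Fin as Fin using (Fin; zero; suc)
  open import Data.Integer using (+_)
  open import Data.Nat as ℕ using (ℕ; zero; suc; s≤s; z≤n)
  import Data.Nat.Properties as ℕ
  open import Data.Product using (Σ; ∃; _×_; _,_; proj₁; proj₂)
  open import Data.Rational as ℚ using (ℚ; 0ℚ; 1ℚ; ½)
  import Data.Rational.Properties as ℚ
  open import Algebra.Definitions.RawSemiring ℚ.+-*-rawSemiring using () renaming (_^_ to _^ℚ_; sum to sumℚ)
  open import Data.Rational.Solver using (module +-*-Solver)
  open import Data.Sum using (inj₁; inj₂)
  open import Data.Vec.Functional using (Vector)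
  open import Function using (_∘_)
  open import Relation.Binary.PropositionalEquality
  open import Relation.Nullary using (¬_; Dec; yes; no; contradiction)

  eventually-map : ∀ {P Q : ℕ → Set} → (∀ n → P n → Q n) → Eventually P → Eventually Q
  eventually-map f (N , p) = N , λ n ≤n → f n (p n ≤n)

  -- The threshold in the hypothesis may depend on the proof of `A`; deciding `A` fixes it
  -- beforehand.
  eventually-⇒ : ∀ {A : Set} {P : ℕ → Set} → Dec A → (A → Eventually P) → Eventually (λ n → A → P n)
  eventually-⇒ (yes a) h = eventually-map (λ _ p _ → p) (h a)
  eventually-⇒ (no ¬a) h = 0 , λ _ _ a → contradiction a ¬a

  0<⊓ : ∀ {p q} → 0ℚ ℚ.< p → 0ℚ ℚ.< q → 0ℚ ℚ.< p ℚ.⊓ q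
  0<⊓ {p} {q} 0<p 0<q with ℚ.⊓-sel p q
  ... | inj₁ eq = subst (0ℚ ℚ.<_) (sym eq) 0<p
  ... | inj₂ eq = subst (0ℚ ℚ.<_) (sym eq) 0<q

  commonLowerBound : ∀ {m} (x : Fin m → ℝ) → (∀ i → 0ℝ < x i) →
    ∃ λ η → 0ℚ ℚ.< η × Eventually (λ n → ∀ i → η ℚ.≤ seq (x i) n)
  commonLowerBound {zero}  x 0<x = 1ℚ , ℚ.positive⁻¹ 1ℚ , 0 , λ _ _ ()
  commonLowerBound {suc m} x 0<x =
    let δ , 0<δ , δ≤ = 0<x zero
        η , 0<η , η≤ = commonLowerBound (x ∘ suc) (0<x ∘ suc)
    in δ ℚ.⊓ η , 0<⊓ 0<δ 0<η , eventually-map (λ { n (δ≤x , η≤x) →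
         λ { zero    → ℚ.≤-trans (ℚ.p⊓q≤p δ η) (ℚ.≤-trans (ℚ.≤-reflexive (sym (ℚ.+-identityˡ δ))) δ≤x)
           ; (suc i) → ℚ.≤-trans (ℚ.p⊓q≤q δ η) (η≤x i) } }) (δ≤ and η≤)

  ∃[1/n] : ∀ n → 0 ℕ.< n → ∃ λ t → 0ℚ ℚ.< t × ℕ→ℚ n ℚ.* t ≡ 1ℚ
  ∃[1/n] (suc n) _ = + 1 ℚ./ suc n , ℚ.positive⁻¹ (+ 1 ℚ./ suc n) {{ℚ.normalize-pos 1 (suc n)}} , n*1/n≡1 n

  combination-close : ∀ {m r} (w : Vector ℝ m) (c : Vector ℝ r) (v : Vector (Vector ℝ m) r) j →
    w j ≈ linearCombination c v j → ∀ τ → 0ℚ ℚ.< τ →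
    Eventually λ n → ℚ.∣ seq (w j) n ℚ.- sumℚ (λ l → seq (c l) n ℚ.* seq (v l j) n) ∣ ℚ.≤ τ
  combination-close w c v j w≈ τ 0<τ = let N , h = w≈ τ 0<τ in
    N , λ n ≤n → subst (λ s → ℚ.∣ seq (w j) n ℚ.- s ∣ ℚ.≤ τ) (seq-sum (λ l → c l * v l j) n) (h n ≤n)

  p-½≤p : ∀ p → p ℚ.- ½ ℚ.≤ p
  p-½≤p p = by-difference 0≤½ (solve 1 (λ p → p := p :- con ½ :+ con ½) refl p)
    where open +-*-Solver

  -- All hypotheses are read off at one sufficiently late index of the Cauchy
  -- sequences; the rank factorization then becomes an exact one over ℚ.
  module Contradiction
    (m : ℕ) (M : Matrix m m) (ε : ℝ) (2≤m : 2 ℕ.≤ m) (0<ε : 0ℝ < ε) (ε≤½ : ε ≤ fromℚ ½)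
    (dominant : DiagonallyDominant M) (lower : ApproximatelyLowerTriangular ε M)
    (r : ℕ) (basis : Vector (Vector ℝ m) r) (spans : ∀ i → column M i ∈Span basis)
    (inv L a logm b : ℝ)
    (inv-quotient : inv * ε ≈ 1ℝ) (inv-log : IsLog inv L)
    (a-quotient : a * (ε * L) ≈ 1ℝ)
    (m-log : IsLog (fromℕ m) logm) (b-quotient : b * logm ≈ fromℕ m)
    (W : ℕ) (c : ℚ) (W-large : 1024 ℕ.* 1024 ℕ.< W) (Wc≡1 : ℕ→ℚ W ℚ.* c ≡ 1ℚ)
    (0<diagonal : ∀ i → 0ℝ < ∣ M i i ∣)
    (small-rank : fromℕ r < fromℚ c * ((a ^ 2) ⊓ b))
    where

    open +-*-Solver using (solve; _:+_; _:-_; _:=_; con)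

    0<⅛ : 0ℚ ℚ.< ⅛
    0<⅛ = ℚ.positive⁻¹ ⅛

    0<1/64 : 0ℚ ℚ.< 1/64
    0<1/64 = ℚ.positive⁻¹ 1/64

    0≤ε : Eventually λ n → 0ℚ ℚ.≤ seq ε n
    0≤ε = let δ , 0<δ , δ≤ = 0<ε in
      eventually-map (λ n le → ℚ.≤-trans (ℚ.+-mono-≤ (ℚ.≤-refl {0ℚ}) (ℚ.<⇒≤ 0<δ)) le) δ≤

    N₀ = proj₁ (cauchy inv ⅛ 0<⅛)
    q₀ = seq inv N₀

    inv-near : Eventually λ n → ℚ.∣ seq inv n ℚ.- q₀ ∣ ℚ.≤ ⅛
    inv-near = N₀ , λ n ≤n → proj₂ (cauchy inv ⅛ 0<⅛) n N₀ ≤n ℕ.≤-refl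

    -- The sample q₀ of 1/ε may lie slightly below 2. A later sample is at least 15/8 and within 1/8
    -- of q₀, so q₀ ≥ 7/4, and the shift by 1/4 makes `dyadic` applicable.
    2≤q₀+¼ : ℕ→ℚ 2 ℚ.≤ q₀ ℚ.+ ¼
    2≤q₀+¼ =
      let n , near , close , ε≤ , 0≤εₙ = witness (inv-near and inv-quotient 1/64 0<1/64 and ε≤½ 1/64 0<1/64 and 0≤ε)
      in by-difference
           (p≤q⇒0≤q-p (∣p-q∣≤d⇒p≤q+d (seq inv n) q₀ near) ⊕≥0 p≤q⇒0≤q-p (inv≥15/8 (seq ε n) (seq inv n) 0≤εₙ close ε≤))
           (solve 2 (λ i q → q :+ con ¼ := con (ℕ→ℚ 2) :+ ((q :+ con ⅛ :- i) :+ (i :- con (+ 15 ℚ./ 8)))) refl (seq inv n) q₀)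

    -- The scale k has to be fixed before the late index, since the tolerance τ and the exponent
    -- used for the logarithm depend on it. It is therefore read off from the early sample q₀.
    module AtScales (k K : ℕ)
      (2T≤ : ℕ→ℚ 2 ^ℚ suc k ℚ.≤ q₀ ℚ.+ ¼) (≤4T : q₀ ℚ.+ ¼ ℚ.≤ ℕ→ℚ 2 ^ℚ suc (suc k))
      (U≤m : ℕ→ℚ 2 ^ℚ suc K ℚ.≤ ℕ→ℚ m) (m≤2U : ℕ→ℚ m ℚ.≤ ℕ→ℚ 2 ^ℚ suc (suc K))
      (η t : ℚ) (0<η : 0ℚ ℚ.< η) (0<t : 0ℚ ℚ.< t) (16Tt≡1 : ℕ→ℚ (16 ℕ.* 2 ℕ.^ k) ℚ.* t ≡ 1ℚ)
      (η≤ : Eventually λ n → ∀ i → η ℚ.≤ ℚ.∣ seq (M i i) n ∣)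
      where

      T τ : ℚ
      T = ℕ→ℚ 2 ^ℚ k
      -- Entries above the diagonal are compared with D/Q and not with D, so the error must be small
      -- relative to η/T: this is η/(16T).
      τ = t ℚ.* η

      0<τ : 0ℚ ℚ.< τ
      0<τ = ℚ.positive⁻¹ τ {{ℚ.pos*pos⇒pos t {{ℚ.positive 0<t}} η {{ℚ.positive 0<η}}}}

      16Tτ≡η : ℕ→ℚ 16 ℚ.* T ℚ.* τ ≡ η
      16Tτ≡η = trans (sym (ℚ.*-assoc (ℕ→ℚ 16 ℚ.* T) t η)) (trans
        (cong (λ x → x ℚ.* t ℚ.* η) (sym (trans (fromℕ-* 16 (2 ℕ.^ k)) (cong (ℕ→ℚ 16 ℚ.*_) (fromℕ-^ 2 k)))))
        (trans (cong (ℚ._* η) 16Tt≡1) (ℚ.*-identityˡ η)))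

      inv≥ : Eventually λ n → ℕ→ℚ 2 ^ℚ suc k ℚ.- ½ ℚ.≤ seq inv n
      inv≥ = eventually-map (λ n near → sample-≥ {seq inv n} {q₀} {ℕ→ℚ 2 ^ℚ suc k} near 2T≤) inv-near

      inv≤ : Eventually λ n → seq inv n ℚ.≤ ℕ→ℚ 2 ^ℚ suc (suc k)
      inv≤ = eventually-map (λ n near → sample-≤ {seq inv n} {q₀} {ℕ→ℚ 2 ^ℚ suc (suc k)} near ≤4T) inv-near

      L≥ : Eventually λ n → ℕ→ℚ (suc k) ℚ.≤ ℕ→ℚ 4 ℚ.* seq L n
      L≥ = log-lowerℝ {inv} {L} k inv≥ inv-log

      logm≥ : Eventually λ n → ℕ→ℚ (suc K) ℚ.≤ ℕ→ℚ 4 ℚ.* seq logm n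
      logm≥ = log-lowerℝ {fromℕ m} {logm} K (0 , λ n _ → subst (λ x → ℕ→ℚ 2 ^ℚ suc K ℚ.- ½ ℚ.≤ x) (sym (seq-fromℕ m n))
        (ℚ.≤-trans (p-½≤p (ℕ→ℚ 2 ^ℚ suc K)) U≤m)) m-log

      coefficient : Fin m → Fin r → ℝ
      coefficient i = proj₁ (spans i)

      entries-close : Eventually λ n → ∀ i j →
        ℚ.∣ seq (M j i) n ℚ.- sumℚ (λ l → seq (coefficient i l) n ℚ.* seq (basis l j) n) ∣ ℚ.≤ τ
      entries-close = eventually-∀ λ i → eventually-∀ λ j → at i j
        where
        at : ∀ i j → Eventually λ n →
          ℚ.∣ seq (M j i) n ℚ.- sumℚ (λ l → seq (coefficient i l) n ℚ.* seq (basis l j) n) ∣ ℚ.≤ τ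
        at i j = combination-close (column M i) (proj₁ (spans i)) basis j (proj₂ (spans i) j) τ 0<τ

      entries-dominant : Eventually λ n → ∀ i j → ℚ.∣ seq (M j i) n ∣ ℚ.≤ ℚ.∣ seq (M i i) n ∣ ℚ.+ τ
      entries-dominant = eventually-∀ λ i → eventually-∀ λ j → at i j
        where
        at : ∀ i j → Eventually λ n → ℚ.∣ seq (M j i) n ∣ ℚ.≤ ℚ.∣ seq (M i i) n ∣ ℚ.+ τ
        at i j = dominant i j τ 0<τ

      entries-lower : Eventually λ n → ∀ i j → j Fin.< i →
        ℚ.∣ seq (M j i) n ∣ ℚ.≤ seq ε n ℚ.* ℚ.∣ seq (M i i) n ∣ ℚ.+ τ
      entries-lower = eventually-∀ λ i → eventually-∀ λ j → at i j
        where
        at : ∀ i j → Eventually λ n → j Fin.< i →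
          ℚ.∣ seq (M j i) n ∣ ℚ.≤ seq ε n ℚ.* ℚ.∣ seq (M i i) n ∣ ℚ.+ τ
        at i j = eventually-⇒ (j Fin.<? i) (λ j<i → lower j i j<i τ 0<τ)

      absurd : ⊥
      absurd =
        let n , f₁ , f₂ , f₃ , f₄ , f₅ , f₆ , f₇ , f₈ , f₉ , f₁₀ , f₁₁ , f₁₂ , f₁₃ = witness
              (0≤ε and inv-quotient ⅛ 0<⅛ and inv≥ and inv≤ and L≥ and a-quotient ⅛ 0<⅛ and logm≥
                and b-quotient 1ℚ (ℚ.positive⁻¹ 1ℚ) and proj₂ (proj₂ small-rank) and η≤
                and entries-close and entries-dominant and entries-lower)
        in AtIndex.absurd m r k K W (λ j i → seq (M j i) n) (λ l j → seq (basis l j) n) (λ i l → seq (coefficient i l) n)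
             (seq ε n) (seq inv n) (seq L n) (seq a n) (seq logm n) (seq b n) c (proj₁ small-rank) η τ
             2≤m W-large Wc≡1 (ℚ.<⇒≤ (proj₁ (proj₂ small-rank))) 0<τ 16Tτ≡η U≤m m≤2U f₁ f₂ f₃ f₄ f₅ f₆ f₇
             (subst (λ x → ℚ.∣ seq b n ℚ.* seq logm n ℚ.- x ∣ ℚ.≤ 1ℚ) (seq-fromℕ m n) f₈)
             (subst (λ x → x ℚ.+ proj₁ small-rank ℚ.≤ c ℚ.* ((seq a n ℚ.* (seq a n ℚ.* 1ℚ)) ℚ.⊓ seq b n)) (seq-fromℕ r n) f₉)
             f₁₀ f₁₁ f₁₂ f₁₃

    contradictory : ⊥
    contradictory =
      let k , 2T≤ , ≤4T = dyadic (q₀ ℚ.+ ¼) 2≤q₀+¼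
          K , U≤m , m≤2U = dyadic (ℕ→ℚ m) (fromℕ-mono-≤ 2≤m)
          η , 0<η , η≤ = commonLowerBound (λ i → ∣ M i i ∣) 0<diagonal
          t , 0<t , 16Tt≡1 = ∃[1/n] (16 ℕ.* 2 ℕ.^ k) (ℕ.*-mono-< {0} {16} {0} (s≤s z≤n) (ℕ.m^n>0 2 k))
      in AtScales.absurd k K 2T≤ ≤4T U≤m m≤2U η t 0<η 0<t 16Tt≡1 η≤

open import Data.Integer using (+_)
open import Data.Product using (_,_)
import Data.Nat.Properties as ℕ
import Data.Rational as ℚ
import Data.Rational.Properties as ℚ
open RationalPowers using (n*1/n≡1)
open Reals using (≮⇒≥; ¬¬-∀; nonzero⇒¬¬0<∣∣)
open LateIndex using (module Contradiction)

-- Any C < 2⁻²⁰ would do in Exponents.endgame.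
C : ℝ
C = fromℚ (+ 1 ℚ./ ℕ.suc (1024 ℕ.* 1024))

lemma4p3 : Σ ℝ λ C → 0ℝ < C ×
    (∀ (m : ℕ) (M : Matrix m m) (ε : ℝ) →
    2 ℕ.≤ m →
    0ℝ < ε → ε ≤ fromℚ ½ →
    (∀ i → ¬ (M i i ≈ 0ℝ)) →
    DiagonallyDominant M →
    ApproximatelyLowerTriangular ε M →
    ∀ (r : ℕ) → IsRank M r →
    ∀ (1/ε log[1/ε] a logm b : ℝ) →
    IsQuotient 1ℝ ε 1/ε →
    IsLog 1/ε log[1/ε] →
    IsQuotient 1ℝ (ε * log[1/ε]) a →
    IsLog (fromℕ m) logm →
    IsQuotient (fromℕ m) logm b →
    C * ((a ^ 2) ⊓ b) ≤ fromℕ r)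
lemma4p3 = C , 0<C ,
  λ m M ε 2≤m 0<ε ε≤½ nonzero dominant lower r (basis , _ , _ , spans) 1/ε log[1/ε] a logm b
    (_ , inv-quotient) inv-log (_ , a-quotient) m-log (_ , b-quotient) →
    ≮⇒≥ (C * ((a ^ 2) ⊓ b)) (fromℕ r) λ small-rank →
      -- The goal is now absurdity, so the doubly negated positivity of the finitely many diagonal
      -- entries can be used as if it were known.
      ¬¬-∀ (λ i → nonzero⇒¬¬0<∣∣ (M i i) (nonzero i)) λ 0<diagonal →
        Contradiction.contradictory m M ε 2≤m 0<ε ε≤½ dominant lower r basis spans 1/ε log[1/ε] a logm b
          inv-quotient inv-log a-quotient m-log b-quotient
          (ℕ.suc (1024 ℕ.* 1024)) (+ 1 ℚ./ ℕ.suc (1024 ℕ.* 1024)) ℕ.≤-refl (n*1/n≡1 (1024 ℕ.* 1024))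
          0<diagonal small-rank
  where
  0<C : 0ℝ < C
  0<C = + 1 ℚ./ ℕ.suc (1024 ℕ.* 1024) , ℚ.positive⁻¹ _ {{ℚ.normalize-pos 1 (ℕ.suc (1024 ℕ.* 1024))}} ,
    0 , λ _ _ → ℚ.≤-reflexive (ℚ.+-identityˡ _)
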